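{- Let $p\ge 1$. There are constants $c,C>0$ depending only on $p$ such that for every sufficiently small $\varepsilon>0$ and every $n\ge C(d\log d)/\varepsilon^2$ the following holds. Any randomized algorithm that, given $A\in\mathbb{R}^{n\times d}$, query access to the entries of an unknown $b\in\mathbb{R}^n$, and $f\in\mathsf{Lip}_1$, outputs $\hat x\in\mathbb{R}^d$ such that, for every such input, with probability at least $4/5$, $$\|f(A\hat x)-b\|_p^p\le \mathsf{OPT}+\varepsilon\big(\mathsf{OPT}+\|Ax^*\|_p^p\big),$$ must, on some input, make at least $c\,d/\varepsilon^2$ queries to the entries of $b$.
   Context: $\mathsf{Lip}_1$ is the set of $f:\mathbb{R}\to\mathbb{R}$ with $f(0)=0$ and $|f(x)-f(y)|\le|x-y|$; $f$ is applied entrywise to vectors. $\mathsf{OPT}:=\min_{x\in\mathbb{R}^d}\|f(Ax)-b\|_p^p$ and $x^*$ is a minimizer of $\|Ax\|_p^p$ among all $x$ attaining $\mathsf{OPT}$.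
   Formalization: The formal theorem assumes d ≥ 2: for d = 1 the condition n ≥ C(d log d)/ε² reads n ≥ 0, and the claim fails (n = 1: a single query reveals b, while c/ε² > 1 for small ε). -}

module Defs where

open import Algebra.Bundles using (CommutativeRing; Semiring)
open import Axiom.ExcludedMiddle using (ExcludedMiddle)
open import Data.Fin.Base using (Fin; toℕ)
open import Data.Nat.Base as ℕ using (ℕ; zero; suc)
open import Data.Product.Base using (Σ-syntax; ∃-syntax; _×_; _,_; proj₁)
open import Data.Vec.Functional using (Vector)
open import Level using (0ℓ)
open import Relation.Binary.Bundles using (TotalOrder)
open import Relation.Binary.Core using (Rel)
open import Relation.Binary.PropositionalEquality.Core using (_≢_)
open import Relation.Binary.Structures using (IsTotalOrder)
open import Relation.Nullary using (¬_; yes; no)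
open import Relation.Unary using (Pred; _∈_; _⊆_; _≐_; _∩_; ∁; U; Empty; Satisfiable; ⋃)

import Algebra.Construct.NaturalChoice.Max as Max
import Algebra.Definitions.RawSemiring as RawSemiringDefs
import Relation.Binary.Construct.NonStrictToStrict as ToStrict

-- The real numbers are handled through their categorical axiomatisation:
-- a Dedekind-complete ordered field, with setoid equality.
record CompleteOrderedField : Set₁ where
  infix 4 _≤_
  infix 8 _⁻¹
  field
    commutativeRing : CommutativeRing 0ℓ 0ℓ

  open CommutativeRing commutativeRing public

  field
    _≤_          : Rel Carrier 0ℓ
    isTotalOrder : IsTotalOrder _≈_ _≤_
    +-monoˡ-≤    : ∀ z {x y} → x ≤ y → x + z ≤ y + z
    *-nonNeg     : ∀ {x y} → 0# ≤ x → 0# ≤ y → 0# ≤ x * y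
    0#≉1#        : ¬ (0# ≈ 1#)
    -- The value of 0# ⁻¹ is unspecified.
    _⁻¹          : Carrier → Carrier
    *-inverseʳ   : ∀ {x} → ¬ (x ≈ 0#) → x * x ⁻¹ ≈ 1#

  IsUpperBound : Pred Carrier 0ℓ → Carrier → Set
  IsUpperBound P u = ∀ {x} → x ∈ P → x ≤ u

  IsSupremum : Pred Carrier 0ℓ → Carrier → Set
  IsSupremum P s = IsUpperBound P s × (∀ {u} → IsUpperBound P u → s ≤ u)

  field
    complete : ∀ P → Satisfiable P → ∃[ u ] IsUpperBound P u →
               ∃[ s ] IsSupremum P s

  totalOrder : TotalOrder 0ℓ 0ℓ 0ℓ
  totalOrder = record { isTotalOrder = isTotalOrder }

  open ToStrict _≈_ _≤_ public using (_<_)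
  open Max totalOrder public using (_⊔_)
  -- _^_ is the natural-number power.
  open RawSemiringDefs (Semiring.rawSemiring semiring) public using (sum; _^_)
  open RawSemiringDefs (Semiring.rawSemiring semiring) using () renaming (_×_ to _·_)

  infixl 7 _/_
  _/_ : Carrier → Carrier → Carrier
  x / y = x * y ⁻¹

  fromℕ : ℕ → Carrier
  fromℕ n = n · 1#

  ∣_∣ : Carrier → Carrier
  ∣ x ∣ = x ⊔ (- x)

-- Finitely many steps along every branch; the next entry may depend on the
-- answers received so far, and repeated queries are counted again.
data QueryTree (n : ℕ) (Answer Out : Set) : Set where
  output : Out → QueryTree n Answer Out
  query  : Fin n → (Answer → QueryTree n Answer Out) → QueryTree n Answer Out

module _ {n : ℕ} {Answer Out : Set} where

  result : QueryTree n Answer Out → Vector Answer n → Out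
  result (output x)  b = x
  result (query i k) b = result (k (b i)) b

  queryCount : QueryTree n Answer Out → Vector Answer n → ℕ
  queryCount (output x)  b = zero
  queryCount (query i k) b = suc (queryCount (k (b i)) b)

module Regression (em : ∀ {ℓ} → ExcludedMiddle ℓ) (F : CompleteOrderedField) where

  open CompleteOrderedField F public renaming (Carrier to ℝ)

  -- The value 0# is used when P is empty or unbounded above.
  sup : Pred ℝ 0ℓ → ℝ
  sup P with em {P = Satisfiable P × ∃[ u ] IsUpperBound P u}
  ... | yes (nonempty , bounded) = proj₁ (complete P nonempty bounded)
  ... | no  _                    = 0#

  -- (1 + x / n)ⁿ increases to eˣ along the n ≥ 1 with 1 + x / n ≥ 0.
  exp : ℝ → ℝ
  exp x = sup λ y → ∃[ n ] 1 ℕ.≤ n × - fromℕ n ≤ x × y ≈ (1# + x / fromℕ n) ^ n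

  -- Natural logarithm; meaningful for positive x only.
  log : ℝ → ℝ
  log x = sup λ y → exp y ≤ x

  -- Real power; meaningful for a nonnegative base and a positive exponent.
  infixr 8 _^ᵣ_
  _^ᵣ_ : ℝ → ℝ → ℝ
  x ^ᵣ p with em {P = x ≈ 0#}
  ... | yes _ = 0#
  ... | no  _ = exp (p * log x)

  Matrix : ℕ → ℕ → Set
  Matrix n d = Fin n → Fin d → ℝ

  infixr 7 _*ᵥ_
  _*ᵥ_ : ∀ {n d} → Matrix n d → Vector ℝ d → Vector ℝ n
  (A *ᵥ x) i = sum λ j → A i j * x j

  ‖_‖^ : ∀ {n} → Vector ℝ n → ℝ → ℝ
  ‖ v ‖^ p = sum λ i → ∣ v i ∣ ^ᵣ p

  -- Compatibility of fun with _≈_ follows from lipschitz.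
  record Lip₁ : Set where
    field
      fun       : ℝ → ℝ
      fun-0     : fun 0# ≈ 0#
      lipschitz : ∀ x y → ∣ fun x - fun y ∣ ≤ ∣ x - y ∣
  open Lip₁ public

  record Input (n d : ℕ) : Set where
    field
      A : Matrix n d
      b : Vector ℝ n
      f : Lip₁

  module _ {n d : ℕ} (p : ℝ) (I : Input n d) where
    open Input I

    loss : Vector ℝ d → ℝ
    loss x = ‖ (λ i → fun f ((A *ᵥ x) i) - b i) ‖^ p

    size : Vector ℝ d → ℝ
    size x = ‖ A *ᵥ x ‖^ p

    IsOPT : ℝ → Set
    IsOPT opt = (∃[ x ] loss x ≈ opt) × (∀ x → opt ≤ loss x)

    IsReference : ℝ → Vector ℝ d → Set
    IsReference opt x* =
      loss x* ≈ opt × (∀ x → loss x ≈ opt → size x* ≤ size x)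

    -- The infimum of the loss need not be attained (bounded f); OPT and x*
    -- only make sense for inputs where it is.
    HasOPT : Set
    HasOPT = ∃[ opt ] ∃[ x* ] IsOPT opt × IsReference opt x*

    IsAccurate : ℝ → Vector ℝ d → Set
    IsAccurate ε x̂ = ∀ opt x* → IsOPT opt → IsReference opt x* →
      loss x̂ ≤ opt + ε * (opt + size x*)

  -- μ is total on predicates, but constrained only on measurable ones.
  record ProbabilitySpace : Set₁ where
    field
      Ω          : Set
      Measurable : Pred (Pred Ω 0ℓ) 0ℓ
      μ          : Pred Ω 0ℓ → ℝ

      measurable-resp : ∀ {E E′} → E ≐ E′ → Measurable E → Measurable E′
      measurable-U    : Measurable U
      measurable-∁    : ∀ {E} → Measurable E → Measurable (∁ E)
      measurable-⋃    : ∀ (E : ℕ → Pred Ω 0ℓ) → (∀ i → Measurable (E i)) →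
                        Measurable (⋃ ℕ E)

      μ-resp   : ∀ {E E′} → Measurable E → E ≐ E′ → μ E ≈ μ E′
      μ-nonNeg : ∀ {E} → Measurable E → 0# ≤ μ E
      μ-U      : μ U ≈ 1#
      μ-⋃      : ∀ (E : ℕ → Pred Ω 0ℓ) → (∀ i → Measurable (E i)) →
                 (∀ {i j} → i ≢ j → Empty (E i ∩ E j)) →
                 IsSupremum
                   (λ s → ∃[ k ] s ≈ sum {k} (λ i → μ (E (toℕ i))))
                   (μ (⋃ ℕ E))

    ProbabilityAtLeast : ℝ → Pred Ω 0ℓ → Set
    ProbabilityAtLeast q E = Measurable E × q ≤ μ E

    Null : Pred Ω 0ℓ → Set₁
    Null E = Σ[ N ∈ Pred Ω 0ℓ ] Measurable N × μ N ≈ 0# × E ⊆ N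

  -- A and f are given in full; b is accessible only through queries.
  record RandomizedAlgorithm (n d : ℕ) : Set₁ where
    field
      space : ProbabilitySpace
    open ProbabilitySpace space public
    field
      tree : Matrix n d → Lip₁ → Ω → QueryTree n ℝ (Vector ℝ d)

    run : Input n d → Ω → Vector ℝ d
    run I ω = result (tree (Input.A I) (Input.f I) ω) (Input.b I)

    queries : Input n d → Ω → ℕ
    queries I ω = queryCount (tree (Input.A I) (Input.f I) ω) (Input.b I)

    Solves : ℝ → ℝ → Set
    Solves p ε = ∀ I → HasOPT p I →
      ProbabilityAtLeast (fromℕ 4 / fromℕ 5) (λ ω → IsAccurate p I ε (run I ω))

    -- At least q queries with positive probability.
    MakesAtLeast : ℝ → Input n d → Set₁
    MakesAtLeast q I = ¬ Null (λ ω → q ≤ fromℕ (queries I ω))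

module Submission where

-- The hard inputs consist of d blocks, one per coordinate of x, of m ≈ (θ/ε)² uniform random bits,
-- and a 1-Lipschitz f for which an optimal coordinate is 0 or 3 according to the majority bit of
-- its block. If S_j is the sum of the signs of block j, an accurate output has signs σ_j with
-- Σ ∣S_j∣ - Σ σ_j S_j ≤ t, where t is a small multiple of d √m. For a deterministic algorithm,
-- flipping all unread bits preserves the output and negates their contribution to S_j, so of each
-- such pair of inputs at most one is solved, unless Σ ∣S_j∣ is at most t + Σ ∣R_j∣ on average over
-- the pair, where R_j is the sum of the signs read. The read part is small, because
-- 𝔼 Σ R_j² is at most the number of queries; and Σ ∣S_j∣ is rarely small by Chebyshev's
-- inequality, the mean of ∣S_j∣ being bounded below by the second and fourth moments. With
-- d ≥ 2 blocks this leaves a success probability below 4/5. A randomized algorithm is averaged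
-- over its randomness.

open import Defs
open import Axiom.ExcludedMiddle using (ExcludedMiddle)
open import Data.Bool.Base using (Bool; true; false; not; _xor_)
open import Data.Empty using (⊥-elim)
open import Data.Fin.Base using (Fin; zero; suc; toℕ; splitAt; remQuot; quotRem)
open import Data.Integer.Base as ℤ using (ℤ; +_; -[1+_])
open import Data.List.Base using (List; []; _∷_; _++_; map)
open import Data.Maybe.Base using (Maybe; just; nothing)
open import Data.Nat.Base as ℕ using (ℕ; zero; suc)
open import Data.Product.Base using (∃-syntax; _×_; _,_; proj₁; proj₂; swap; map₂)
open import Data.Sum.Base as Sum using (_⊎_; inj₁; inj₂; [_,_]′)
open import Data.Vec.Base as Vec using (Vec; []; _∷_)
open import Data.Vec.Functional using (Vector)
open import Function.Base using (_∘_; id; const)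
open import Level using (0ℓ)
open import Relation.Binary.Bundles using (TotalOrder)
open import Relation.Binary.Definitions using (WeaklyDecidable)
open import Relation.Binary.PropositionalEquality.Core as ≡ using (_≡_; _≢_)
open import Relation.Nullary using (¬_; yes; no; contradiction)
open import Relation.Unary using (Pred; _∈_; _⊆_; _≐_; _∩_; _∪_; ∁; U; ∅; Empty; Satisfiable; ⋃)

import Algebra.Construct.NaturalChoice.Max as Max
import Algebra.Construct.NaturalChoice.Min as Min
import Algebra.Properties.CommutativeSemiring.Exp as ExpProperties
import Algebra.Properties.Ring as RingProperties
import Algebra.Properties.Semiring.Mult as SemiringMult
import Algebra.Properties.Semiring.Sum as SemiringSum
import Algebra.Solver.Ring as RingSolver
import Algebra.Solver.Ring.AlmostCommutativeRing as ACR
import Data.Fin.Properties as Fin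
import Data.Integer.Properties as ℤ
import Data.Nat.Properties as ℕ
import Data.Vec.Properties as Vec
import Relation.Binary.Reasoning.PartialOrder as PartialOrderReasoning

-- A 1-Lipschitz `f` cannot jump from 0 to 1, and for p > 1 an intermediate value of `f` may fit
-- mixed bits better than 0 or 1 does, so the majority bit alone would not govern the optimum. Rows
-- at twice the scale with right-hand side 0 repair this: doubling carries the transition onto a
-- plateau of height 1, where these rows cost as much as missing every bit. The isolated zero of `f`
-- at 6 exempts the coordinate 3 from that cost. It also makes 3 the only optimal coordinate of a
-- block with a strict majority of ones, so that OPT and x* exist and are explicit although `f` is
-- bounded. Only residuals 0 and ±1 then matter, and p enters through constants alone. No event is
-- ever conditioned on. With Y = Σ ∣S_j∣ and a free centre a, Chebyshev's inequality appears as the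
-- pointwise fact (1 - Y/a)² ≥ 1 - 2Y/a. The number of wins in a flipped pair is thus bounded by an
-- expression whose expectation passes through the induction over the query tree one query at a
-- time.

-- Arithmetic of a complete ordered field, with a ring solver

module OrderedFieldProperties (em : ∀ {ℓ} → ExcludedMiddle ℓ) (F : CompleteOrderedField) where

  open Regression em F
  open RingProperties ring using (-0#≈0#; -‿distribˡ-*; -‿distribʳ-*; -‿involutive; -‿+-comm)
  open SemiringMult semiring using (×-homo-+; ×1-homo-*)
  open TotalOrder totalOrder public
    using (poset; ≤-respˡ-≈; ≤-respʳ-≈)
    renaming (refl to ≤-refl; reflexive to ≤-reflexive; trans to ≤-trans; antisym to ≤-antisym; total to ≤-total)
  open PartialOrderReasoning poset public

  private
    ⟦_⟧ℤ : ℤ → ℝ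
    ⟦ + n ⟧ℤ      = fromℕ n
    ⟦ -[1+ n ] ⟧ℤ = - fromℕ (suc n)

    acr = ACR.fromCommutativeRing commutativeRing

    a+b-a+c : ∀ a b c → (a + b) - (a + c) ≈ b - c
    a+b-a+c a b c = begin-equality
      (a + b) - (a + c)     ≈⟨ +-congˡ (sym (-‿+-comm a c)) ⟩
      (a + b) + (- a + - c) ≈⟨ sym (+-assoc _ _ _) ⟩
      ((a + b) + - a) + - c ≈⟨ +-congʳ (trans (+-congʳ (+-comm a b)) (+-assoc b a (- a))) ⟩
      (b + (a + - a)) + - c ≈⟨ +-congʳ (trans (+-congˡ (-‿inverseʳ a)) (+-identityʳ b)) ⟩
      b - c                 ∎

    ⊖-homo : ∀ m n → ⟦ m ℤ.⊖ n ⟧ℤ ≈ fromℕ m - fromℕ n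
    ⊖-homo m       zero    = sym (trans (+-congˡ -0#≈0#) (+-identityʳ _))
    ⊖-homo zero    (suc n) = sym (+-identityˡ _)
    ⊖-homo (suc m) (suc n) = begin-equality
      ⟦ suc m ℤ.⊖ suc n ⟧ℤ    ≡⟨ ≡.cong ⟦_⟧ℤ (ℤ.[1+m]⊖[1+n]≡m⊖n m n) ⟩
      ⟦ m ℤ.⊖ n ⟧ℤ            ≈⟨ ⊖-homo m n ⟩
      fromℕ m - fromℕ n       ≈⟨ sym (a+b-a+c 1# _ _) ⟩
      fromℕ (suc m) - fromℕ (suc n) ∎

    -homo : ∀ i → ⟦ ℤ.- i ⟧ℤ ≈ - ⟦ i ⟧ℤ
    -homo (+ zero)  = sym -0#≈0#
    -homo (+ suc n) = refl
    -homo -[1+ n ]  = sym (-‿involutive _)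

    +homo : ∀ i j → ⟦ i ℤ.+ j ⟧ℤ ≈ ⟦ i ⟧ℤ + ⟦ j ⟧ℤ
    +homo (+ m)    (+ n)    = ×-homo-+ 1# m n
    +homo (+ m)    -[1+ n ] = ⊖-homo m (suc n)
    +homo -[1+ m ] (+ n)    = trans (⊖-homo n (suc m)) (+-comm _ _)
    +homo -[1+ m ] -[1+ n ] = begin-equality
      - fromℕ (suc (suc (m ℕ.+ n)))          ≡⟨ ≡.cong (λ k → - fromℕ (suc k)) (≡.sym (ℕ.+-suc m n)) ⟩
      - fromℕ (suc m ℕ.+ suc n)              ≈⟨ -‿cong (×-homo-+ 1# (suc m) (suc n)) ⟩
      - (fromℕ (suc m) + fromℕ (suc n))      ≈⟨ sym (-‿+-comm _ _) ⟩
      - fromℕ (suc m) + - fromℕ (suc n)      ∎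

    *homo : ∀ i j → ⟦ i ℤ.* j ⟧ℤ ≈ ⟦ i ⟧ℤ * ⟦ j ⟧ℤ
    *homo (+ m) (+ n) = begin-equality
      ⟦ + m ℤ.* + n ⟧ℤ  ≡⟨ ≡.cong ⟦_⟧ℤ (≡.sym (ℤ.pos-* m n)) ⟩
      fromℕ (m ℕ.* n)   ≈⟨ ×1-homo-* m n ⟩
      fromℕ m * fromℕ n ∎
    *homo (+ m) -[1+ n ] = begin-equality
      ⟦ + m ℤ.* -[1+ n ] ⟧ℤ         ≡⟨ ≡.cong ⟦_⟧ℤ (≡.sym (ℤ.neg-distribʳ-* (+ m) (+ suc n))) ⟩
      ⟦ ℤ.- (+ m ℤ.* + suc n) ⟧ℤ    ≈⟨ -homo (+ m ℤ.* + suc n) ⟩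
      - ⟦ + m ℤ.* + suc n ⟧ℤ        ≈⟨ -‿cong (*homo (+ m) (+ suc n)) ⟩
      - (fromℕ m * fromℕ (suc n))   ≈⟨ -‿distribʳ-* _ _ ⟩
      fromℕ m * - fromℕ (suc n)     ∎
    *homo -[1+ m ] (+ n) = begin-equality
      ⟦ -[1+ m ] ℤ.* + n ⟧ℤ         ≡⟨ ≡.cong ⟦_⟧ℤ (≡.sym (ℤ.neg-distribˡ-* (+ suc m) (+ n))) ⟩
      ⟦ ℤ.- (+ suc m ℤ.* + n) ⟧ℤ    ≈⟨ -homo (+ suc m ℤ.* + n) ⟩
      - ⟦ + suc m ℤ.* + n ⟧ℤ        ≈⟨ -‿cong (*homo (+ suc m) (+ n)) ⟩
      - (fromℕ (suc m) * fromℕ n)   ≈⟨ -‿distribˡ-* _ _ ⟩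
      - fromℕ (suc m) * fromℕ n     ∎
    *homo -[1+ m ] -[1+ n ] = begin-equality
      fromℕ (suc m ℕ.* suc n)             ≈⟨ ×1-homo-* (suc m) (suc n) ⟩
      fromℕ (suc m) * fromℕ (suc n)       ≈⟨ sym (-‿involutive _) ⟩
      - - (fromℕ (suc m) * fromℕ (suc n)) ≈⟨ -‿cong (-‿distribʳ-* _ _) ⟩
      - (fromℕ (suc m) * - fromℕ (suc n)) ≈⟨ -‿distribˡ-* _ _ ⟩
      - fromℕ (suc m) * - fromℕ (suc n)   ∎

    morphism : ℤ.+-*-rawRing ACR.-Raw-AlmostCommutative⟶ acr
    morphism = record
      { ⟦_⟧    = ⟦_⟧ℤ
      ; +-homo = +homo
      ; *-homo = *homo
      ; -‿homo = -homo
      ; 0-homo = refl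
      ; 1-homo = +-identityʳ 1#
      }

    coeff≟ : WeaklyDecidable (ACR.Induced-equivalence morphism)
    coeff≟ i j with i ℤ.≟ j
    ... | yes i≡j = just (reflexive (≡.cong ⟦_⟧ℤ i≡j))
    ... | no  _   = nothing

  -- The integers as coefficients, so that numerals are fromℕ literals.
  open RingSolver ℤ.+-*-rawRing acr morphism coeff≟ public
    using (solve; con; _:=_; _:+_; _:*_; _:-_; :-_; Polynomial)

  -- `fromℕ 1` unfolds to `1# + 0#`, so `:n 1` does not stand for `1#`. Where `1#` itself occurs it
  -- is passed to the solver as a variable, and the identity is made homogeneous by extra factors
  -- `1#`, or it is first rewritten by `fromℕ-1`.
  :n : ∀ {k} → ℕ → Polynomial k
  :n n = con (+ n)

  fromℕ-1 : fromℕ 1 ≈ 1#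
  fromℕ-1 = +-identityʳ 1#

  fromℕ-+ : ∀ m n → fromℕ (m ℕ.+ n) ≈ fromℕ m + fromℕ n
  fromℕ-+ = ×-homo-+ 1#

  fromℕ-* : ∀ m n → fromℕ (m ℕ.* n) ≈ fromℕ m * fromℕ n
  fromℕ-* = ×1-homo-*

  x≤y⇒0≤y-x : ∀ {x y} → x ≤ y → 0# ≤ y - x
  x≤y⇒0≤y-x {x} {y} x≤y = ≤-respˡ-≈ (-‿inverseʳ x) (+-monoˡ-≤ (- x) x≤y)

  -- To derive x ≤ y from other inequalities, exhibit y - x as a nonnegative combination d of them.
  ≤-slack : ∀ {x y d} → 0# ≤ d → x + d ≈ y → x ≤ y
  ≤-slack {x} {y} {d} 0≤d x+d≈y = begin
    x      ≈⟨ sym (+-identityˡ x) ⟩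
    0# + x ≤⟨ +-monoˡ-≤ x 0≤d ⟩
    d + x  ≈⟨ +-comm d x ⟩
    x + d  ≈⟨ x+d≈y ⟩
    y      ∎

  +-nonNeg : ∀ {x y} → 0# ≤ x → 0# ≤ y → 0# ≤ x + y
  +-nonNeg {x} {y} 0≤x 0≤y = ≤-trans 0≤y (≤-slack 0≤x (+-comm y x))

  +-mono-≤ : ∀ {x y u v} → x ≤ y → u ≤ v → x + u ≤ y + v
  +-mono-≤ {x} {y} {u} {v} x≤y u≤v =
    ≤-slack (+-nonNeg (x≤y⇒0≤y-x x≤y) (x≤y⇒0≤y-x u≤v))
      (solve 4 (λ x y u v → x :+ u :+ (y :- x :+ (v :- u)) := y :+ v) refl x y u v)

  +-monoʳ-≤ : ∀ z {x y} → x ≤ y → z + x ≤ z + y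
  +-monoʳ-≤ z = +-mono-≤ ≤-refl

  neg-antimono-≤ : ∀ {x y} → x ≤ y → - y ≤ - x
  neg-antimono-≤ {x} {y} x≤y =
    ≤-slack (x≤y⇒0≤y-x x≤y) (solve 2 (λ x y → :- y :+ (y :- x) := :- x) refl x y)

  x≤0⇒0≤-x : ∀ {x} → x ≤ 0# → 0# ≤ - x
  x≤0⇒0≤-x x≤0 = ≤-respˡ-≈ -0#≈0# (neg-antimono-≤ x≤0)

  0≤y-x⇒x≤y : ∀ {x y} → 0# ≤ y - x → x ≤ y
  0≤y-x⇒x≤y {x} {y} h = ≤-slack h (solve 2 (λ x y → x :+ (y :- x) := y) refl x y)

  *-monoˡ-≤ : ∀ {z x y} → 0# ≤ z → x ≤ y → z * x ≤ z * y
  *-monoˡ-≤ {z} {x} {y} 0≤z x≤y =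
    ≤-slack (*-nonNeg 0≤z (x≤y⇒0≤y-x x≤y))
      (solve 3 (λ z x y → z :* x :+ z :* (y :- x) := z :* y) refl z x y)

  *-monoʳ-≤ : ∀ {z x y} → 0# ≤ z → x ≤ y → x * z ≤ y * z
  *-monoʳ-≤ 0≤z x≤y = ≤-respˡ-≈ (*-comm _ _) (≤-respʳ-≈ (*-comm _ _) (*-monoˡ-≤ 0≤z x≤y))

  *-mono-≤ : ∀ {x y u v} → 0# ≤ x → 0# ≤ u → x ≤ y → u ≤ v → x * u ≤ y * v
  *-mono-≤ 0≤x 0≤u x≤y u≤v = ≤-trans (*-monoˡ-≤ 0≤x u≤v) (*-monoʳ-≤ (≤-trans 0≤u u≤v) x≤y)

  square-nonNeg : ∀ x → 0# ≤ x * x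
  square-nonNeg x with ≤-total 0# x
  ... | inj₁ 0≤x = *-nonNeg 0≤x 0≤x
  ... | inj₂ x≤0 = ≤-respʳ-≈ (solve 1 (λ x → :- x :* :- x := x :* x) refl x)
                     (*-nonNeg (x≤0⇒0≤-x x≤0) (x≤0⇒0≤-x x≤0))

  0≤1 : 0# ≤ 1#
  0≤1 = ≤-respʳ-≈ (*-identityˡ 1#) (square-nonNeg 1#)

  0<1 : 0# < 1#
  0<1 = 0≤1 , 0#≉1#

  fromℕ-nonNeg : ∀ n → 0# ≤ fromℕ n
  fromℕ-nonNeg zero    = ≤-refl
  fromℕ-nonNeg (suc n) = +-nonNeg 0≤1 (fromℕ-nonNeg n)

  fromℕ-mono : ∀ {m n} → m ℕ.≤ n → fromℕ m ≤ fromℕ n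
  fromℕ-mono {n = n} ℕ.z≤n = fromℕ-nonNeg n
  fromℕ-mono (ℕ.s≤s m≤n) = +-monoʳ-≤ 1# (fromℕ-mono m≤n)

  <-≤-trans : ∀ {x y z} → x < y → y ≤ z → x < z
  <-≤-trans (x≤y , x≉y) y≤z =
    ≤-trans x≤y y≤z , λ x≈z → x≉y (≤-antisym x≤y (≤-respʳ-≈ (sym x≈z) y≤z))

  ≤-<-trans : ∀ {x y z} → x ≤ y → y < z → x < z
  ≤-<-trans x≤y (y≤z , y≉z) =
    ≤-trans x≤y y≤z , λ x≈z → y≉z (≤-antisym y≤z (≤-respˡ-≈ x≈z x≤y))

  <⇒≱ : ∀ {x y} → x < y → ¬ (y ≤ x)
  <⇒≱ (x≤y , x≉y) y≤x = x≉y (≤-antisym x≤y y≤x)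

  ≰⇒> : ∀ {x y} → ¬ (x ≤ y) → y < x
  ≰⇒> {x} {y} x≰y with ≤-total x y
  ... | inj₁ x≤y = contradiction x≤y x≰y
  ... | inj₂ y≤x = y≤x , λ y≈x → x≰y (≤-reflexive (sym y≈x))

  <⊎≥ : ∀ x y → (x < y) ⊎ (y ≤ x)
  <⊎≥ x y with em {P = y ≤ x}
  ... | yes y≤x = inj₂ y≤x
  ... | no  y≰x = inj₁ (≰⇒> y≰x)

  <-slack : ∀ {x y d} → 0# < d → x + d ≈ y → x < y
  <-slack {x} {y} {d} (0≤d , 0≉d) x+d≈y = ≤-slack 0≤d x+d≈y , λ x≈y → 0≉d (begin-equality
    0#          ≈⟨ sym (-‿inverseʳ y) ⟩
    y - y       ≈⟨ +-cong (sym x+d≈y) (-‿cong (sym x≈y)) ⟩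
    (x + d) - x ≈⟨ solve 2 (λ x d → x :+ d :- x := d) refl x d ⟩
    d           ∎)

  x<y⇒0<y-x : ∀ {x y} → x < y → 0# < y - x
  x<y⇒0<y-x {x} {y} (x≤y , x≉y) = x≤y⇒0≤y-x x≤y , λ 0≈y-x → x≉y (begin-equality
    x           ≈⟨ sym (+-identityʳ x) ⟩
    x + 0#      ≈⟨ +-congˡ 0≈y-x ⟩
    x + (y - x) ≈⟨ solve 2 (λ x y → x :+ (y :- x) := y) refl x y ⟩
    y           ∎)

  <-resp-≈ʳ : ∀ {x y z} → y ≈ z → x < y → x < z
  <-resp-≈ʳ y≈z x<y = <-≤-trans x<y (≤-reflexive y≈z)

  +-pos : ∀ {x y} → 0# < x → 0# ≤ y → 0# < x + y
  +-pos {x} {y} 0<x 0≤y = <-≤-trans 0<x (≤-slack 0≤y refl)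

  fromℕ-pos : ∀ n → 0# < fromℕ (suc n)
  fromℕ-pos n = +-pos 0<1 (fromℕ-nonNeg n)

  fromℕ-cancel-≤ : ∀ m n → fromℕ m ≤ fromℕ n → m ℕ.≤ n
  fromℕ-cancel-≤ m n h with m ℕ.≤? n
  ... | yes m≤n = m≤n
  ... | no  m≰n = contradiction h (<⇒≱ (<-≤-trans
          (<-slack 0<1 (+-comm (fromℕ n) 1#)) (fromℕ-mono (ℕ.≰⇒> m≰n))))

  pos⇒≉0 : ∀ {x} → 0# < x → ¬ (x ≈ 0#)
  pos⇒≉0 (_ , 0≉x) x≈0 = 0≉x (sym x≈0)

  *-inverse-pos : ∀ {x} → 0# < x → x * x ⁻¹ ≈ 1#
  *-inverse-pos 0<x = *-inverseʳ (pos⇒≉0 0<x)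

  *-cancelˡ-≤ : ∀ {z x y} → 0# < z → z * x ≤ z * y → x ≤ y
  *-cancelˡ-≤ {z} {x} {y} 0<z h with ≤-total x y
  ... | inj₁ x≤y = x≤y
  ... | inj₂ y≤x = ≤-reflexive (begin-equality
    x               ≈⟨ lemma x ⟩
    z ⁻¹ * (z * x)  ≈⟨ *-congˡ (≤-antisym h (*-monoˡ-≤ (proj₁ 0<z) y≤x)) ⟩
    z ⁻¹ * (z * y)  ≈⟨ sym (lemma y) ⟩
    y               ∎)
    where
    lemma : ∀ w → w ≈ z ⁻¹ * (z * w)
    lemma w = begin-equality
      w              ≈⟨ sym (*-identityˡ w) ⟩
      1# * w         ≈⟨ *-congʳ (sym (*-inverse-pos 0<z)) ⟩
      z * z ⁻¹ * w   ≈⟨ solve 3 (λ z i w → z :* i :* w := i :* (z :* w)) refl z (z ⁻¹) w ⟩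
      z ⁻¹ * (z * w) ∎

  ⁻¹-pos : ∀ {x} → 0# < x → 0# < x ⁻¹
  ⁻¹-pos {x} 0<x = *-cancelˡ-≤ 0<x
      (≤-respˡ-≈ (sym (zeroʳ x)) (≤-respʳ-≈ (sym (*-inverse-pos 0<x)) 0≤1))
    , λ 0≈x⁻¹ → 0#≉1# (trans (sym (trans (*-congˡ (sym 0≈x⁻¹)) (zeroʳ x))) (*-inverse-pos 0<x))

  *-pos : ∀ {x y} → 0# < x → 0# < y → 0# < x * y
  *-pos {x} {y} 0<x@(0≤x , _) (0≤y , 0≉y) = *-nonNeg 0≤x 0≤y , λ 0≈xy → 0≉y (begin-equality
    0#              ≈⟨ sym (zeroʳ _) ⟩
    x ⁻¹ * 0#       ≈⟨ *-congˡ 0≈xy ⟩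
    x ⁻¹ * (x * y)  ≈⟨ solve 3 (λ x i y → i :* (x :* y) := x :* i :* y) refl x (x ⁻¹) y ⟩
    x * x ⁻¹ * y    ≈⟨ *-congʳ (*-inverse-pos 0<x) ⟩
    1# * y          ≈⟨ *-identityˡ y ⟩
    y               ∎)

  /-pos : ∀ {x y} → 0# < x → 0# < y → 0# < x / y
  /-pos 0<x 0<y = *-pos 0<x (⁻¹-pos 0<y)

  y*[x/y]≈x : ∀ {x y} → 0# < y → y * (x / y) ≈ x
  y*[x/y]≈x {x} {y} 0<y = begin-equality
    y * (x * y ⁻¹)  ≈⟨ solve 3 (λ x y i → y :* (x :* i) := x :* (y :* i)) refl x y (y ⁻¹) ⟩
    x * (y * y ⁻¹)  ≈⟨ *-congˡ (*-inverse-pos 0<y) ⟩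
    x * 1#          ≈⟨ *-identityʳ x ⟩
    x               ∎

  x≤y/z : ∀ {x y z} → 0# < z → z * x ≤ y → x ≤ y / z
  x≤y/z 0<z h = *-cancelˡ-≤ 0<z (≤-respʳ-≈ (sym (y*[x/y]≈x 0<z)) h)

  x/z≤y : ∀ {x y z} → 0# < z → x ≤ z * y → x / z ≤ y
  x/z≤y 0<z h = *-cancelˡ-≤ 0<z (≤-respˡ-≈ (sym (y*[x/y]≈x 0<z)) h)

  z*y≤x : ∀ {x y z} → 0# < z → y ≤ x / z → z * y ≤ x
  z*y≤x 0<z h = ≤-respʳ-≈ (y*[x/y]≈x 0<z) (*-monoˡ-≤ (proj₁ 0<z) h)

  open Max totalOrder public
    using (⊔-lub; x≤x⊔y; x≤y⊔x; ⊔-cong; x≤y⇒x⊔y≈y; x≤y⇒y⊔x≈y)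

  x≤∣x∣ : ∀ x → x ≤ ∣ x ∣
  x≤∣x∣ x = x≤x⊔y x (- x)

  -x≤∣x∣ : ∀ x → - x ≤ ∣ x ∣
  -x≤∣x∣ x = x≤y⊔x x (- x)

  ∣∣-lub : ∀ {x y} → x ≤ y → - x ≤ y → ∣ x ∣ ≤ y
  ∣∣-lub = ⊔-lub

  ∣∣-cong : ∀ {x y} → x ≈ y → ∣ x ∣ ≈ ∣ y ∣
  ∣∣-cong x≈y = ⊔-cong x≈y (-‿cong x≈y)

  ∣x∣≈x : ∀ {x} → 0# ≤ x → ∣ x ∣ ≈ x
  ∣x∣≈x {x} 0≤x = x≤y⇒y⊔x≈y (≤-trans (≤-respʳ-≈ -0#≈0# (neg-antimono-≤ 0≤x)) 0≤x)

  ∣x∣≈-x : ∀ {x} → x ≤ 0# → ∣ x ∣ ≈ - x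
  ∣x∣≈-x x≤0 = x≤y⇒x⊔y≈y (≤-trans x≤0 (x≤0⇒0≤-x x≤0))

  ∣x∣-nonNeg : ∀ x → 0# ≤ ∣ x ∣
  ∣x∣-nonNeg x with ≤-total 0# x
  ... | inj₁ 0≤x = ≤-trans 0≤x (x≤∣x∣ x)
  ... | inj₂ x≤0 = ≤-trans (x≤0⇒0≤-x x≤0) (-x≤∣x∣ x)

  ∣x∣²≈x² : ∀ x → ∣ x ∣ * ∣ x ∣ ≈ x * x
  ∣x∣²≈x² x with ≤-total 0# x
  ... | inj₁ 0≤x = *-cong (∣x∣≈x 0≤x) (∣x∣≈x 0≤x)
  ... | inj₂ x≤0 = trans (*-cong (∣x∣≈-x x≤0) (∣x∣≈-x x≤0))
                     (solve 1 (λ x → :- x :* :- x := x :* x) refl x)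

  -- If `x` bounded all naturals, their supremum `s` would bound every successor as well, so
  -- `s - 1#` would already be an upper bound.
  archimedean : ∀ x → ∃[ n ] x ≤ fromℕ n
  archimedean x with em {P = ∃[ n ] x ≤ fromℕ n}
  ... | yes p = p
  ... | no ¬p = contradiction s≤s-1 (<⇒≱ (<-slack 0<1 (solve 2 (λ s o → s :- o :+ o := s) refl s 1#)))
    where
    naturals : ℝ → Set
    naturals y = ∃[ n ] y ≈ fromℕ n

    bounded : IsUpperBound naturals x
    bounded (n , y≈n) = ≤-respˡ-≈ (sym y≈n) ([ (λ h → ⊥-elim (¬p (n , h))) , id ]′ (≤-total x (fromℕ n)))

    supremum = complete naturals (0# , 0 , refl) (x , bounded)
    s = proj₁ supremum

    s≤s-1 : s ≤ s - 1#
    s≤s-1 = proj₂ (proj₂ supremum) λ {y} (n , y≈n) →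
      ≤-slack (x≤y⇒0≤y-x (proj₁ (proj₂ supremum) (suc n , refl)))
        (trans (+-congʳ y≈n)
          (solve 3 (λ n s o → n :+ (s :- (o :+ n)) := s :- o) refl (fromℕ n) s 1#))

  floor : ∀ x → 0# ≤ x → ∃[ n ] fromℕ n ≤ x × x < fromℕ (suc n)
  floor x 0≤x = search (suc (proj₁ n₀)) (≤-<-trans (proj₂ n₀) (<-slack 0<1 (+-comm _ _)))
    where
    n₀ = archimedean x

    search : ∀ k → x < fromℕ k → ∃[ n ] fromℕ n ≤ x × x < fromℕ (suc n)
    search zero    x<0 = contradiction 0≤x (<⇒≱ x<0)
    search (suc k) x<k with <⊎≥ x (fromℕ k)
    ... | inj₁ x<k′ = search k x<k′
    ... | inj₂ k≤x  = k , k≤x , x<k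

-- Exponential, logarithm and real powers

module RealPower (em : ∀ {ℓ} → ExcludedMiddle ℓ) (F : CompleteOrderedField) where

  open Regression em F
  open OrderedFieldProperties em F
  open ExpProperties commutativeSemiring using (^-congˡ; ^-assocʳ; ^-distrib-*)

  ^-nonNeg : ∀ {x} n → 0# ≤ x → 0# ≤ x ^ n
  ^-nonNeg zero    0≤x = 0≤1
  ^-nonNeg (suc n) 0≤x = *-nonNeg 0≤x (^-nonNeg n 0≤x)

  ^-pos : ∀ {x} n → 0# < x → 0# < x ^ n
  ^-pos zero    0<x = 0<1
  ^-pos (suc n) 0<x = *-pos 0<x (^-pos n 0<x)

  ^-monoˡ-≤ : ∀ {x y} n → 0# ≤ x → x ≤ y → x ^ n ≤ y ^ n
  ^-monoˡ-≤ zero    0≤x x≤y = ≤-refl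
  ^-monoˡ-≤ (suc n) 0≤x x≤y = *-mono-≤ 0≤x (^-nonNeg n 0≤x) x≤y (^-monoˡ-≤ n 0≤x x≤y)

  1^n≈1 : ∀ n → 1# ^ n ≈ 1#
  1^n≈1 zero    = refl
  1^n≈1 (suc n) = trans (*-identityˡ _) (1^n≈1 n)

  bernoulli : ∀ {x} n → 0# ≤ 1# + x → 1# + fromℕ n * x ≤ (1# + x) ^ n
  bernoulli {x} zero    h = ≤-reflexive (solve 2 (λ o x → o :+ :n 0 :* x := o) refl 1# x)
  bernoulli {x} (suc n) h = ≤-trans
    (≤-slack (*-nonNeg (fromℕ-nonNeg n) (square-nonNeg x)) (begin-equality
      1# + (1# + fromℕ n) * x + fromℕ n * (x * x)
        ≈⟨ +-congʳ (+-cong (sym (*-identityˡ 1#)) (*-congʳ (+-congˡ (sym (*-identityˡ (fromℕ n)))))) ⟩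
      1# * 1# + (1# + 1# * fromℕ n) * x + fromℕ n * (x * x)
        ≈⟨ solve 3 (λ o n x → o :* o :+ (o :+ o :* n) :* x :+ n :* (x :* x) := (o :+ x) :* (o :+ n :* x)) refl 1# (fromℕ n) x ⟩
      (1# + x) * (1# + fromℕ n * x) ∎))
    (*-monoˡ-≤ h (bernoulli n h))

  sup-isSupremum : ∀ P → Satisfiable P → ∃[ u ] IsUpperBound P u → IsSupremum P (sup P)
  sup-isSupremum P sat bdd with em {P = Satisfiable P × ∃[ u ] IsUpperBound P u}
  ... | yes (s , b) = proj₂ (complete P s b)
  ... | no  ¬h      = contradiction (sat , bdd) ¬h

  sup-cong : ∀ {P Q} → P ≐ Q → sup P ≈ sup Q
  sup-cong {P} {Q} (P⊆Q , Q⊆P)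
    with em {P = Satisfiable P × ∃[ u ] IsUpperBound P u} | em {P = Satisfiable Q × ∃[ u ] IsUpperBound Q u}
  ... | yes (s , b) | yes (s′ , b′) = ≤-antisym
        (proj₂ (proj₂ (complete P s b)) λ p → proj₁ (proj₂ (complete Q s′ b′)) (P⊆Q p))
        (proj₂ (proj₂ (complete Q s′ b′)) λ q → proj₁ (proj₂ (complete P s b)) (Q⊆P q))
  ... | yes ((x , p) , u , b) | no ¬h = contradiction ((x , P⊆Q p) , u , λ {_} q → b (Q⊆P q)) ¬h
  ... | no ¬h | yes ((x , q) , u , b) = contradiction ((x , Q⊆P q) , u , λ {_} p → b (P⊆Q p)) ¬h
  ... | no _ | no _ = refl

  ExpTerm : ℝ → Pred ℝ 0ℓ
  ExpTerm x y = ∃[ n ] 1 ℕ.≤ n × - fromℕ n ≤ x × y ≈ (1# + x / fromℕ n) ^ n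

  ½ : ℝ
  ½ = 1# / fromℕ 2

  2½≈1 : fromℕ 2 * ½ ≈ 1#
  2½≈1 = y*[x/y]≈x (fromℕ-pos 1)

  ½+½≈1 : ½ + ½ ≈ 1#
  ½+½≈1 = trans (solve 1 (λ h → h :+ h := :n 2 :* h) refl ½) 2½≈1

  0<½ : 0# < ½
  0<½ = /-pos 0<1 (fromℕ-pos 1)

  -- (1 + t)ⁿ (1 - t)ⁿ ≤ 1 with t = ½ / n, and (1 - t)ⁿ ≥ ½ by Bernoulli.
  [1+½/n]^n≤2 : ∀ n → (1# + ½ / fromℕ (suc n)) ^ suc n ≤ fromℕ 2
  [1+½/n]^n≤2 k = *-cancelˡ-≤ 0<½ (begin
    ½ * A          ≤⟨ *-monoʳ-≤ (^-nonNeg n 0≤1+t) ½≤B ⟩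
    B * A          ≈⟨ sym (^-distrib-* (1# - t) (1# + t) n) ⟩
    ((1# - t) * (1# + t)) ^ n ≤⟨ ^-monoˡ-≤ n (*-nonNeg 0≤1-t 0≤1+t) 1-t²≤1 ⟩
    1# ^ n         ≈⟨ 1^n≈1 n ⟩
    1#             ≈⟨ sym 2½≈1 ⟩
    fromℕ 2 * ½    ≈⟨ *-comm _ _ ⟩
    ½ * fromℕ 2    ∎)
    where
    n = suc k
    t = ½ / fromℕ n
    A = (1# + t) ^ n
    B = (1# - t) ^ n

    nt≈½ : fromℕ n * t ≈ ½
    nt≈½ = y*[x/y]≈x (fromℕ-pos k)

    0≤t : 0# ≤ t
    0≤t = proj₁ (/-pos 0<½ (fromℕ-pos k))

    0≤1+t : 0# ≤ 1# + t
    0≤1+t = +-nonNeg 0≤1 0≤t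

    0≤1-t : 0# ≤ 1# - t
    0≤1-t = x≤y⇒0≤y-x (≤-trans
      (≤-slack (*-nonNeg (fromℕ-nonNeg k) 0≤t)
        (trans (+-congʳ (sym (*-identityˡ t))) (trans (sym (distribʳ t 1# (fromℕ k))) nt≈½)))
      (≤-slack (proj₁ 0<½) ½+½≈1))

    1-t²≤1 : (1# - t) * (1# + t) ≤ 1#
    1-t²≤1 = ≤-slack (square-nonNeg t) (begin-equality
      (1# - t) * (1# + t) + t * t ≈⟨ solve 2 (λ o t → (o :- t) :* (o :+ t) :+ t :* t := o :* o) refl 1# t ⟩
      1# * 1#                     ≈⟨ *-identityˡ 1# ⟩
      1#                          ∎)

    ½≤B : ½ ≤ B
    ½≤B = begin
      ½                      ≈⟨ solve 1 (λ h → h := h :+ h :- h) refl ½ ⟩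
      ½ + ½ - ½              ≈⟨ +-cong ½+½≈1 (-‿cong (sym nt≈½)) ⟩
      1# - fromℕ n * t       ≈⟨ solve 3 (λ o n t → o :- n :* t := o :+ n :* (:- t)) refl 1# (fromℕ n) t ⟩
      1# + fromℕ n * (- t)   ≤⟨ bernoulli n 0≤1-t ⟩
      B                      ∎

  expTerm-nonNeg-base : ∀ {x} k → - fromℕ (suc k) ≤ x → 0# ≤ 1# + x / fromℕ (suc k)
  expTerm-nonNeg-base {x} k -n≤x = *-cancelˡ-≤ (fromℕ-pos k) (begin
    n * 0#             ≈⟨ zeroʳ n ⟩
    0#                 ≤⟨ x≤y⇒0≤y-x -n≤x ⟩
    x - - n            ≈⟨ solve 2 (λ x n → x :- :- n := n :+ x) refl x n ⟩
    n + x              ≈⟨ +-cong (sym (*-identityʳ n)) (sym (y*[x/y]≈x (fromℕ-pos k))) ⟩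
    n * 1# + n * (x / n) ≈⟨ sym (distribˡ n 1# (x / n)) ⟩
    n * (1# + x / n)   ∎)
    where n = fromℕ (suc k)

  -- Without an upper bound the supremum in `exp` would be its default value 0. With k ≥ 2x and t =
  -- ½ / n, Bernoulli's inequality gives 1 + x / n ≤ 1 + k t ≤ (1 + t)ᵏ, and (1 + t)ⁿ ≤ 2, so 2ᵏ
  -- works for all n at once.
  ExpTerm-bounded : ∀ x → ∃[ u ] IsUpperBound (ExpTerm x) u
  ExpTerm-bounded x = fromℕ 2 ^ k , bound
    where
    k = proj₁ (archimedean (fromℕ 2 * x))

    bound : IsUpperBound (ExpTerm x) (fromℕ 2 ^ k)
    bound {y} (suc n , _ , -n≤x , y≈) = begin
      y                              ≈⟨ y≈ ⟩
      (1# + x / N) ^ suc n           ≤⟨ ^-monoˡ-≤ (suc n) (expTerm-nonNeg-base n -n≤x) base ⟩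
      ((1# + t) ^ k) ^ suc n         ≈⟨ ^-assocʳ (1# + t) k (suc n) ⟩
      (1# + t) ^ (k ℕ.* suc n)       ≡⟨ ≡.cong ((1# + t) ^_) (ℕ.*-comm k (suc n)) ⟩
      (1# + t) ^ (suc n ℕ.* k)       ≈⟨ sym (^-assocʳ (1# + t) (suc n) k) ⟩
      ((1# + t) ^ suc n) ^ k         ≤⟨ ^-monoˡ-≤ k (^-nonNeg (suc n) 0≤1+t) ([1+½/n]^n≤2 n) ⟩
      fromℕ 2 ^ k                    ∎
      where
      N = fromℕ (suc n)
      t = ½ / N

      0≤1+t : 0# ≤ 1# + t
      0≤1+t = +-nonNeg 0≤1 (proj₁ (/-pos 0<½ (fromℕ-pos n)))

      x/N≤kt : x / N ≤ fromℕ k * t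
      x/N≤kt = begin
        x * N ⁻¹                        ≈⟨ *-congʳ (trans (sym (*-identityˡ x)) (*-congʳ (sym 2½≈1))) ⟩
        fromℕ 2 * ½ * x * N ⁻¹          ≈⟨ solve 4 (λ a h x i → a :* h :* x :* i := a :* x :* (h :* i)) refl (fromℕ 2) ½ x (N ⁻¹) ⟩
        fromℕ 2 * x * (½ * N ⁻¹)        ≤⟨ *-monoʳ-≤ (proj₁ (/-pos 0<½ (fromℕ-pos n))) (proj₂ (archimedean (fromℕ 2 * x))) ⟩
        fromℕ k * t                     ∎

      base : 1# + x / N ≤ (1# + t) ^ k
      base = ≤-trans (+-monoʳ-≤ 1# x/N≤kt) (bernoulli k 0≤1+t)

  expTerm≤exp : ∀ {x y} → ExpTerm x y → y ≤ exp x
  expTerm≤exp {x} {y} t = proj₁ (sup-isSupremum (ExpTerm x) (y , t) (ExpTerm-bounded x)) t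

  -- One positive term of the supremum is enough. Its index is one more than a natural bound for -
  -- x, which makes the base strictly positive.
  exp-pos : ∀ x → 0# < exp x
  exp-pos x = <-≤-trans (^-pos (suc k) 0<base)
      (expTerm≤exp (suc k , ℕ.s≤s ℕ.z≤n , proj₁ -n<x , refl))
    where
    k = proj₁ (archimedean (- x))
    n = fromℕ (suc k)

    -n<x : - n < x
    -n<x = <-slack (+-pos 0<1 (x≤y⇒0≤y-x (proj₂ (archimedean (- x)))))
      (solve 3 (λ o k x → :- (o :+ k) :+ (o :+ (k :- :- x)) := x) refl 1# (fromℕ k) x)

    0<base : 0# < 1# + x / n
    0<base = <-resp-≈ʳ (begin-equality
      n ⁻¹ * (x - - n)       ≈⟨ solve 3 (λ x n i → i :* (x :- :- n) := n :* i :+ x :* i) refl x n (n ⁻¹) ⟩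
      n * n ⁻¹ + x * n ⁻¹    ≈⟨ +-congʳ (*-inverse-pos (fromℕ-pos k)) ⟩
      1# + x / n             ∎)
      (*-pos (⁻¹-pos (fromℕ-pos k)) (x<y⇒0<y-x -n<x))

  -- Makes `log` meaningful: the set of y with `exp y ≤ x` is bounded above by `x`. For x ≥ 0 the
  -- term 1 + x with n = 1 suffices.
  x≤exp : ∀ x → x ≤ exp x
  x≤exp x with ≤-total 0# x
  ... | inj₂ x≤0 = ≤-trans x≤0 (proj₁ (exp-pos x))
  ... | inj₁ 0≤x = begin
    x                         ≈⟨ sym (y*[x/y]≈x (fromℕ-pos 0)) ⟩
    fromℕ 1 * (x / fromℕ 1)   ≈⟨ trans (*-congʳ fromℕ-1) (*-identityˡ _) ⟩
    x / fromℕ 1               ≤⟨ ≤-slack 0≤1 (+-comm _ _) ⟩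
    1# + x / fromℕ 1          ≈⟨ sym (*-identityʳ _) ⟩
    (1# + x / fromℕ 1) ^ 1    ≤⟨ expTerm≤exp (1 , ℕ.s≤s ℕ.z≤n , ≤-trans (≤-slack (fromℕ-nonNeg 1) (-‿inverseˡ _)) 0≤x , refl) ⟩
    exp x                     ∎

  exp½≤2 : exp ½ ≤ fromℕ 2
  exp½≤2 = proj₂ (sup-isSupremum (ExpTerm ½) satisfiable (ExpTerm-bounded ½))
    λ { (suc n , _ , _ , y≈) → ≤-respˡ-≈ (sym y≈) ([1+½/n]^n≤2 n) }
    where
    satisfiable : Satisfiable (ExpTerm ½)
    satisfiable = _ , 1 , ℕ.s≤s ℕ.z≤n
      , ≤-trans (≤-slack (fromℕ-nonNeg 1) (-‿inverseˡ _)) (proj₁ 0<½) , refl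

  -- Lets the factor log d in the bound on n absorb a constant as soon as d ≥ 2.
  ½≤log : ∀ {x} → fromℕ 2 ≤ x → ½ ≤ log x
  ½≤log {x} 2≤x = proj₁ (sup-isSupremum (λ y → exp y ≤ x) (½ , exp½≤x)
    (x , λ {y} exp-y≤x → ≤-trans (x≤exp y) exp-y≤x)) exp½≤x
    where
    exp½≤x : exp ½ ≤ x
    exp½≤x = ≤-trans exp½≤2 2≤x

  exp-cong : ∀ {x y} → x ≈ y → exp x ≈ exp y
  exp-cong x≈y = sup-cong (transport x≈y , transport (sym x≈y))
    where
    transport : ∀ {x y z} → x ≈ y → ExpTerm x z → ExpTerm y z
    transport x≈y (n , 1≤n , -n≤x , z≈) =
      n , 1≤n , ≤-respʳ-≈ x≈y -n≤x , trans z≈ (^-congˡ n (+-congˡ (*-congʳ x≈y)))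

  log-cong : ∀ {x y} → x ≈ y → log x ≈ log y
  log-cong x≈y = sup-cong (≤-respʳ-≈ x≈y , ≤-respʳ-≈ (sym x≈y))

  ^ᵣ-zero : ∀ {x} p → x ≈ 0# → x ^ᵣ p ≈ 0#
  ^ᵣ-zero {x} p x≈0 with em {P = x ≈ 0#}
  ... | yes _   = refl
  ... | no  x≉0 = contradiction x≈0 x≉0

  ^ᵣ-pos : ∀ {x} p → ¬ (x ≈ 0#) → 0# < x ^ᵣ p
  ^ᵣ-pos {x} p x≉0 with em {P = x ≈ 0#}
  ... | yes x≈0 = contradiction x≈0 x≉0
  ... | no  _   = exp-pos _

  ^ᵣ-nonNeg : ∀ x p → 0# ≤ x ^ᵣ p
  ^ᵣ-nonNeg x p with em {P = x ≈ 0#}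
  ... | yes _ = ≤-refl
  ... | no  _ = proj₁ (exp-pos _)

  ^ᵣ-congʳ : ∀ {x y} p → x ≈ y → x ^ᵣ p ≈ y ^ᵣ p
  ^ᵣ-congʳ {x} {y} p x≈y with em {P = x ≈ 0#} | em {P = y ≈ 0#}
  ... | yes _   | yes _   = refl
  ... | yes x≈0 | no  y≉0 = contradiction (trans (sym x≈y) x≈0) y≉0
  ... | no  x≉0 | yes y≈0 = contradiction (trans x≈y y≈0) x≉0
  ... | no  _   | no  _   = exp-cong (*-congˡ (log-cong x≈y))

-- Finite distributions and expectations

module Averaging (em : ∀ {ℓ} → ExcludedMiddle ℓ) (F : CompleteOrderedField) where

  open Regression em F
  open OrderedFieldProperties em F
  open RealPower em F using (½; 0<½; ½+½≈1)

  𝟙 : Set → ℝ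
  𝟙 P with em {P = P}
  ... | yes _ = 1#
  ... | no  _ = 0#

  𝟙-true : ∀ {P} → P → 𝟙 P ≈ 1#
  𝟙-true {P} p with em {P = P}
  ... | yes _  = refl
  ... | no  ¬p = contradiction p ¬p

  𝟙-false : ∀ {P} → ¬ P → 𝟙 P ≈ 0#
  𝟙-false {P} ¬p with em {P = P}
  ... | yes p = contradiction p ¬p
  ... | no  _ = refl

  Weighted : Set → Set
  Weighted A = List (ℝ × A)

  private
    variable
      A B C : Set

  Σ𝑤 : Weighted A → (A → ℝ) → ℝ
  Σ𝑤 []             f = 0#
  Σ𝑤 ((w , a) ∷ xs) f = w * f a + Σ𝑤 xs f

  Σ𝑤-cong : ∀ (xs : Weighted A) {f g : A → ℝ} → (∀ a → f a ≈ g a) → Σ𝑤 xs f ≈ Σ𝑤 xs g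
  Σ𝑤-cong []       f≈g = refl
  Σ𝑤-cong (x ∷ xs) f≈g = +-cong (*-congˡ (f≈g _)) (Σ𝑤-cong xs f≈g)

  Σ𝑤-+ : ∀ (xs : Weighted A) (f g : A → ℝ) → Σ𝑤 xs (λ a → f a + g a) ≈ Σ𝑤 xs f + Σ𝑤 xs g
  Σ𝑤-+ []             f g = sym (+-identityˡ 0#)
  Σ𝑤-+ ((w , a) ∷ xs) f g = trans (+-congˡ (Σ𝑤-+ xs f g))
    (solve 5 (λ w x y s t → w :* (x :+ y) :+ (s :+ t) := w :* x :+ s :+ (w :* y :+ t)) refl
      w (f a) (g a) (Σ𝑤 xs f) (Σ𝑤 xs g))

  Σ𝑤-* : ∀ (xs : Weighted A) k (f : A → ℝ) → Σ𝑤 xs (λ a → k * f a) ≈ k * Σ𝑤 xs f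
  Σ𝑤-* []             k f = sym (zeroʳ k)
  Σ𝑤-* ((w , a) ∷ xs) k f = trans (+-congˡ (Σ𝑤-* xs k f))
    (solve 4 (λ w x k s → w :* (k :* x) :+ k :* s := k :* (w :* x :+ s)) refl w (f a) k (Σ𝑤 xs f))

  product : Weighted A → Weighted B → (A → B → C) → Weighted C
  product []             ys g = []
  product ((w , a) ∷ xs) ys g = map (λ (v , b) → w * v , g a b) ys ++ product xs ys g

  Σ𝑤-product : ∀ (xs : Weighted A) (ys : Weighted B) (g : A → B → C) f →
               Σ𝑤 (product xs ys g) f ≈ Σ𝑤 xs (λ a → Σ𝑤 ys (λ b → f (g a b)))
  Σ𝑤-product []             ys g f = refl
  Σ𝑤-product ((w , a) ∷ xs) ys g f = trans (row ys) (+-congˡ (Σ𝑤-product xs ys g f))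
    where
    row : ∀ ys′ → Σ𝑤 (map (λ (v , b) → w * v , g a b) ys′ ++ product xs ys g) f
                ≈ w * Σ𝑤 ys′ (λ b → f (g a b)) + Σ𝑤 (product xs ys g) f
    row []              = solve 2 (λ w s → s := w :* :n 0 :+ s) refl w (Σ𝑤 (product xs ys g) f)
    row ((v , b) ∷ ys′) = trans (+-congˡ (row ys′))
      (solve 5 (λ w v x s t → w :* v :* x :+ (w :* s :+ t) := w :* (v :* x :+ s) :+ t) refl
        w v (f (g a b)) (Σ𝑤 ys′ (λ b → f (g a b))) (Σ𝑤 (product xs ys g) f))

  -- Positivity and total mass one are recorded as properties of the expectation functional. In this
  -- form they pass to products without any inspection of the weights.
  record Distribution (A : Set) : Set where
    field
      weighted : Weighted A
      mono     : ∀ {f g : A → ℝ} → (∀ a → f a ≤ g a) → Σ𝑤 weighted f ≤ Σ𝑤 weighted g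
      total    : ∀ k → Σ𝑤 weighted (λ _ → k) ≈ k
  open Distribution public

  𝔼 : Distribution A → (A → ℝ) → ℝ
  𝔼 μ = Σ𝑤 (weighted μ)

  coin : Distribution Bool
  coin = record
    { weighted = (½ , true) ∷ (½ , false) ∷ []
    ; mono     = λ f≤g → +-mono-≤ (*-monoˡ-≤ (proj₁ 0<½) (f≤g true))
                          (+-mono-≤ (*-monoˡ-≤ (proj₁ 0<½) (f≤g false)) ≤-refl)
    ; total    = λ k → trans
        (solve 2 (λ h k → h :* k :+ (h :* k :+ :n 0) := (h :+ h) :* k) refl ½ k)
        (trans (*-congʳ ½+½≈1) (*-identityˡ k))
    }

  iid : Distribution A → ∀ k → Distribution (Vec A k)
  iid μ zero    = record
    { weighted = (1# , []) ∷ []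
    ; mono     = λ f≤g → +-mono-≤ (*-monoˡ-≤ 0≤1 (f≤g [])) ≤-refl
    ; total    = λ k → trans (+-identityʳ _) (*-identityˡ k)
    }
  iid μ (suc k) = record
    { weighted = product (weighted μ) (weighted (iid μ k)) _∷_
    ; mono     = λ f≤g → ≤-respˡ-≈ (sym (uncons _)) (≤-respʳ-≈ (sym (uncons _))
                   (mono μ λ a → mono (iid μ k) λ v → f≤g (a ∷ v)))
    ; total    = λ x → trans (uncons _) (trans (Σ𝑤-cong (weighted μ) λ a → total (iid μ k) x) (total μ x))
    }
    where
    uncons = Σ𝑤-product (weighted μ) (weighted (iid μ k)) _∷_

  𝔼-iid-zero : ∀ (μ : Distribution A) f → 𝔼 (iid μ 0) f ≈ f []
  𝔼-iid-zero μ f = trans (+-identityʳ _) (*-identityˡ _)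

  𝔼-iid-suc : ∀ (μ : Distribution A) k f →
              𝔼 (iid μ (suc k)) f ≈ 𝔼 μ (λ a → 𝔼 (iid μ k) (λ v → f (a ∷ v)))
  𝔼-iid-suc μ k = Σ𝑤-product (weighted μ) (weighted (iid μ k)) _∷_

  𝔼-coin : ∀ f → 𝔼 coin f ≈ ½ * (f true + f false)
  𝔼-coin f = solve 3 (λ h x y → h :* x :+ (h :* y :+ :n 0) := h :* (x :+ y)) refl ½ (f true) (f false)

  𝔼-cong : ∀ (μ : Distribution A) {f g : A → ℝ} → (∀ a → f a ≈ g a) → 𝔼 μ f ≈ 𝔼 μ g
  𝔼-cong μ = Σ𝑤-cong (weighted μ)

  𝔼-+ : ∀ (μ : Distribution A) (f g : A → ℝ) → 𝔼 μ (λ a → f a + g a) ≈ 𝔼 μ f + 𝔼 μ g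
  𝔼-+ μ = Σ𝑤-+ (weighted μ)

  𝔼-* : ∀ (μ : Distribution A) k (f : A → ℝ) → 𝔼 μ (λ a → k * f a) ≈ k * 𝔼 μ f
  𝔼-* μ = Σ𝑤-* (weighted μ)

  -- `u b` overwrites one bit of a sample by `b`; the equation says that this bit is fair and
  -- independent of the rest. Being stable under `iid`, it reaches a bit inside a block inside a
  -- table by two applications of `iid-resamples`.
  Resamples : Distribution A → (Bool → A → A) → Set
  Resamples {A} μ u = ∀ (f : A → ℝ) → 𝔼 μ f ≈ ½ * (𝔼 μ (f ∘ u true) + 𝔼 μ (f ∘ u false))

  coin-resamples : Resamples coin (λ b _ → b)
  coin-resamples f = trans (𝔼-coin f) (*-congˡ (+-cong (sym (total coin _)) (sym (total coin _))))

  iid-resamples : ∀ {μ : Distribution A} {u} → Resamples μ u →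
                  ∀ {k} j → Resamples (iid μ k) (λ b v → Vec.updateAt v j (u b))
  iid-resamples {μ = μ} {u} r {suc k} zero f = begin-equality
    𝔼 (iid μ (suc k)) f
      ≈⟨ 𝔼-iid-suc μ k f ⟩
    𝔼 μ (λ a → 𝔼 (iid μ k) (λ v → f (a ∷ v)))
      ≈⟨ r (λ a → 𝔼 (iid μ k) (λ v → f (a ∷ v))) ⟩
    ½ * (𝔼 μ (λ a → 𝔼 (iid μ k) (λ v → f (u true a ∷ v))) + 𝔼 μ (λ a → 𝔼 (iid μ k) (λ v → f (u false a ∷ v))))
      ≈⟨ *-congˡ (sym (+-cong (𝔼-iid-suc μ k _) (𝔼-iid-suc μ k _))) ⟩
    _ ∎
  iid-resamples {μ = μ} {u} r {suc k} (suc j) f = begin-equality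
    𝔼 (iid μ (suc k)) f
      ≈⟨ 𝔼-iid-suc μ k f ⟩
    𝔼 μ (λ a → 𝔼 (iid μ k) (λ v → f (a ∷ v)))
      ≈⟨ 𝔼-cong μ (λ a → iid-resamples {u = u} r j (λ v → f (a ∷ v))) ⟩
    𝔼 μ (λ a → ½ * (𝔼 (iid μ k) (λ v → f (a ∷ upd true v)) + 𝔼 (iid μ k) (λ v → f (a ∷ upd false v))))
      ≈⟨ trans (𝔼-* μ ½ _) (*-congˡ (𝔼-+ μ _ _)) ⟩
    ½ * (𝔼 μ (λ a → 𝔼 (iid μ k) (λ v → f (a ∷ upd true v))) + 𝔼 μ (λ a → 𝔼 (iid μ k) (λ v → f (a ∷ upd false v))))
      ≈⟨ *-congˡ (sym (+-cong (𝔼-iid-suc μ k _) (𝔼-iid-suc μ k _))) ⟩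
    _ ∎
    where
    upd : Bool → Vec _ k → Vec _ k
    upd b v = Vec.updateAt v j (u b)

  Preserves : Distribution A → (A → A) → Set
  Preserves {A} μ φ = ∀ (f : A → ℝ) → 𝔼 μ (f ∘ φ) ≈ 𝔼 μ f

  coin-not : Preserves coin not
  coin-not f = trans (𝔼-coin (f ∘ not)) (trans (*-congˡ (+-comm _ _)) (sym (𝔼-coin f)))

  iid-map : ∀ {μ : Distribution A} {φ} → Preserves μ φ → ∀ k → Preserves (iid μ k) (Vec.map φ)
  iid-map         p zero    f = refl
  iid-map {μ = μ} p (suc k) f = begin-equality
    𝔼 (iid μ (suc k)) (f ∘ Vec.map _)
      ≈⟨ 𝔼-iid-suc μ k _ ⟩
    𝔼 μ (λ a → 𝔼 (iid μ k) (λ v → f (_ ∷ Vec.map _ v)))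
      ≈⟨ 𝔼-cong μ (λ a → iid-map p k (λ v → f (_ ∷ v))) ⟩
    𝔼 μ (λ a → 𝔼 (iid μ k) (λ v → f (_ ∷ v)))
      ≈⟨ p (λ a → 𝔼 (iid μ k) (λ v → f (a ∷ v))) ⟩
    𝔼 μ (λ a → 𝔼 (iid μ k) (λ v → f (a ∷ v)))
      ≈⟨ sym (𝔼-iid-suc μ k f) ⟩
    𝔼 (iid μ (suc k)) f ∎

  -- Finite additivity, null sets and averaging over inputs

  module Probability (𝒫 : ProbabilitySpace) where
    open ProbabilitySpace 𝒫

    -- Padding two events by empty ones turns countable additivity into finite additivity.
    pair : Pred Ω 0ℓ → Pred Ω 0ℓ → ℕ → Pred Ω 0ℓ
    pair E D zero          = E
    pair E D (suc zero)    = D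
    pair E D (suc (suc _)) = ∅

    measurable-∅ : Measurable ∅
    measurable-∅ = measurable-resp ((λ ¬u → ¬u _) , λ ()) (measurable-∁ measurable-U)

    pair-measurable : ∀ {E D} → Measurable E → Measurable D → ∀ i → Measurable (pair E D i)
    pair-measurable mE mD zero          = mE
    pair-measurable mE mD (suc zero)    = mD
    pair-measurable mE mD (suc (suc i)) = measurable-∅

    ⋃-pair : ∀ {E D} → ⋃ ℕ (pair E D) ≐ E ∪ D
    ⋃-pair = (λ { (0 , e) → inj₁ e ; (1 , d) → inj₂ d })
           , (λ { (inj₁ e) → 0 , e ; (inj₂ d) → 1 , d })

    measurable-∪ : ∀ {E D} → Measurable E → Measurable D → Measurable (E ∪ D)
    measurable-∪ mE mD = measurable-resp ⋃-pair (measurable-⋃ _ (pair-measurable mE mD))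

    ∁∁ : ∀ {E : Pred Ω 0ℓ} {ω} → ¬ ¬ E ω → E ω
    ∁∁ {E} {ω} ¬¬e with em {P = E ω}
    ... | yes e = e
    ... | no ¬e = contradiction ¬e ¬¬e

    measurable-∩ : ∀ {E D} → Measurable E → Measurable D → Measurable (E ∩ D)
    measurable-∩ {E} {D} mE mD = measurable-resp
      ( (λ h → ∁∁ {E} (h ∘ inj₁) , ∁∁ {D} (h ∘ inj₂))
      , (λ (e , d) → [ (λ ¬e → ¬e e) , (λ ¬d → ¬d d) ]′))
      (measurable-∁ (measurable-∪ (measurable-∁ mE) (measurable-∁ mD)))

    -- For the constant sequence ∅ the partial sum of length two is at most the measure of the
    -- union, which is again ∅: twice `μ ∅` is at most `μ ∅`.
    μ-∅ : μ ∅ ≈ 0#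
    μ-∅ = ≤-antisym (≤-slack (x≤y⇒0≤y-x 2μ≤μ)
        (solve 1 (λ m → m :+ (m :- (m :+ (m :+ :n 0))) := :n 0) refl (μ ∅)))
      (μ-nonNeg measurable-∅)
      where
      2μ≤μ : μ ∅ + (μ ∅ + 0#) ≤ μ ∅
      2μ≤μ = ≤-respʳ-≈
        (μ-resp (measurable-⋃ _ (λ _ → measurable-∅)) ((λ { (_ , ()) }) , λ ()))
        (proj₁ (μ-⋃ (λ _ → ∅) (λ _ → measurable-∅) (λ { _ _ (() , _) })) (2 , refl))

    μ-∪ : ∀ {E D} → Measurable E → Measurable D → Empty (E ∩ D) → μ (E ∪ D) ≈ μ E + μ D
    μ-∪ {E} {D} mE mD disjoint = trans
      (sym (μ-resp (measurable-⋃ _ m) ⋃-pair))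
      (≤-antisym (proj₂ supremum upper)
        (≤-respˡ-≈ (+-congˡ (+-identityʳ _)) (proj₁ supremum (2 , refl))))
      where
      m = pair-measurable mE mD

      disjoint′ : ∀ {i j} → i ≢ j → Empty (pair E D i ∩ pair E D j)
      disjoint′ {0} {0} i≢j = contradiction ≡.refl i≢j
      disjoint′ {0} {1} i≢j = disjoint
      disjoint′ {0} {suc (suc j)} i≢j ω (_ , ())
      disjoint′ {1} {0} i≢j ω (d , e) = disjoint ω (e , d)
      disjoint′ {1} {1} i≢j = contradiction ≡.refl i≢j
      disjoint′ {1} {suc (suc j)} i≢j ω (_ , ())
      disjoint′ {suc (suc i)} i≢j ω (() , _)

      supremum = μ-⋃ (pair E D) m disjoint′

      zeros : ∀ k → sum {k} (λ i → μ (pair E D (suc (suc (toℕ i))))) ≈ 0#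
      zeros zero    = refl
      zeros (suc k) = trans (+-cong μ-∅ (zeros k)) (+-identityʳ 0#)

      upper : IsUpperBound _ (μ E + μ D)
      upper (0 , s≈) = ≤-respˡ-≈ (sym s≈) (+-nonNeg (μ-nonNeg mE) (μ-nonNeg mD))
      upper (1 , s≈) = ≤-respˡ-≈ (sym s≈) (+-monoʳ-≤ _ (μ-nonNeg mD))
      upper (suc (suc k) , s≈) = ≤-reflexive (trans s≈ (+-congˡ (trans (+-congˡ (zeros k)) (+-identityʳ _))))

    μ-split : ∀ {E D} → Measurable E → Measurable D → μ (E ∩ D) + μ (∁ E ∩ D) ≈ μ D
    μ-split {E} {D} mE mD = trans
      (sym (μ-∪ (measurable-∩ mE mD) (measurable-∩ (measurable-∁ mE) mD) (λ ω ((e , _) , (¬e , _)) → ¬e e)))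
      (μ-resp (measurable-∪ (measurable-∩ mE mD) (measurable-∩ (measurable-∁ mE) mD))
        ( [ proj₂ , proj₂ ]′
        , λ {ω} d → decide ω d ))
      where
      decide : ∀ ω → D ω → ((E ∩ D) ∪ (∁ E ∩ D)) ω
      decide ω d with em {P = E ω}
      ... | yes e = inj₁ (e , d)
      ... | no ¬e = inj₂ (¬e , d)

    μ-mono : ∀ {E D} → Measurable E → Measurable D → E ⊆ D → μ E ≤ μ D
    μ-mono {E} {D} mE mD E⊆D = ≤-slack (μ-nonNeg (measurable-∩ (measurable-∁ mE) mD))
      (trans (+-congʳ (μ-resp mE ((λ e → e , E⊆D e) , proj₁))) (μ-split mE mD))

    -- Monotonicity of the integral over D of the simple function Σ𝑤 𝟙 (S a), by splitting D along
    -- the first set.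
    Σ𝑤-μ-≤ : ∀ (xs : Weighted A) {S : A → Pred Ω 0ℓ} {D b} → (∀ a → Measurable (S a)) → Measurable D →
             (∀ ω → ω ∈ D → Σ𝑤 xs (λ a → 𝟙 (S a ω)) ≤ b) →
             Σ𝑤 xs (λ a → μ (S a ∩ D)) ≤ b * μ D
    -- The claim is 0 ≤ b μ(D). A point of `D` yields 0 ≤ b through `bound`; if there is none,
    -- `bound` says nothing about `b`, but `μ D` vanishes.
    Σ𝑤-μ-≤ [] {D = D} {b} mS mD bound with em {P = ∃[ ω ] D ω}
    ... | yes (ω , d) = *-nonNeg (bound ω d) (μ-nonNeg mD)
    ... | no  empty   = ≤-reflexive (sym (trans
            (*-congˡ (trans (μ-resp mD ((λ d → empty (_ , d)) , λ ())) μ-∅)) (zeroʳ b)))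
    Σ𝑤-μ-≤ ((w , a) ∷ xs) {S} {D} {b} mS mD bound = begin
      w * μ (S a ∩ D) + Σ𝑤 xs (λ a′ → μ (S a′ ∩ D))
        ≈⟨ +-congˡ (trans (Σ𝑤-cong xs (λ a′ → sym (split a′))) (Σ𝑤-+ xs _ _)) ⟩
      w * μ (S a ∩ D) + (Σ𝑤 xs (λ a′ → μ (S a′ ∩ (S a ∩ D))) + Σ𝑤 xs (λ a′ → μ (S a′ ∩ (∁ (S a) ∩ D))))
        ≤⟨ +-monoʳ-≤ _ (+-mono-≤ (Σ𝑤-μ-≤ xs mS mSD inside) (Σ𝑤-μ-≤ xs mS m¬SD outside)) ⟩
      w * μ (S a ∩ D) + ((b - w) * μ (S a ∩ D) + b * μ (∁ (S a) ∩ D))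
        ≈⟨ solve 4 (λ w b x y → w :* x :+ ((b :- w) :* x :+ b :* y) := b :* (x :+ y)) refl w b _ _ ⟩
      b * (μ (S a ∩ D) + μ (∁ (S a) ∩ D))
        ≈⟨ *-congˡ (μ-split (mS a) mD) ⟩
      b * μ D ∎
      where
      mSD  = measurable-∩ (mS a) mD
      m¬SD = measurable-∩ (measurable-∁ (mS a)) mD

      split : ∀ a′ → μ (S a′ ∩ (S a ∩ D)) + μ (S a′ ∩ (∁ (S a) ∩ D)) ≈ μ (S a′ ∩ D)
      split a′ = trans
        (+-cong (μ-resp (measurable-∩ (mS a′) mSD) ((λ (x , y , z) → y , x , z) , λ (y , x , z) → x , y , z))
                (μ-resp (measurable-∩ (mS a′) m¬SD) ((λ (x , y , z) → y , x , z) , λ (y , x , z) → x , y , z)))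
        (μ-split (mS a) (measurable-∩ (mS a′) mD))

      inside : ∀ ω → ω ∈ (S a ∩ D) → Σ𝑤 xs (λ a′ → 𝟙 (S a′ ω)) ≤ b - w
      inside ω (s , d) = ≤-slack (x≤y⇒0≤y-x (bound ω d)) (trans
        (+-congˡ (+-congˡ (-‿cong (+-congʳ (trans (*-congˡ (𝟙-true s)) (*-identityʳ w))))))
        (solve 3 (λ s b w → s :+ (b :- (w :+ s)) := b :- w) refl _ b w))

      outside : ∀ ω → ω ∈ (∁ (S a) ∩ D) → Σ𝑤 xs (λ a′ → 𝟙 (S a′ ω)) ≤ b
      outside ω (¬s , d) = ≤-respˡ-≈
        (trans (+-congʳ (trans (*-congˡ (𝟙-false ¬s)) (zeroʳ w))) (+-identityˡ _)) (bound ω d)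

    Null-∪ : ∀ {E D} → Null E → Null D → Null (E ∪ D)
    Null-∪ {E} {D} (N , mN , N≈0 , E⊆N) (M , mM , M≈0 , D⊆M) =
      N ∪ M , mN∪M , N∪M≈0 , [ inj₁ ∘ E⊆N , inj₂ ∘ D⊆M ]′
      where
      mN∪M = measurable-∪ mN mM

      ∁N∩N∪M≈0 : μ (∁ N ∩ (N ∪ M)) ≈ 0#
      ∁N∩N∪M≈0 = ≤-antisym
        (≤-respʳ-≈ M≈0 (μ-mono (measurable-∩ (measurable-∁ mN) mN∪M) mM
          λ (¬n , n∪m) → [ (λ n → contradiction n ¬n) , id ]′ n∪m))
        (μ-nonNeg (measurable-∩ (measurable-∁ mN) mN∪M))

      N∪M≈0 : μ (N ∪ M) ≈ 0#
      N∪M≈0 = trans (sym (μ-split mN mN∪M)) (trans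
        (+-cong (trans (μ-resp (measurable-∩ mN mN∪M) (proj₁ , λ n → n , inj₁ n)) N≈0) ∁N∩N∪M≈0)
        (+-identityʳ 0#))

    Null-⊆ : ∀ {E D} → E ⊆ D → Null D → Null E
    Null-⊆ E⊆D (N , mN , N≈0 , D⊆N) = N , mN , N≈0 , D⊆N ∘ E⊆D

    -- Plays the role of finiteness of the index type. It is built along the vector structure, so
    -- that it covers unions over all tables of bits without enumerating them.
    ClosedUnderNull-⋃ : Set → Set₁
    ClosedUnderNull-⋃ A = ∀ (E : A → Pred Ω 0ℓ) → (∀ a → Null (E a)) → Null (⋃ A E)

    Bool-Null-⋃ : ClosedUnderNull-⋃ Bool
    Bool-Null-⋃ E null = Null-⊆ (λ { (true , e) → inj₁ e ; (false , e) → inj₂ e })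
      (Null-∪ (null true) (null false))

    Vec-Null-⋃ : ClosedUnderNull-⋃ A → ∀ k → ClosedUnderNull-⋃ (Vec A k)
    Vec-Null-⋃ c zero    E null = Null-⊆ (λ { ([] , e) → e }) (null [])
    Vec-Null-⋃ c (suc k) E null = Null-⊆ (λ { ((a ∷ v) , e) → a , v , e })
      (c _ λ a → Vec-Null-⋃ c k (λ v → E (a ∷ v)) λ v → null (a ∷ v))

    -- Interchanges the average over inputs with the integral over Ω. The exceptional sets are first
    -- merged into one measurable null set `N`, because `bound` speaks only of points outside all of
    -- them; `Σ𝑤-μ-≤` is then applied on its complement.
    averaging : ∀ (ν : Distribution A) → ClosedUnderNull-⋃ A → ∀ {S E : A → Pred Ω 0ℓ} {p b} →
                (∀ a → ProbabilityAtLeast p (S a)) → (∀ a → Null (E a)) →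
                (∀ ω → (∀ a → ¬ E a ω) → 𝔼 ν (λ a → 𝟙 (S a ω)) ≤ b) → p ≤ b
    averaging ν closed {S} {E} {p} {b} likely null bound with closed E null
    ... | N , mN , N≈0 , E⊆N = begin
      p                          ≈⟨ sym (total ν p) ⟩
      𝔼 ν (λ _ → p)              ≤⟨ mono ν (λ a → ≤-trans (proj₂ (likely a)) (≤-reflexive (sym (offNull a)))) ⟩
      𝔼 ν (λ a → μ (S a ∩ ∁ N))  ≤⟨ Σ𝑤-μ-≤ (weighted ν) (proj₁ ∘ likely) (measurable-∁ mN)
                                      (λ ω ω∉N → bound ω λ a e → ω∉N (E⊆N (a , e))) ⟩
      b * μ (∁ N)                ≈⟨ *-congˡ ∁N≈1 ⟩
      b * 1#                     ≈⟨ *-identityʳ b ⟩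
      b                          ∎
      where
      ∁N≈1 : μ (∁ N) ≈ 1#
      ∁N≈1 = begin-equality
        μ (∁ N)                      ≈⟨ sym (μ-resp (measurable-∩ (measurable-∁ mN) measurable-U) (proj₁ , λ n → n , _)) ⟩
        μ (∁ N ∩ U)                  ≈⟨ sym (+-identityˡ _) ⟩
        0# + μ (∁ N ∩ U)             ≈⟨ +-congʳ (sym (trans (μ-resp (measurable-∩ mN measurable-U) (proj₁ , λ n → n , _)) N≈0)) ⟩
        μ (N ∩ U) + μ (∁ N ∩ U)      ≈⟨ μ-split mN measurable-U ⟩
        μ U                          ≈⟨ μ-U ⟩
        1#                           ∎

      offNull : ∀ a → μ (S a ∩ ∁ N) ≈ μ (S a)
      offNull a = begin-equality
        μ (S a ∩ ∁ N)                       ≈⟨ μ-resp (measurable-∩ mS (measurable-∁ mN)) ((λ (s , n) → n , s) , λ (n , s) → s , n) ⟩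
        μ (∁ N ∩ S a)                       ≈⟨ sym (+-identityˡ _) ⟩
        0# + μ (∁ N ∩ S a)                  ≈⟨ +-congʳ (≤-antisym (μ-nonNeg (measurable-∩ mN mS))
                                                 (≤-respʳ-≈ N≈0 (μ-mono (measurable-∩ mN mS) mN proj₁))) ⟩
        μ (N ∩ S a) + μ (∁ N ∩ S a)         ≈⟨ μ-split mN mS ⟩
        μ (S a)                             ∎
        where mS = proj₁ (likely a)

-- Moments of sums of random signs

module SignSums (em : ∀ {ℓ} → ExcludedMiddle ℓ) (F : CompleteOrderedField) where

  open Regression em F
  open OrderedFieldProperties em F
  open RealPower em F using (½; ½+½≈1)
  open Averaging em F

  sign : Bool → ℝ
  sign true  = 1#
  sign false = - 1#

  signSum : ∀ {m} → Vec Bool m → ℝ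
  signSum []      = 0#
  signSum (b ∷ v) = sign b + signSum v

  bits : ∀ m → Distribution (Vec Bool m)
  bits = iid coin

  2*½*x≈x : ∀ x → ½ * (fromℕ 2 * x) ≈ x
  2*½*x≈x x = trans (solve 2 (λ h x → h :* (:n 2 :* x) := (h :+ h) :* x) refl ½ x)
                (trans (*-congʳ ½+½≈1) (*-identityˡ x))

  -- Averages out the first bit. In the moment computations the odd powers of its sign cancel
  -- between the two values, which is what `step` verifies.
  𝔼-bits-suc : ∀ m (f : Vec Bool (suc m) → ℝ) (g : Vec Bool m → ℝ) →
               (∀ v → f (true ∷ v) + f (false ∷ v) ≈ fromℕ 2 * g v) → 𝔼 (bits (suc m)) f ≈ 𝔼 (bits m) g
  𝔼-bits-suc m f g step = begin-equality
    𝔼 (bits (suc m)) f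
      ≈⟨ trans (𝔼-iid-suc coin m f) (𝔼-coin (λ b → 𝔼 (bits m) (λ v → f (b ∷ v)))) ⟩
    ½ * (𝔼 (bits m) (λ v → f (true ∷ v)) + 𝔼 (bits m) (λ v → f (false ∷ v)))
      ≈⟨ *-congˡ (sym (𝔼-+ (bits m) _ _)) ⟩
    ½ * 𝔼 (bits m) (λ v → f (true ∷ v) + f (false ∷ v))
      ≈⟨ *-congˡ (trans (𝔼-cong (bits m) step) (𝔼-* (bits m) (fromℕ 2) g)) ⟩
    ½ * (fromℕ 2 * 𝔼 (bits m) g)
      ≈⟨ 2*½*x≈x _ ⟩
    𝔼 (bits m) g ∎

  private
    module _ {m : ℕ} (v : Vec Bool m) where
      sq : ℝ
      sq = signSum v * signSum v

  second-moment : ∀ m → 𝔼 (bits m) (λ v → signSum v * signSum v) ≈ fromℕ m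
  second-moment zero    = trans (𝔼-iid-zero coin sq) (zeroˡ 0#)
  second-moment (suc m) = begin-equality
    𝔼 (bits (suc m)) (λ v → sq v)
      ≈⟨ 𝔼-bits-suc m _ _ (λ v → solve 2 (λ o s →
           (o :+ s) :* (o :+ s) :+ (:- o :+ s) :* (:- o :+ s) := :n 2 :* (o :* o :+ s :* s))
           refl 1# (signSum v)) ⟩
    𝔼 (bits m) (λ v → 1# * 1# + sq v)
      ≈⟨ 𝔼-+ (bits m) _ _ ⟩
    𝔼 (bits m) (λ v → 1# * 1#) + 𝔼 (bits m) sq
      ≈⟨ +-cong (trans (total (bits m) _) (*-identityˡ 1#)) (second-moment m) ⟩
    fromℕ (suc m) ∎

  -- The exact value is 3m² - 2m. Dropping the linear term keeps the induction a matter of 1 + 6m +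
  -- 3m² ≤ 3 (1 + m)².
  fourth-moment : ∀ m → 𝔼 (bits m) (λ v → (signSum v * signSum v) * (signSum v * signSum v)) ≤ fromℕ 3 * (fromℕ m * fromℕ m)
  fourth-moment zero    = ≤-reflexive (trans (𝔼-iid-zero coin (λ v → sq v * sq v))
    (solve 0 (:n 0 :* :n 0 :* (:n 0 :* :n 0) := :n 3 :* (:n 0 :* :n 0)) refl))
  fourth-moment (suc m) = begin
    𝔼 (bits (suc m)) (λ v → sq v * sq v)
      ≈⟨ 𝔼-bits-suc m _ _ (λ v → solve 2 (λ o s →
           (o :+ s) :* (o :+ s) :* ((o :+ s) :* (o :+ s)) :+ (:- o :+ s) :* (:- o :+ s) :* ((:- o :+ s) :* (:- o :+ s))
           := :n 2 :* (o :* o :* (o :* o) :+ (:n 6 :* (o :* o) :* (s :* s) :+ s :* s :* (s :* s))))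
           refl 1# (signSum v)) ⟩
    𝔼 (bits m) (λ v → 1# * 1# * (1# * 1#) + (fromℕ 6 * (1# * 1#) * sq v + sq v * sq v))
      ≈⟨ trans (𝔼-+ (bits m) _ _) (+-cong (total (bits m) _) (trans (𝔼-+ (bits m) _ _) (+-congʳ (𝔼-* (bits m) _ sq)))) ⟩
    1# * 1# * (1# * 1#) + (fromℕ 6 * (1# * 1#) * 𝔼 (bits m) sq + 𝔼 (bits m) (λ v → sq v * sq v))
      ≤⟨ +-monoʳ-≤ _ (+-mono-≤ (≤-reflexive (*-congˡ (second-moment m))) (fourth-moment m)) ⟩
    1# * 1# * (1# * 1#) + (fromℕ 6 * (1# * 1#) * fromℕ m + fromℕ 3 * (fromℕ m * fromℕ m))
      ≈⟨ +-congʳ (trans (*-cong (*-identityˡ 1#) (*-identityˡ 1#)) refl) ⟩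
    1# * 1# + (fromℕ 6 * (1# * 1#) * fromℕ m + fromℕ 3 * (fromℕ m * fromℕ m))
      ≈⟨ +-congˡ (+-congʳ (solve 2 (λ o n → :n 6 :* (o :* o) :* n := :n 6 :* o :* (o :* n)) refl 1# (fromℕ m))) ⟩
    1# * 1# + (fromℕ 6 * 1# * (1# * fromℕ m) + fromℕ 3 * (fromℕ m * fromℕ m))
      ≈⟨ +-congˡ (+-congʳ (*-congˡ (*-identityˡ _))) ⟩
    1# * 1# + (fromℕ 6 * 1# * fromℕ m + fromℕ 3 * (fromℕ m * fromℕ m))
      ≤⟨ ≤-slack (*-nonNeg (fromℕ-nonNeg 2) (square-nonNeg 1#))
           (solve 2 (λ o n → o :* o :+ (:n 6 :* o :* n :+ :n 3 :* (n :* n)) :+ :n 2 :* (o :* o)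
                       := :n 3 :* ((o :+ n) :* (o :+ n))) refl 1# (fromℕ m)) ⟩
    fromℕ 3 * (fromℕ (suc m) * fromℕ (suc m)) ∎

  meanAbs : ℕ → ℝ
  meanAbs m = 𝔼 (bits m) (λ v → ∣ signSum v ∣)

  -- a (a - 2s)² (a + 4s) ≥ 0 for a = ∣ signSum v ∣ bounds it below by even moments.
  meanAbs-bound : ∀ m {s} → 0# < s → fromℕ m ≤ s * s → fromℕ 9 * fromℕ m ≤ fromℕ 16 * (s * meanAbs m)
  meanAbs-bound m {s} 0<s m≤s² = *-cancelˡ-≤ (*-pos 0<s 0<s) (begin
    s * s * (fromℕ 9 * n)
      ≤⟨ ≤-slack (*-nonNeg (*-nonNeg (fromℕ-nonNeg 3) (fromℕ-nonNeg m)) (x≤y⇒0≤y-x m≤s²))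
           (solve 2 (λ s n → s :* s :* (:n 9 :* n) :+ :n 3 :* n :* (s :* s :- n)
                       := :n 12 :* (s :* s) :* n :- :n 3 :* (n :* n)) refl s n) ⟩
    fromℕ 12 * (s * s) * n - fromℕ 3 * (n * n)
      ≤⟨ +-mono-≤ (≤-reflexive (*-congˡ (sym (second-moment m)))) (neg-antimono-≤ (fourth-moment m)) ⟩
    fromℕ 12 * (s * s) * 𝔼 (bits m) sq - 𝔼 (bits m) (λ v → sq v * sq v)
      ≤⟨ 0≤y-x⇒x≤y (≤-trans moments (≤-reflexive
           (solve 4 (λ s e f g → :n 16 :* (s :* s :* s) :* e :+ f :- :n 12 :* (s :* s) :* g
              := s :* s :* (:n 16 :* (s :* e)) :- (:n 12 :* (s :* s) :* g :- f)) refl s (meanAbs m) _ _))) ⟩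
    s * s * (fromℕ 16 * (s * meanAbs m)) ∎)
    where
    n = fromℕ m
    k₁ = fromℕ 16 * (s * s * s)
    k₂ = fromℕ 12 * (s * s)

    pointwise : ∀ v → k₂ * sq {m} v ≤ k₁ * ∣ signSum v ∣ + sq v * sq v
    pointwise v = begin
      k₂ * sq v                       ≈⟨ *-congˡ (sym a²) ⟩
      k₂ * (a * a)                    ≤⟨ ≤-slack (*-nonNeg (*-nonNeg 0≤a (square-nonNeg (a - fromℕ 2 * s)))
                                                    (+-nonNeg 0≤a (*-nonNeg (fromℕ-nonNeg 4) (proj₁ 0<s))))
                                          (solve 2 (λ a s → :n 12 :* (s :* s) :* (a :* a) :+ a :* ((a :- :n 2 :* s) :* (a :- :n 2 :* s)) :* (a :+ :n 4 :* s)
                                             := :n 16 :* (s :* s :* s) :* a :+ a :* a :* (a :* a)) refl a s) ⟩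
      k₁ * a + a * a * (a * a)        ≈⟨ +-congˡ (*-cong a² a²) ⟩
      k₁ * a + sq v * sq v            ∎
      where
      a   = ∣ signSum v ∣
      0≤a = ∣x∣-nonNeg (signSum v)
      a²  = ∣x∣²≈x² (signSum v)

    moments : 0# ≤ k₁ * meanAbs m + 𝔼 (bits m) (λ v → sq v * sq v) - k₂ * 𝔼 (bits m) sq
    moments = x≤y⇒0≤y-x (begin
      k₂ * 𝔼 (bits m) sq                                 ≈⟨ sym (𝔼-* (bits m) k₂ sq) ⟩
      𝔼 (bits m) (λ v → k₂ * sq v)                       ≤⟨ mono (bits m) pointwise ⟩
      𝔼 (bits m) (λ v → k₁ * ∣ signSum v ∣ + sq v * sq v) ≈⟨ trans (𝔼-+ (bits m) _ _) (+-congʳ (𝔼-* (bits m) k₁ _)) ⟩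
      k₁ * meanAbs m + 𝔼 (bits m) (λ v → sq v * sq v)    ∎)

  module _ {m : ℕ} {s : ℝ} (0<s : 0# < s) (m≤s² : fromℕ m ≤ s * s) (s²≤m : fromℕ 32 * (s * s) ≤ fromℕ 35 * fromℕ m) where

    private
      n = fromℕ m
      e = meanAbs m
      0≤n = fromℕ-nonNeg m

    -- Combining 9m ≤ 16 s e with 32 s² ≤ 35m gives e / s at least (9 · 32) / (16 · 35), just above
    -- 1/2.
    s≤2meanAbs : s ≤ fromℕ 2 * meanAbs m
    s≤2meanAbs = *-cancelˡ-≤ (*-pos (fromℕ-pos 279) 0<s) (begin
      fromℕ 280 * s * s                      ≤⟨ ≤-slack (*-nonNeg (fromℕ-nonNeg 8) (square-nonNeg s))
                                                  (solve 1 (λ s → :n 280 :* s :* s :+ :n 8 :* (s :* s) := :n 9 :* (:n 32 :* (s :* s))) refl s) ⟩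
      fromℕ 9 * (fromℕ 32 * (s * s))         ≤⟨ *-monoˡ-≤ (fromℕ-nonNeg 9) s²≤m ⟩
      fromℕ 9 * (fromℕ 35 * n)               ≈⟨ solve 1 (λ n → :n 9 :* (:n 35 :* n) := :n 35 :* (:n 9 :* n)) refl n ⟩
      fromℕ 35 * (fromℕ 9 * n)               ≤⟨ *-monoˡ-≤ (fromℕ-nonNeg 35) (meanAbs-bound m 0<s m≤s²) ⟩
      fromℕ 35 * (fromℕ 16 * (s * e))        ≈⟨ solve 2 (λ s e → :n 35 :* (:n 16 :* (s :* e)) := :n 280 :* s :* (:n 2 :* e)) refl s e ⟩
      fromℕ 280 * s * (fromℕ 2 * e)          ∎)

    -- Here e² / m is at least (9/16)² · (32/35), just above 2/7. This bounds the variance of ∣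
    -- signSum ∣ by 5/2 of its squared mean.
    2m≤7meanAbs² : fromℕ 2 * fromℕ m ≤ fromℕ 7 * (meanAbs m * meanAbs m)
    2m≤7meanAbs² = *-cancelˡ-≤ (*-pos (fromℕ-pos 255) (*-pos 0<s 0<s)) (begin
      fromℕ 256 * (s * s) * (fromℕ 2 * n)    ≈⟨ solve 2 (λ s n → :n 256 :* (s :* s) :* (:n 2 :* n) := :n 16 :* n :* (:n 32 :* (s :* s))) refl s n ⟩
      fromℕ 16 * n * (fromℕ 32 * (s * s))    ≤⟨ *-monoˡ-≤ (*-nonNeg (fromℕ-nonNeg 16) 0≤n) s²≤m ⟩
      fromℕ 16 * n * (fromℕ 35 * n)          ≤⟨ ≤-slack (*-nonNeg (fromℕ-nonNeg 7) (square-nonNeg n))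
                                                  (solve 1 (λ n → :n 16 :* n :* (:n 35 :* n) :+ :n 7 :* (n :* n) := :n 7 :* (:n 9 :* n :* (:n 9 :* n))) refl n) ⟩
      fromℕ 7 * (fromℕ 9 * n * (fromℕ 9 * n)) ≤⟨ *-monoˡ-≤ (fromℕ-nonNeg 7) (*-mono-≤ 0≤9n 0≤9n bound bound) ⟩
      fromℕ 7 * (fromℕ 16 * (s * e) * (fromℕ 16 * (s * e)))
                                             ≈⟨ solve 2 (λ s e → :n 7 :* (:n 16 :* (s :* e) :* (:n 16 :* (s :* e))) := :n 256 :* (s :* s) :* (:n 7 :* (e :* e))) refl s e ⟩
      fromℕ 256 * (s * s) * (fromℕ 7 * (e * e)) ∎)
      where
      0≤9n  = *-nonNeg (fromℕ-nonNeg 9) 0≤n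
      bound = meanAbs-bound m 0<s m≤s²

  absSum : ∀ {m d} → Vec (Vec Bool m) d → ℝ
  absSum []       = 0#
  absSum (v ∷ vs) = ∣ signSum v ∣ + absSum vs

  blocks : ∀ m d → Distribution (Vec (Vec Bool m) d)
  blocks m = iid (bits m)

  mean-absSum : ∀ m d → 𝔼 (blocks m d) absSum ≈ fromℕ d * meanAbs m
  mean-absSum m zero    = trans (𝔼-iid-zero (bits m) absSum) (sym (zeroˡ _))
  mean-absSum m (suc d) = begin-equality
    𝔼 (blocks m (suc d)) absSum
      ≈⟨ 𝔼-iid-suc (bits m) d absSum ⟩
    𝔼 (bits m) (λ v → 𝔼 (blocks m d) (λ vs → ∣ signSum v ∣ + absSum vs))
      ≈⟨ 𝔼-cong (bits m) (λ v → trans (𝔼-+ (blocks m d) _ absSum) (+-cong (total (blocks m d) _) (mean-absSum m d))) ⟩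
    𝔼 (bits m) (λ v → ∣ signSum v ∣ + fromℕ d * meanAbs m)
      ≈⟨ trans (𝔼-+ (bits m) _ _) (+-congˡ (total (bits m) _)) ⟩
    meanAbs m + fromℕ d * meanAbs m
      ≈⟨ sym (trans (distribʳ _ 1# (fromℕ d)) (+-congʳ (*-identityˡ _))) ⟩
    fromℕ (suc d) * meanAbs m ∎

  -- The variance of a sum of d independent copies is d (m - e²). The terms are arranged so that no
  -- difference occurs in the induction.
  second-moment-absSum : ∀ m d →
    𝔼 (blocks m d) (λ c → absSum c * absSum c) + fromℕ d * (meanAbs m * meanAbs m)
      ≈ fromℕ d * fromℕ m + fromℕ d * fromℕ d * (meanAbs m * meanAbs m)
  second-moment-absSum m zero    = trans
    (+-congʳ (𝔼-iid-zero (bits m) (λ c → absSum c * absSum c)))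
    (solve 2 (λ n e → :n 0 :* :n 0 :+ :n 0 :* (e :* e) := :n 0 :* n :+ :n 0 :* :n 0 :* (e :* e)) refl (fromℕ m) (meanAbs m))
  second-moment-absSum m (suc d) = begin-equality
    𝔼 (blocks m (suc d)) (λ c → absSum c * absSum c) + (1# + D) * (e * e)
      ≈⟨ +-congʳ expand ⟩
    N + fromℕ 2 * e * (D * e) + M + (1# + D) * (e * e)
      ≈⟨ solve 5 (λ o n d e M → n :+ :n 2 :* e :* (d :* e) :+ M :+ (o :+ d) :* (e :* e)
           := n :+ :n 2 :* e :* (d :* e) :+ (M :+ d :* (e :* e)) :+ o :* (e :* e)) refl 1# N D e M ⟩
    N + fromℕ 2 * e * (D * e) + (M + D * (e * e)) + 1# * (e * e)
      ≈⟨ +-cong (+-congˡ (second-moment-absSum m d)) (trans (*-identityˡ _) (sym (trans (*-identityˡ _) (*-identityˡ _)))) ⟩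
    N + fromℕ 2 * e * (D * e) + (D * N + D * D * (e * e)) + 1# * (1# * (e * e))
      ≈⟨ +-congʳ (+-congʳ (+-cong (sym (*-identityˡ N)) (sym (*-identityˡ _)))) ⟩
    1# * N + 1# * (fromℕ 2 * e * (D * e)) + (D * N + D * D * (e * e)) + 1# * (1# * (e * e))
      ≈⟨ solve 4 (λ o n d e → o :* n :+ o :* (:n 2 :* e :* (d :* e)) :+ (d :* n :+ d :* d :* (e :* e)) :+ o :* (o :* (e :* e))
           := (o :+ d) :* n :+ (o :+ d) :* (o :+ d) :* (e :* e)) refl 1# N D e ⟩
    (1# + D) * N + (1# + D) * (1# + D) * (e * e) ∎
    where
    N = fromℕ m
    D = fromℕ d
    e = meanAbs m
    M = 𝔼 (blocks m d) (λ c → absSum c * absSum c)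

    inner : ∀ x → 𝔼 (blocks m d) (λ c → (x + absSum c) * (x + absSum c)) ≈ x * x + fromℕ 2 * (D * e) * x + M
    inner x = begin-equality
      𝔼 (blocks m d) (λ c → (x + absSum c) * (x + absSum c))
        ≈⟨ 𝔼-cong (blocks m d) (λ c → solve 2 (λ x y → (x :+ y) :* (x :+ y) := x :* x :+ :n 2 :* x :* y :+ y :* y) refl x (absSum c)) ⟩
      𝔼 (blocks m d) (λ c → x * x + fromℕ 2 * x * absSum c + absSum c * absSum c)
        ≈⟨ trans (𝔼-+ (blocks m d) _ _) (+-congʳ (trans (𝔼-+ (blocks m d) _ _)
             (+-cong (total (blocks m d) _) (trans (𝔼-* (blocks m d) _ _) (*-congˡ (mean-absSum m d)))))) ⟩
      x * x + fromℕ 2 * x * (D * e) + M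
        ≈⟨ +-congʳ (+-congˡ (solve 2 (λ x y → :n 2 :* x :* y := :n 2 :* y :* x) refl x (D * e))) ⟩
      x * x + fromℕ 2 * (D * e) * x + M ∎

    expand : 𝔼 (blocks m (suc d)) (λ c → absSum c * absSum c) ≈ N + fromℕ 2 * e * (D * e) + M
    expand = begin-equality
      𝔼 (blocks m (suc d)) (λ c → absSum c * absSum c)
        ≈⟨ 𝔼-iid-suc (bits m) d _ ⟩
      𝔼 (bits m) (λ v → 𝔼 (blocks m d) (λ c → (∣ signSum v ∣ + absSum c) * (∣ signSum v ∣ + absSum c)))
        ≈⟨ 𝔼-cong (bits m) (λ v → trans (inner ∣ signSum v ∣) (+-congʳ (+-congʳ (∣x∣²≈x² (signSum v))))) ⟩
      𝔼 (bits m) (λ v → sq v + fromℕ 2 * (D * e) * ∣ signSum v ∣ + M)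
        ≈⟨ trans (𝔼-+ (bits m) _ _) (+-cong (trans (𝔼-+ (bits m) _ _)
             (+-cong (second-moment m) (𝔼-* (bits m) _ _))) (total (bits m) M)) ⟩
      N + fromℕ 2 * (D * e) * e + M
        ≈⟨ +-congʳ (+-congˡ (solve 2 (λ y e → :n 2 :* y :* e := :n 2 :* e :* y) refl (D * e) e)) ⟩
      N + fromℕ 2 * e * (D * e) + M ∎

  deviation : ∀ {m d} → ℝ → Vec (Vec Bool m) d → ℝ
  deviation a c = (a - absSum c) * (a - absSum c)

  -- With a = (2d + 5) h and 2h the mean of ∣ signSum ∣: Chebyshev's inequality with the centre
  -- chosen to minimise 𝔼 (1 - absSum / a)².
  deviation-bound : ∀ m d h → meanAbs m ≈ fromℕ 2 * h → fromℕ 2 * fromℕ m ≤ fromℕ 7 * (meanAbs m * meanAbs m) →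
    let a = (fromℕ 2 * fromℕ d + fromℕ 5) * h in
    𝔼 (blocks m d) (deviation a) ≤ fromℕ 5 * (h * a)
  deviation-bound m d h e≈2h 2m≤7e² = begin
    𝔼 (blocks m d) (deviation a)
      ≈⟨ 𝔼-cong (blocks m d) (λ c → solve 2 (λ a y → (a :- y) :* (a :- y) := a :* a :+ :- (:n 2 :* a) :* y :+ y :* y) refl a (absSum c)) ⟩
    𝔼 (blocks m d) (λ c → a * a + - (fromℕ 2 * a) * absSum c + absSum c * absSum c)
      ≈⟨ trans (𝔼-+ (blocks m d) _ _) (+-congʳ (trans (𝔼-+ (blocks m d) _ _)
           (+-cong (total (blocks m d) _) (trans (𝔼-* (blocks m d) _ _) (*-congˡ (mean-absSum m d)))))) ⟩
    a * a + - (fromℕ 2 * a) * (D * e) + M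
      -- With e = 2h and m ≤ 14h² each block has variance at most 10h², and the centre `a` lies 5h
      -- above the mean 2dh. The total 25h² + 10dh² is exactly 5h a.
      ≤⟨ ≤-slack (*-nonNeg (fromℕ-nonNeg d) (x≤y⇒0≤y-x m≤14h²)) (begin-equality
           a * a + - (fromℕ 2 * a) * (D * e) + M + D * (fromℕ 14 * (h * h) - N)
             ≈⟨ solve 6 (λ a D e M h N → a :* a :+ :- (:n 2 :* a) :* (D :* e) :+ M :+ D :* (:n 14 :* (h :* h) :- N)
                  := a :* a :+ :- (:n 2 :* a) :* (D :* e) :+ (M :+ D :* (e :* e)) :- D :* (e :* e) :+ D :* (:n 14 :* (h :* h) :- N)) refl a D e M h N ⟩
           a * a + - (fromℕ 2 * a) * (D * e) + (M + D * (e * e)) - D * (e * e) + D * (fromℕ 14 * (h * h) - N)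
             ≈⟨ +-congʳ (+-congʳ (+-congˡ (second-moment-absSum m d))) ⟩
           a * a + - (fromℕ 2 * a) * (D * e) + (D * N + D * D * (e * e)) - D * (e * e) + D * (fromℕ 14 * (h * h) - N)
             ≈⟨ +-congʳ (+-cong (+-cong (+-congˡ (*-congˡ (*-congˡ e≈2h))) (+-congˡ (*-congˡ (*-cong e≈2h e≈2h)))) (-‿cong (*-congˡ (*-cong e≈2h e≈2h)))) ⟩
           a * a + - (fromℕ 2 * a) * (D * (fromℕ 2 * h)) + (D * N + D * D * (fromℕ 2 * h * (fromℕ 2 * h))) - D * (fromℕ 2 * h * (fromℕ 2 * h)) + D * (fromℕ 14 * (h * h) - N)
             ≈⟨ solve 3 (λ D h N → let a = (:n 2 :* D :+ :n 5) :* h in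
                  a :* a :+ :- (:n 2 :* a) :* (D :* (:n 2 :* h)) :+ (D :* N :+ D :* D :* (:n 2 :* h :* (:n 2 :* h))) :- D :* (:n 2 :* h :* (:n 2 :* h)) :+ D :* (:n 14 :* (h :* h) :- N)
                  := :n 5 :* (h :* a)) refl D h N ⟩
           fromℕ 5 * (h * a) ∎) ⟩
    fromℕ 5 * (h * a) ∎
    where
    N = fromℕ m
    D = fromℕ d
    e = meanAbs m
    a = (fromℕ 2 * fromℕ d + fromℕ 5) * h
    M = 𝔼 (blocks m d) (λ c → absSum c * absSum c)

    m≤14h² : N ≤ fromℕ 14 * (h * h)
    m≤14h² = *-cancelˡ-≤ (fromℕ-pos 1) (≤-trans 2m≤7e² (≤-reflexive (trans (*-congˡ (*-cong e≈2h e≈2h))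
      (solve 1 (λ h → :n 7 :* (:n 2 :* h :* (:n 2 :* h)) := :n 2 :* (:n 14 :* (h :* h))) refl h))))

-- Tables of bits that are partly read

module PartialKnowledge where

  private
    variable
      A B : Set
      m d : ℕ

  Known : ℕ → ℕ → Set
  Known m d = Vec (Vec (Maybe Bool) m) d

  override : Maybe Bool → Bool → Bool
  override (just b) _ = b
  override nothing  b = b

  override-row : Vec (Maybe Bool) m → Vec Bool m → Vec Bool m
  override-row = Vec.zipWith override

  -- Writing the read bits over a uniformly random table produces the conditional distribution of
  -- the table given those bits, so that conditioning reduces to composition with a map.
  overrideAll : Known m d → Vec (Vec Bool m) d → Vec (Vec Bool m) d
  overrideAll = Vec.zipWith override-row

  at : Vec (Vec A m) d → Fin d × Fin m → A
  at c (j , k) = Vec.lookup (Vec.lookup c j) k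

  set : Fin d × Fin m → A → Vec (Vec A m) d → Vec (Vec A m) d
  set (j , k) a c = Vec.updateAt c j (λ v → Vec.updateAt v k (const a))

  flipAll : Vec (Vec Bool m) d → Vec (Vec Bool m) d
  flipAll = Vec.map (Vec.map not)

  nothingKnown : ∀ m d → Known m d
  nothingKnown m d = Vec.replicate d (Vec.replicate m nothing)

  overrideAll-nothingKnown : ∀ (c : Vec (Vec Bool m) d) → overrideAll (nothingKnown m d) c ≡ c
  overrideAll-nothingKnown []      = ≡.refl
  overrideAll-nothingKnown (v ∷ c) = ≡.cong₂ _∷_ (row v) (overrideAll-nothingKnown c)
    where
    row : ∀ {m} (v : Vec Bool m) → override-row (Vec.replicate m nothing) v ≡ v
    row []      = ≡.refl
    row (b ∷ v) = ≡.cong (b ∷_) (row v)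

  at-overrideAll : ∀ (ρ : Known m d) c s → at (overrideAll ρ c) s ≡ override (at ρ s) (at c s)
  at-overrideAll ρ c (j , k) = ≡.trans
    (≡.cong (λ v → Vec.lookup v k) (Vec.lookup-zipWith override-row j ρ c))
    (Vec.lookup-zipWith override k (Vec.lookup ρ j) (Vec.lookup c j))

  at-set : ∀ s a (c : Vec (Vec A m) d) → at (set s a c) s ≡ a
  at-set (j , k) a c = ≡.trans
    (≡.cong (λ v → Vec.lookup v k) (Vec.lookup∘updateAt j c))
    (Vec.lookup∘updateAt k (Vec.lookup c j))

  -- Turns the resampling of an unread bit into progress of the known state, which is how the
  -- induction over a query tree descends into its two branches.
  overrideAll-set : ∀ (ρ : Known m d) c s b → at ρ s ≡ nothing →
                    overrideAll ρ (set s b c) ≡ overrideAll (set s (just b) ρ) c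
  overrideAll-set ρ c (j , k) b unknown = table ρ c j unknown
    where
    row : ∀ {m} (r : Vec (Maybe Bool) m) v k → Vec.lookup r k ≡ nothing →
          override-row r (Vec.updateAt v k (const b)) ≡ override-row (Vec.updateAt r k (const (just b))) v
    row (nothing ∷ r) (_ ∷ v) zero    eq = ≡.refl
    row (x ∷ r)       (y ∷ v) (suc k) eq = ≡.cong (override x y ∷_) (row r v k eq)

    table : ∀ {d} (ρ : Known _ d) c j → Vec.lookup (Vec.lookup ρ j) k ≡ nothing →
             overrideAll ρ (set (j , k) b c) ≡ overrideAll (set (j , k) (just b) ρ) c
    table (r ∷ ρ) (v ∷ c) zero    eq = ≡.cong (_∷ overrideAll ρ c) (row r v k eq)
    table (r ∷ ρ) (v ∷ c) (suc j) eq = ≡.cong (override-row r v ∷_) (table ρ c j eq)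

-- Adaptive query trees against random bits

module AdaptiveQueries (em : ∀ {ℓ} → ExcludedMiddle ℓ) (F : CompleteOrderedField) where

  open Regression em F
  open OrderedFieldProperties em F
  open RealPower em F using (½; 0<½)
  open Averaging em F
  open SignSums em F
  open PartialKnowledge

  knownSign : Maybe Bool → ℝ
  knownSign (just b) = sign b
  knownSign nothing  = 0#

  knownSum : ∀ {m} → Vec (Maybe Bool) m → ℝ
  knownSum []      = 0#
  knownSum (x ∷ r) = knownSign x + knownSum r

  energy : ∀ {m d} → Known m d → ℝ
  energy []      = 0#
  energy (r ∷ ρ) = knownSum r * knownSum r + energy ρ

  energy-nothingKnown : ∀ m d → energy (nothingKnown m d) ≈ 0#
  energy-nothingKnown m zero    = refl
  energy-nothingKnown m (suc d) = trans
    (+-cong (trans (*-cong (row m) (row m)) (zeroˡ 0#)) (energy-nothingKnown m d)) (+-identityʳ 0#)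
    where
    row : ∀ m → knownSum (Vec.replicate m nothing) ≈ 0#
    row zero    = refl
    row (suc m) = trans (+-identityˡ _) (row m)

  -- In the block that is read, (R + 1)² + (R - 1)² = 2 (R² + 1), whichever block and bit the tree
  -- selects. The increase is therefore insensitive to adaptivity.
  energy-set : ∀ {m d} (ρ : Known m d) s → at ρ s ≡ nothing →
               energy (set s (just true) ρ) + energy (set s (just false) ρ) ≈ fromℕ 2 * (energy ρ + 1#)
  energy-set ρ (j , k) unknown = table ρ j unknown
    where
    row : ∀ {m} (r : Vec (Maybe Bool) m) k b → Vec.lookup r k ≡ nothing →
          knownSum (Vec.updateAt r k (const (just b))) ≈ sign b + knownSum r
    row (nothing ∷ r) zero    b eq = +-congˡ (sym (+-identityˡ _))
    row (x ∷ r)       (suc k) b eq = trans (+-congˡ (row r k b eq))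
      (solve 3 (λ x b r → x :+ (b :+ r) := b :+ (x :+ r)) refl (knownSign x) (sign b) (knownSum r))

    table : ∀ {d} (ρ : Known _ d) j → Vec.lookup (Vec.lookup ρ j) k ≡ nothing →
             energy (set (j , k) (just true) ρ) + energy (set (j , k) (just false) ρ) ≈ fromℕ 2 * (energy ρ + 1#)
    table (r ∷ ρ) zero eq = begin-equality
      _ ≈⟨ +-cong (+-congʳ (*-cong (row r k true eq) (row r k true eq))) (+-congʳ (*-cong (row r k false eq) (row r k false eq))) ⟩
      _ ≈⟨ solve 3 (λ o s e → (o :+ s) :* (o :+ s) :+ e :+ ((:- o :+ s) :* (:- o :+ s) :+ e) := :n 2 :* (s :* s :+ e :+ o :* o)) refl 1# (knownSum r) (energy ρ) ⟩
      _ ≈⟨ *-congˡ (+-congˡ (*-identityˡ 1#)) ⟩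
      _ ∎
    table (r ∷ ρ) (suc j) eq = begin-equality
      _ ≈⟨ solve 3 (λ x e f → x :+ e :+ (x :+ f) := :n 2 :* x :+ (e :+ f)) refl (knownSum r * knownSum r) _ _ ⟩
      _ ≈⟨ +-congˡ (table ρ j eq) ⟩
      _ ≈⟨ solve 3 (λ x e o → :n 2 :* x :+ :n 2 :* (e :+ o) := :n 2 :* (x :+ e :+ o)) refl (knownSum r * knownSum r) (energy ρ) 1# ⟩
      _ ∎

  correlation : ∀ {m d} → Vec Bool d → Vec (Vec Bool m) d → ℝ
  correlation []      []      = 0#
  correlation (σ ∷ σs) (v ∷ c) = sign σ * signSum v + correlation σs c

  -- An unread bit occurs once with each sign and cancels; a read bit is overridden in both tables
  -- and counts twice.
  flip-known : ∀ {m} (r : Vec (Maybe Bool) m) v →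
    signSum (override-row r v) + signSum (override-row r (Vec.map not v)) ≈ fromℕ 2 * knownSum r
  flip-known [] []           = solve 0 (:n 0 :+ :n 0 := :n 2 :* :n 0) refl
  flip-known (x ∷ r) (b ∷ v) = trans
    (solve 4 (λ a s c t → a :+ s :+ (c :+ t) := a :+ c :+ (s :+ t)) refl _ (signSum (override-row r v)) _ _)
    (trans (+-cong (site x b) (flip-known r v)) (sym (distribˡ (fromℕ 2) (knownSign x) (knownSum r))))
    where
    site : ∀ x b → sign (override x b) + sign (override x (not b)) ≈ fromℕ 2 * knownSign x
    site (just a) b     = solve 1 (λ s → s :+ s := :n 2 :* s) refl (sign a)
    site nothing  true  = solve 1 (λ o → o :+ :- o := :n 2 :* :n 0) refl 1#
    site nothing  false = solve 1 (λ o → :- o :+ o := :n 2 :* :n 0) refl 1#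

  energy-nonNeg : ∀ {m d} (ρ : Known m d) → 0# ≤ energy ρ
  energy-nonNeg []      = ≤-refl
  energy-nonNeg (r ∷ ρ) = +-nonNeg (square-nonNeg (knownSum r)) (energy-nonNeg ρ)

  value : Bool → ℝ
  value true  = 1#
  value false = 0#

  answer : ∀ {m d} → Vec (Vec Bool m) d → (Fin d × Fin m) ⊎ ℝ → ℝ
  answer c (inj₁ s) = value (at c s)
  answer c (inj₂ x) = x

  encode : ∀ {m d n} → (Fin n → (Fin d × Fin m) ⊎ ℝ) → Vec (Vec Bool m) d → Vector ℝ n
  encode source c i = answer c (source i)

  module _ {g h : ℝ} (0<g : 0# < g) (0<h : 0# < h) (gh≈1 : g * h ≈ 1#) where

    -- AM-GM: 2 ∣R∣ ≤ g R² + h.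
    2σR≤gR²+h : ∀ σ R → sign σ * (fromℕ 2 * R) ≤ g * (R * R) + h
    2σR≤gR²+h true R = ≤-slack (*-nonNeg (proj₁ 0<g) (square-nonNeg (R - h))) (begin-equality
      1# * (fromℕ 2 * R) + g * ((R - h) * (R - h))
        ≈⟨ solve 4 (λ o R g h → o :* (:n 2 :* R) :+ g :* ((R :- h) :* (R :- h)) := :n 2 :* R :* (o :- g :* h) :+ g :* (R :* R) :+ g :* h :* h) refl 1# R g h ⟩
      fromℕ 2 * R * (1# - g * h) + g * (R * R) + g * h * h
        ≈⟨ +-cong (+-congʳ (*-congˡ (+-congˡ (-‿cong gh≈1)))) (*-congʳ gh≈1) ⟩
      fromℕ 2 * R * (1# - 1#) + g * (R * R) + 1# * h
        ≈⟨ +-cong (solve 3 (λ o R q → :n 2 :* R :* (o :- o) :+ q := q) refl 1# R (g * (R * R))) (*-identityˡ h) ⟩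
      g * (R * R) + h ∎)
    2σR≤gR²+h false R = ≤-trans
      (≤-reflexive (solve 2 (λ o R → :- o :* (:n 2 :* R) := o :* (:n 2 :* (:- R))) refl 1# R))
      (≤-trans (2σR≤gR²+h true (- R))
        (≤-reflexive (solve 3 (λ g R h → g :* (:- R :* :- R) :+ h := g :* (R :* R) :+ h) refl g R h)))

    -- By `flip-known` only the terms 2 σ_j R_j survive. AM-GM replaces ∣R_j∣ by R_j², since it is
    -- the sum of squares whose growth along the tree is known; `h` is left free to balance the two
    -- resulting terms.
    correlation-flip : ∀ {m d} σ (ρ : Known m d) c →
      correlation σ (overrideAll ρ c) + correlation σ (overrideAll ρ (flipAll c)) ≤ g * energy ρ + fromℕ d * h
    correlation-flip []       []      []      = ≤-reflexive (solve 2 (λ g h → :n 0 :+ :n 0 := g :* :n 0 :+ :n 0 :* h) refl g h)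
    correlation-flip {d = suc d} (σ ∷ σs) (r ∷ ρ) (v ∷ c) = begin
      _ ≈⟨ solve 5 (λ s a x b y → s :* a :+ x :+ (s :* b :+ y) := s :* (a :+ b) :+ (x :+ y)) refl (sign σ) _ (correlation σs (overrideAll ρ c)) _ _ ⟩
      _ ≤⟨ +-mono-≤ (≤-respˡ-≈ (*-congˡ (sym (flip-known r v))) (2σR≤gR²+h σ (knownSum r))) (correlation-flip σs ρ c) ⟩
      g * (R * R) + h + (g * energy ρ + D * h)
        ≈⟨ +-congʳ (+-congˡ (sym (*-identityˡ h))) ⟩
      g * (R * R) + 1# * h + (g * energy ρ + D * h)
        ≈⟨ solve 6 (λ g R o h e D → g :* (R :* R) :+ o :* h :+ (g :* e :+ D :* h) := g :* (R :* R :+ e) :+ (o :+ D) :* h) refl g R 1# h (energy ρ) D ⟩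
      g * (R * R + energy ρ) + fromℕ (suc d) * h ∎
      where
      R = knownSum r
      D = fromℕ d

    module _ {m d n : ℕ} (source : Fin n → (Fin d × Fin m) ⊎ ℝ) {Out : Set}
             (Success : Out → Vec (Vec Bool m) d → Set) (decide : Out → Vec Bool d)
             {t a : ℝ} (0≤t : 0# ≤ t) (0<a : 0# < a)
             (success : ∀ x c → Success x c → absSum c - correlation (decide x) c ≤ t) where

      private
        μ = blocks m d

        T : Vec (Vec Bool m) d → ℝ
        T = deviation a

        win : QueryTree n ℝ Out → Vec (Vec Bool m) d → ℝ
        win tree c = 𝟙 (Success (result tree (encode source c)) c)

        -- At `q` = 0 this is `a` times the largest value that the two `absSum` of a flipped pair
        -- can have in total when both tables are won. Each of the `q` queries still allowed is
        -- charged as one unit of energy.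
        slack : Known m d → ℝ → ℝ
        slack ρ q = a * (fromℕ 2 * t + (g * (energy ρ + q) + fromℕ d * h))

        flip-invariant : ∀ f → 𝔼 μ (f ∘ flipAll) ≈ 𝔼 μ f
        flip-invariant = iid-map (iid-map coin-not m) d

        resample : ∀ s (f : Vec (Vec Bool m) d → ℝ) → 𝔼 μ f ≈ ½ * (𝔼 μ (f ∘ set s true) + 𝔼 μ (f ∘ set s false))
        resample (j , k) = iid-resamples {u = λ b v → Vec.updateAt v k (const b)} (iid-resamples {u = λ b _ → b} coin-resamples k) j

      slack-nonNeg : ∀ ρ → 0# ≤ slack ρ 0#
      slack-nonNeg ρ = *-nonNeg (proj₁ 0<a) (+-nonNeg (*-nonNeg (fromℕ-nonNeg 2) 0≤t)
        (+-nonNeg (*-nonNeg (proj₁ 0<g) (+-nonNeg (energy-nonNeg ρ) ≤-refl)) (*-nonNeg (fromℕ-nonNeg d) (proj₁ 0<h))))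

      atMostOne : ∀ (ρ : Known m d) c {w} → w ≤ 1# →
        fromℕ 2 * (a * a) * w ≤ fromℕ 2 * (a * a) + (T (overrideAll ρ c) + T (overrideAll ρ (flipAll c))) + fromℕ 2 * slack ρ 0#
      atMostOne ρ c w≤1 = ≤-trans
        (≤-respʳ-≈ (*-identityʳ _) (*-monoˡ-≤ (*-nonNeg (fromℕ-nonNeg 2) (square-nonNeg a)) w≤1))
        (≤-slack (+-nonNeg (+-nonNeg (square-nonNeg _) (square-nonNeg _)) (*-nonNeg (fromℕ-nonNeg 2) (slack-nonNeg ρ)))
          (sym (+-assoc _ _ _)))

      -- Flipping the unread bits changes the sign of their contribution but not the output, so
      -- both c and its flip can be won only if absSum is small on average over the two.
      output-pair : ∀ x (ρ : Known m d) c →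
        let c₁ = overrideAll ρ c ; c₂ = overrideAll ρ (flipAll c) in
        fromℕ 2 * (a * a) * (𝟙 (Success x c₁) + 𝟙 (Success x c₂))
          ≤ fromℕ 2 * (a * a) + (T c₁ + T c₂) + fromℕ 2 * slack ρ 0#
      output-pair x ρ c with em {P = Success x (overrideAll ρ c)} | em {P = Success x (overrideAll ρ (flipAll c))}
      -- Adding the two win conditions to `correlation-flip` gives a (Y₁ + Y₂) ≤ `slack ρ 0#`. The
      -- second win has to be paid with 2a², and (a - Y₁)² + (a - Y₂)² ≥ 2a² - 2a (Y₁ + Y₂) does so
      -- up to twice the slack.
      ... | yes p₁ | yes p₂ = ≤-slack
            (+-nonNeg (+-nonNeg (square-nonNeg Y₁) (square-nonNeg Y₂))
              (*-nonNeg (*-nonNeg (fromℕ-nonNeg 2) (proj₁ 0<a))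
                (+-nonNeg (+-nonNeg (x≤y⇒0≤y-x (success x _ p₁)) (x≤y⇒0≤y-x (success x _ p₂)))
                  (x≤y⇒0≤y-x (correlation-flip (decide x) ρ c)))))
            (trans (+-congʳ (*-congˡ (+-cong (sym fromℕ-1) (sym fromℕ-1))))
              (solve 9 (λ a t g h e y₁ y₂ z₁ z₂ →
                :n 2 :* (a :* a) :* (:n 1 :+ :n 1)
                  :+ (y₁ :* y₁ :+ y₂ :* y₂ :+ :n 2 :* a :* (t :- (y₁ :- z₁) :+ (t :- (y₂ :- z₂)) :+ (g :* e :+ h :- (z₁ :+ z₂))))
                := :n 2 :* (a :* a) :+ ((a :- y₁) :* (a :- y₁) :+ (a :- y₂) :* (a :- y₂))
                  :+ :n 2 :* (a :* (:n 2 :* t :+ (g :* (e :+ :n 0) :+ h))))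
                refl a t g (fromℕ d * h) (energy ρ) Y₁ Y₂ Z₁ Z₂))
        where
        Y₁ = absSum (overrideAll ρ c)
        Y₂ = absSum (overrideAll ρ (flipAll c))
        Z₁ = correlation (decide x) (overrideAll ρ c)
        Z₂ = correlation (decide x) (overrideAll ρ (flipAll c))
      ... | yes _ | no  _ = atMostOne ρ c (≤-reflexive (+-identityʳ 1#))
      ... | no  _ | yes _ = atMostOne ρ c (≤-reflexive (+-identityˡ 1#))
      ... | no  _ | no  _ = atMostOne ρ c (≤-respˡ-≈ (sym (+-identityˡ 0#)) 0≤1)

      -- The flip preserves the uniform distribution, so both members of a pair contribute the same
      -- expectation when `output-pair` is averaged.
      output-bound : ∀ x (ρ : Known m d) →
        fromℕ 2 * (a * a) * 𝔼 μ (λ c → 𝟙 (Success x (overrideAll ρ c)))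
          ≤ a * a + 𝔼 μ (λ c → T (overrideAll ρ c)) + slack ρ 0#
      output-bound x ρ = *-cancelˡ-≤ (fromℕ-pos 1) (begin
        fromℕ 2 * (fromℕ 2 * (a * a) * 𝔼 μ S)
          ≈⟨ solve 2 (λ a e → :n 2 :* (:n 2 :* (a :* a) :* e) := :n 2 :* (a :* a) :* (e :+ e)) refl a (𝔼 μ S) ⟩
        fromℕ 2 * (a * a) * (𝔼 μ S + 𝔼 μ S)
          ≈⟨ *-congˡ (trans (+-congˡ (sym (flip-invariant S))) (sym (𝔼-+ μ S (S ∘ flipAll)))) ⟩
        fromℕ 2 * (a * a) * 𝔼 μ (λ c → S c + S (flipAll c))
          ≈⟨ sym (𝔼-* μ _ _) ⟩
        𝔼 μ (λ c → fromℕ 2 * (a * a) * (S c + S (flipAll c)))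
          ≤⟨ mono μ (output-pair x ρ) ⟩
        𝔼 μ (λ c → fromℕ 2 * (a * a) + (V c + V (flipAll c)) + fromℕ 2 * slack ρ 0#)
          ≈⟨ trans (𝔼-+ μ _ _) (+-cong (trans (𝔼-+ μ _ _) (+-cong (total μ _)
               (trans (𝔼-+ μ _ _) (+-congˡ (flip-invariant V))))) (total μ _)) ⟩
        fromℕ 2 * (a * a) + (𝔼 μ V + 𝔼 μ V) + fromℕ 2 * slack ρ 0#
          ≈⟨ solve 3 (λ a v s → :n 2 :* a :+ (v :+ v) :+ :n 2 :* s := :n 2 :* (a :+ v :+ s)) refl (a * a) (𝔼 μ V) (slack ρ 0#) ⟩
        fromℕ 2 * (a * a + 𝔼 μ V + slack ρ 0#) ∎)
        where
        S = λ c → 𝟙 (Success x (overrideAll ρ c))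
        V = λ c → T (overrideAll ρ c)

      slack-mono : ∀ ρ {p q} → p ≤ q → slack ρ p ≤ slack ρ q
      slack-mono ρ p≤q = *-monoˡ-≤ (proj₁ 0<a) (+-monoʳ-≤ _ (+-mono-≤ (*-monoˡ-≤ (proj₁ 0<g) (+-monoʳ-≤ _ p≤q)) ≤-refl))

      -- A fresh query raises the energy by 1 on average, so energy plus remaining queries never grows.
      adaptive-bound : ∀ tree (ρ : Known m d) q →
        (∀ c → fromℕ (queryCount tree (encode source (overrideAll ρ c))) ≤ q) →
        fromℕ 2 * (a * a) * 𝔼 μ (λ c → win tree (overrideAll ρ c))
          ≤ a * a + 𝔼 μ (λ c → T (overrideAll ρ c)) + slack ρ q
      adaptive-bound (output x)  ρ q count≤q =
        -- An output makes no queries, so the hypothesis at any table, here the one filled with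
        -- `true`, says 0 ≤ q.
        ≤-trans (output-bound x ρ) (+-monoʳ-≤ _ (slack-mono ρ (count≤q (Vec.replicate d (Vec.replicate m true)))))
      adaptive-bound (query i k) ρ q count≤q = step (source i) ≡.refl
        where
        counted : ∀ c y → encode source (overrideAll ρ c) i ≡ y → fromℕ (suc (queryCount (k y) (encode source (overrideAll ρ c)))) ≤ q
        counted c y ≡.refl = count≤q c

        won : ∀ c y → encode source c i ≡ y → win (query i k) c ≡ win (k y) c
        won c y ≡.refl = ≡.refl

        -- All tables compatible with `ρ` give the same answer, because the entry is not a bit or
        -- because the bit has been read. The energy stays, and the budget `q` may be kept since the
        -- remaining count is only smaller.
        forced : ∀ y → (∀ c → encode source (overrideAll ρ c) i ≡ y) → _
        forced y eq = ≤-trans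
          (≤-reflexive (*-congˡ (𝔼-cong μ λ c → reflexive (won (overrideAll ρ c) y (eq c)))))
          (adaptive-bound (k y) ρ q λ c → ≤-trans (≤-slack 0≤1 (+-comm _ _)) (counted c y (eq c)))

        fresh : ∀ s → source i ≡ inj₁ s → at ρ s ≡ nothing → _
        fresh s eq unknown = begin
          fromℕ 2 * (a * a) * 𝔼 μ W
            ≈⟨ trans (*-congˡ (resample s W)) (solve 4 (λ A h x y → A :* (h :* (x :+ y)) := h :* (A :* x :+ A :* y)) refl (fromℕ 2 * (a * a)) ½ _ _) ⟩
          ½ * (fromℕ 2 * (a * a) * 𝔼 μ (W ∘ set s true) + fromℕ 2 * (a * a) * 𝔼 μ (W ∘ set s false))
            ≤⟨ *-monoˡ-≤ (proj₁ 0<½) (+-mono-≤ (branch true) (branch false)) ⟩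
          ½ * ((a * a + 𝔼 μ (V ∘ set s true) + slack (ρ′ true) (q - 1#)) + (a * a + 𝔼 μ (V ∘ set s false) + slack (ρ′ false) (q - 1#)))
            ≈⟨ *-congˡ (solve 5 (λ A v w x y → A :+ v :+ x :+ (A :+ w :+ y) := :n 2 :* A :+ (v :+ w) :+ (x :+ y)) refl (a * a) _ _ _ _) ⟩
          ½ * (fromℕ 2 * (a * a) + (𝔼 μ (V ∘ set s true) + 𝔼 μ (V ∘ set s false)) + (slack (ρ′ true) (q - 1#) + slack (ρ′ false) (q - 1#)))
            ≈⟨ *-congˡ (+-congˡ slacks) ⟩
          ½ * (fromℕ 2 * (a * a) + (𝔼 μ (V ∘ set s true) + 𝔼 μ (V ∘ set s false)) + fromℕ 2 * slack ρ q)
            ≈⟨ solve 4 (λ h A v s → h :* (:n 2 :* A :+ v :+ :n 2 :* s) := h :* (:n 2 :* A) :+ h :* v :+ h :* (:n 2 :* s)) refl ½ (a * a) _ (slack ρ q) ⟩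
          ½ * (fromℕ 2 * (a * a)) + ½ * (𝔼 μ (V ∘ set s true) + 𝔼 μ (V ∘ set s false)) + ½ * (fromℕ 2 * slack ρ q)
            ≈⟨ +-cong (+-cong (2*½*x≈x _) (sym (resample s V))) (2*½*x≈x _) ⟩
          a * a + 𝔼 μ V + slack ρ q ∎
          where
          W V : Vec (Vec Bool m) d → ℝ
          W c = win (query i k) (overrideAll ρ c)
          V c = T (overrideAll ρ c)

          ρ′ : Bool → Known m d
          ρ′ b = set s (just b) ρ

          override-ρ′ : ∀ b c → overrideAll ρ (set s b c) ≡ overrideAll (ρ′ b) c
          override-ρ′ b c = overrideAll-set ρ c s b unknown

          read : ∀ b c → encode source (overrideAll (ρ′ b) c) i ≡ value b
          read b c = ≡.trans (≡.cong (answer (overrideAll (ρ′ b) c)) eq) (≡.cong value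
            (≡.trans (at-overrideAll (ρ′ b) c s) (≡.cong (λ x → override x (at c s)) (at-set s (just b) ρ))))

          branch : ∀ b → fromℕ 2 * (a * a) * 𝔼 μ (W ∘ set s b) ≤ a * a + 𝔼 μ (V ∘ set s b) + slack (ρ′ b) (q - 1#)
          branch b = ≤-respˡ-≈ (*-congˡ (𝔼-cong μ λ c → reflexive (≡.sym
              (≡.trans (≡.cong (win (query i k)) (override-ρ′ b c)) (won (overrideAll (ρ′ b) c) (value b) (read b c))))))
            (≤-respʳ-≈ (+-congʳ (+-congˡ (𝔼-cong μ λ c → reflexive (≡.cong T (≡.sym (override-ρ′ b c))))))
              (adaptive-bound (k (value b)) (ρ′ b) (q - 1#) count))
            where
            count : ∀ c → fromℕ (queryCount (k (value b)) (encode source (overrideAll (ρ′ b) c))) ≤ q - 1#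
            count c = ≤-slack (x≤y⇒0≤y-x (≡.subst (λ c′ → fromℕ (suc (queryCount (k (value b)) (encode source c′))) ≤ q) (override-ρ′ b c)
                (counted (set s b c) (value b) (≡.trans (≡.cong (λ c′ → encode source c′ i) (override-ρ′ b c)) (read b c)))))
              (solve 3 (λ n q o → n :+ (q :- (o :+ n)) := q :- o) refl _ q 1#)

          slacks : slack (ρ′ true) (q - 1#) + slack (ρ′ false) (q - 1#) ≈ fromℕ 2 * slack ρ q
          slacks = begin-equality
            _ ≈⟨ solve 7 (λ a t g e f q x → a :* (:n 2 :* t :+ (g :* (e :+ q) :+ x)) :+ a :* (:n 2 :* t :+ (g :* (f :+ q) :+ x))
                   := a :* (:n 4 :* t :+ (g :* (e :+ f :+ :n 2 :* q) :+ :n 2 :* x))) refl a t g _ _ (q - 1#) (fromℕ d * h) ⟩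
            _ ≈⟨ *-congˡ (+-congˡ (+-congʳ (*-congˡ (+-congʳ (energy-set ρ s unknown))))) ⟩
            _ ≈⟨ solve 7 (λ a t g e q x o → a :* (:n 4 :* t :+ (g :* (:n 2 :* (e :+ o) :+ :n 2 :* (q :- o)) :+ :n 2 :* x))
                   := :n 2 :* (a :* (:n 2 :* t :+ (g :* (e :+ q) :+ x)))) refl a t g (energy ρ) q (fromℕ d * h) 1# ⟩
            _ ∎

        step : ∀ x → source i ≡ x → fromℕ 2 * (a * a) * 𝔼 μ (λ c → win (query i k) (overrideAll ρ c))
          ≤ a * a + 𝔼 μ (λ c → T (overrideAll ρ c)) + slack ρ q
        step (inj₂ y) eq = forced y (λ c → ≡.cong (answer (overrideAll ρ c)) eq)
        step (inj₁ s) eq with at ρ s in known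
        ... | just b  = forced (value b) (λ c → ≡.trans (≡.cong (answer (overrideAll ρ c)) eq) (≡.cong value
                (≡.trans (at-overrideAll ρ c s) (≡.cong (λ x → override x (at c s)) known))))
        ... | nothing = fresh s eq known

-- Finite sums of real numbers

module FiniteSums (em : ∀ {ℓ} → ExcludedMiddle ℓ) (F : CompleteOrderedField) where

  open Regression em F hiding (zero)
  open OrderedFieldProperties em F
  open SemiringSum semiring public
    using (∑-distrib-+; *-distribˡ-sum; sum-replicate-zero) renaming (sum-cong-≋ to sum-cong)

  sum-mono : ∀ {n} {f g : Vector ℝ n} → (∀ i → f i ≤ g i) → sum f ≤ sum g
  sum-mono {zero}  f≤g = ≤-refl
  sum-mono {suc n} f≤g = +-mono-≤ (f≤g zero) (sum-mono (f≤g ∘ suc))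

  sum-const : ∀ n x → sum {n} (λ _ → x) ≈ fromℕ n * x
  sum-const zero    x = sym (zeroˡ x)
  sum-const (suc n) x = trans (+-cong (sym (*-identityˡ x)) (sum-const n x)) (sym (distribʳ x 1# (fromℕ n)))

  sum-nonNeg : ∀ {n} {f : Vector ℝ n} → (∀ i → 0# ≤ f i) → 0# ≤ sum f
  sum-nonNeg {n} 0≤f = ≤-respˡ-≈ (sum-replicate-zero n) (sum-mono 0≤f)

  -- Passes from a vector of optimal total loss to the optimality of each of its blocks.
  sum-squeeze : ∀ {n} {f g : Vector ℝ n} → (∀ i → f i ≤ g i) → sum g ≤ sum f → ∀ i → g i ≤ f i
  sum-squeeze {suc n} {f} {g} f≤g h zero    = ≤-slack
    (+-nonNeg (x≤y⇒0≤y-x h) (x≤y⇒0≤y-x (sum-mono (f≤g ∘ suc))))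
    (solve 4 (λ x s y t → y :+ (x :+ s :- (y :+ t) :+ (t :- s)) := x) refl (f zero) (sum (f ∘ suc)) (g zero) (sum (g ∘ suc)))
  sum-squeeze {suc n} {f} {g} f≤g h (suc i) = sum-squeeze (f≤g ∘ suc)
    (≤-slack (+-nonNeg (x≤y⇒0≤y-x h) (x≤y⇒0≤y-x (f≤g zero)))
      (solve 4 (λ x s y t → t :+ (x :+ s :- (y :+ t) :+ (y :- x)) := s) refl (f zero) (sum (f ∘ suc)) (g zero) (sum (g ∘ suc)))) i

  sum-splitAt : ∀ m {n} (g : Fin m ⊎ Fin n → ℝ) → sum (g ∘ splitAt m) ≈ sum (g ∘ inj₁) + sum (g ∘ inj₂)
  sum-splitAt zero    g = sym (+-identityˡ _)
  sum-splitAt (suc m) g = trans (+-congˡ (sum-splitAt m (g ∘ Sum.map₁ suc))) (sym (+-assoc _ _ _))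

  sum-remQuot : ∀ d {m} (g : Fin d × Fin m → ℝ) → sum (g ∘ remQuot {d} m) ≈ sum (λ j → sum (λ k → g (j , k)))
  sum-remQuot zero        g = refl
  sum-remQuot (suc d) {m} g = trans
    (sum-splitAt m (λ s → g (swap ([ (_, zero) , map₂ suc ∘ quotRem {d} m ]′ s))))
    (+-congˡ (sum-remQuot d (λ (j , k) → g (suc j , k))))

  sum-δ : ∀ {d} (j : Fin d) (f δ : Vector ℝ d) {s} → δ j ≈ s → (∀ i → i ≢ j → δ i ≈ 0#) → sum (λ i → δ i * f i) ≈ s * f j
  sum-δ {suc d} zero    f δ δj δi = trans
    (+-cong (*-congʳ δj) (trans (sum-cong (λ i → trans (*-congʳ (δi (suc i) λ ())) (zeroˡ _))) (sum-replicate-zero d)))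
    (+-identityʳ _)
  sum-δ {suc d} (suc j) f δ δj δi = trans
    (+-cong (trans (*-congʳ (δi zero λ ())) (zeroˡ _)) (sum-δ j (f ∘ suc) (δ ∘ suc) δj (λ i i≢j → δi (suc i) λ { ≡.refl → i≢j ≡.refl })))
    (+-identityˡ _)

-- The Lipschitz function of the hard inputs

module BumpFunction (em : ∀ {ℓ} → ExcludedMiddle ℓ) (F : CompleteOrderedField) where

  open Regression em F
  open OrderedFieldProperties em F
  open Min totalOrder using (_⊓_; ⊓-glb; x⊓y≤x; x⊓y≤y)

  -- 0 up to 1, equal to 1 on [2, 5] and from 7 on, with a single zero at 6 in between.
  bump : ℝ → ℝ
  bump x = (1# ⊓ (0# ⊔ (x - 1#))) ⊓ ∣ x - fromℕ 6 ∣

  private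
    -- The one-sided form passes directly through minima and maxima; the two-sided bound follows by
    -- exchanging the arguments.
    NonExpansive : (ℝ → ℝ) → Set
    NonExpansive f = ∀ x y → f x ≤ f y + ∣ x - y ∣

    ≤+⇒-≤ : ∀ {u v w} → u ≤ v + w → u - w ≤ v
    ≤+⇒-≤ {u} {v} {w} h = ≤-slack (x≤y⇒0≤y-x h) (solve 3 (λ u v w → u :- w :+ (v :+ w :- u) := v) refl u v w)

    ⊓-nonExpansive : ∀ {f g} → NonExpansive f → NonExpansive g → NonExpansive (λ x → f x ⊓ g x)
    ⊓-nonExpansive {f} {g} nf ng x y = 0≤y-x⇒x≤y (≤-respʳ-≈
      (solve 3 (λ u v w → v :- (u :- w) := v :+ w :- u) refl (f x ⊓ g x) (f y ⊓ g y) ∣ x - y ∣)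
      (x≤y⇒0≤y-x (⊓-glb
        (≤+⇒-≤ (≤-trans (x⊓y≤x (f x) (g x)) (nf x y)))
        (≤+⇒-≤ (≤-trans (x⊓y≤y (f x) (g x)) (ng x y))))))

    ⊔-nonExpansive : ∀ {f g} → NonExpansive f → NonExpansive g → NonExpansive (λ x → f x ⊔ g x)
    ⊔-nonExpansive {f} {g} nf ng x y = ⊔-lub
      (≤-trans (nf x y) (+-mono-≤ (x≤x⊔y (f y) (g y)) ≤-refl))
      (≤-trans (ng x y) (+-mono-≤ (x≤y⊔x (f y) (g y)) ≤-refl))

    const-nonExpansive : ∀ k → NonExpansive (λ _ → k)
    const-nonExpansive k x y = ≤-slack (∣x∣-nonNeg (x - y)) refl

    -k-nonExpansive : ∀ k → NonExpansive (λ x → x - k)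
    -k-nonExpansive k x y = ≤-slack (x≤y⇒0≤y-x (x≤∣x∣ (x - y)))
      (solve 4 (λ x y k a → x :- k :+ (a :- (x :- y)) := y :- k :+ a) refl x y k ∣ x - y ∣)

    k--nonExpansive : ∀ k → NonExpansive (λ x → - (x - k))
    k--nonExpansive k x y = ≤-slack (x≤y⇒0≤y-x (-x≤∣x∣ (x - y)))
      (solve 4 (λ x y k a → :- (x :- k) :+ (a :- :- (x :- y)) := :- (y :- k) :+ a) refl x y k ∣ x - y ∣)

    bump-nonExpansive : NonExpansive bump
    bump-nonExpansive = ⊓-nonExpansive
      (⊓-nonExpansive (const-nonExpansive 1#) (⊔-nonExpansive (const-nonExpansive 0#) (-k-nonExpansive 1#)))
      (⊔-nonExpansive (-k-nonExpansive (fromℕ 6)) (k--nonExpansive (fromℕ 6)))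

  bump-lipschitz : ∀ x y → ∣ bump x - bump y ∣ ≤ ∣ x - y ∣
  bump-lipschitz x y = ∣∣-lub
    (≤-slack (x≤y⇒0≤y-x (bump-nonExpansive x y)) (solve 3 (λ u v w → u :- v :+ (v :+ w :- u) := w) refl (bump x) (bump y) ∣ x - y ∣))
    (≤-slack (x≤y⇒0≤y-x (≤-respʳ-≈ (+-congˡ ∣y-x∣≈) (bump-nonExpansive y x)))
      (solve 3 (λ u v w → :- (u :- v) :+ (u :+ w :- v) := w) refl (bump x) (bump y) ∣ x - y ∣))
    where
    ∣y-x∣≈ : ∣ y - x ∣ ≈ ∣ x - y ∣
    ∣y-x∣≈ = ≤-antisym
      (∣∣-lub (≤-respˡ-≈ (solve 2 (λ x y → :- (x :- y) := y :- x) refl x y) (-x≤∣x∣ (x - y)))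
              (≤-respˡ-≈ (solve 2 (λ x y → x :- y := :- (y :- x)) refl x y) (x≤∣x∣ (x - y))))
      (∣∣-lub (≤-respˡ-≈ (solve 2 (λ x y → :- (y :- x) := x :- y) refl x y) (-x≤∣x∣ (y - x)))
              (≤-respˡ-≈ (solve 2 (λ x y → y :- x := :- (x :- y)) refl x y) (x≤∣x∣ (y - x))))

  0≤bump : ∀ x → 0# ≤ bump x
  0≤bump x = ⊓-glb (⊓-glb 0≤1 (x≤x⊔y 0# (x - 1#))) (∣x∣-nonNeg (x - fromℕ 6))

  bump≤1 : ∀ x → bump x ≤ 1#
  bump≤1 x = ≤-trans (x⊓y≤x _ _) (x⊓y≤x 1# _)

  bump≈0 : ∀ {x} → x ≤ 1# → bump x ≈ 0#
  bump≈0 {x} x≤1 = ≤-antisym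
    (≤-trans (x⊓y≤x _ _) (≤-trans (x⊓y≤y 1# _) (⊔-lub ≤-refl
      (≤-slack (x≤y⇒0≤y-x x≤1) (solve 2 (λ x o → x :- o :+ (o :- x) := :n 0) refl x 1#)))))
    (0≤bump x)

  bump-6 : ∀ {x} → x ≈ fromℕ 6 → bump x ≈ 0#
  bump-6 {x} x≈6 = ≤-antisym
    (≤-trans (x⊓y≤y _ ∣ x - fromℕ 6 ∣) (≤-reflexive (trans (∣x∣≈x (≤-reflexive (sym x-6≈0))) x-6≈0)))
    (0≤bump x)
    where
    x-6≈0 : x - fromℕ 6 ≈ 0#
    x-6≈0 = trans (+-congʳ x≈6) (-‿inverseʳ _)

  2≤x⇒1≤ramp : ∀ {x} → fromℕ 2 ≤ x → 1# ≤ 1# ⊓ (0# ⊔ (x - 1#))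
  2≤x⇒1≤ramp {x} 2≤x = ⊓-glb ≤-refl (≤-trans (≤-slack (x≤y⇒0≤y-x 2≤x) (begin-equality
    1# + (x - fromℕ 2)     ≈⟨ +-congʳ (sym fromℕ-1) ⟩
    fromℕ 1 + (x - fromℕ 2) ≈⟨ solve 1 (λ x → :n 1 :+ (x :- :n 2) := x :- :n 1) refl x ⟩
    x - fromℕ 1            ≈⟨ +-congˡ (-‿cong fromℕ-1) ⟩
    x - 1#                 ∎)) (x≤y⊔x 0# (x - 1#)))

  bump≈1 : ∀ {x} → fromℕ 2 ≤ x → (x ≤ fromℕ 5) ⊎ (fromℕ 7 ≤ x) → bump x ≈ 1#
  bump≈1 {x} 2≤x side = ≤-antisym (bump≤1 x) (⊓-glb (2≤x⇒1≤ramp 2≤x) (far side))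
    where
    far : (x ≤ fromℕ 5) ⊎ (fromℕ 7 ≤ x) → 1# ≤ ∣ x - fromℕ 6 ∣
    far (inj₁ x≤5) = ≤-trans (≤-slack (x≤y⇒0≤y-x x≤5)
      (trans (+-congʳ (sym fromℕ-1)) (solve 1 (λ x → :n 1 :+ (:n 5 :- x) := :- (x :- :n 6)) refl x))) (-x≤∣x∣ (x - fromℕ 6))
    far (inj₂ 7≤x) = ≤-trans (≤-slack (x≤y⇒0≤y-x 7≤x)
      (trans (+-congʳ (sym fromℕ-1)) (solve 1 (λ x → :n 1 :+ (x :- :n 7) := x :- :n 6) refl x))) (x≤∣x∣ (x - fromℕ 6))

  -- From 2 on the ramp is at least 1, so the minimum can vanish only through ∣ x - 6 ∣.
  bump-zero : ∀ {x} → fromℕ 2 ≤ x → bump x ≤ 0# → x ≈ fromℕ 6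
  bump-zero {x} 2≤x bump≤0 = ≤-antisym
      (0≤y-x⇒x≤y (≤-respʳ-≈ (solve 1 (λ x → :- (x :- :n 6) := :n 6 :- x) refl x)
        (x≤0⇒0≤-x (≤-trans (x≤∣x∣ (x - fromℕ 6)) ∣x-6∣≤0))))
      (0≤y-x⇒x≤y (≤-respʳ-≈ (solve 1 (λ x → :- :- (x :- :n 6) := x :- :n 6) refl x)
        (x≤0⇒0≤-x (≤-trans (-x≤∣x∣ (x - fromℕ 6)) ∣x-6∣≤0))))
    where
    ∣x-6∣≤0 : ∣ x - fromℕ 6 ∣ ≤ 0#
    ∣x-6∣≤0 with ≤-total 1# ∣ x - fromℕ 6 ∣
    ... | inj₁ 1≤∣∣ = contradiction (≤-trans (⊓-glb (2≤x⇒1≤ramp 2≤x) 1≤∣∣) bump≤0) (<⇒≱ 0<1)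
    ... | inj₂ ∣∣≤1 = ≤-trans (⊓-glb (≤-trans ∣∣≤1 (2≤x⇒1≤ramp 2≤x)) ≤-refl) bump≤0

  bumpLip : Lip₁
  bumpLip = record
    { fun       = bump
    ; fun-0     = bump≈0 0≤1
    ; lipschitz = bump-lipschitz
    }

-- The hard inputs, their optima and their reference points

module HardInstance (em : ∀ {ℓ} → ExcludedMiddle ℓ) (F : CompleteOrderedField)
                    (p : CompleteOrderedField.Carrier F) (m d r : ℕ) where

  open Regression em F hiding (zero)
  open OrderedFieldProperties em F
  open RealPower em F
  open SignSums em F
  open FiniteSums em F
  open BumpFunction em F
  open AdaptiveQueries em F using (value; answer; encode; correlation)

  -- Coordinate j meets m random bits through the rows e_j. The barrier rows 2 e_j, with right-hand
  -- side 0, make a coordinate pay for a whole block unless bump takes the value 0 or 1 there.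
  data Row : Set where
    bit barrier : Fin d × Fin m → Row
    idle        : Row

  -- The `r` idle rows are zero rows with right-hand side 0; they pad the input to a prescribed
  -- number of rows at no loss.
  row : Fin (d ℕ.* m ℕ.+ (d ℕ.* m ℕ.+ r)) → Row
  row i = [ bit ∘ remQuot m , [ barrier ∘ remQuot m , const idle ]′ ∘ splitAt (d ℕ.* m) ]′ (splitAt (d ℕ.* m) i)

  sum-rows : ∀ (g : Row → ℝ) → g idle ≈ 0# → sum (g ∘ row) ≈
    sum (λ j → sum (λ k → g (bit (j , k)))) + sum (λ j → sum (λ k → g (barrier (j , k))))
  sum-rows g g-idle = trans
    (sum-splitAt (d ℕ.* m) (g ∘ [ bit ∘ remQuot m , [ barrier ∘ remQuot m , const idle ]′ ∘ splitAt (d ℕ.* m) ]′))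
    (+-cong (sum-remQuot d (g ∘ bit)) (trans
      (sum-splitAt (d ℕ.* m) (g ∘ [ barrier ∘ remQuot m , const idle ]′))
      (trans (+-cong (sum-remQuot d (g ∘ barrier))
                     (trans (sum-cong {r} (λ _ → g-idle)) (sum-replicate-zero r)))
             (+-identityʳ _))))

  δ : Fin d → Fin d → ℝ
  δ j i with j Fin.≟ i
  ... | yes _ = 1#
  ... | no  _ = 0#

  δ-same : ∀ j → δ j j ≈ 1#
  δ-same j with j Fin.≟ j
  ... | yes _   = refl
  ... | no  j≢j = contradiction ≡.refl j≢j

  δ-other : ∀ j i → i ≢ j → δ j i ≈ 0#
  δ-other j i i≢j with j Fin.≟ i
  ... | yes j≡i = contradiction (≡.sym j≡i) i≢j
  ... | no  _   = refl

  coefficient : Row → Fin d → ℝ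
  coefficient (bit (j , _))     i = δ j i
  coefficient (barrier (j , _)) i = fromℕ 2 * δ j i
  coefficient idle              i = 0#

  linear : Row → Vector ℝ d → ℝ
  linear (bit (j , _))     x = x j
  linear (barrier (j , _)) x = fromℕ 2 * x j
  linear idle              x = 0#

  coefficient-linear : ∀ ρ x → sum (λ i → coefficient ρ i * x i) ≈ linear ρ x
  coefficient-linear (bit (j , _))     x = trans (sum-δ j x (δ j) (δ-same j) (δ-other j)) (*-identityˡ _)
  coefficient-linear (barrier (j , _)) x = sum-δ j x (λ i → fromℕ 2 * δ j i)
    (trans (*-congˡ (δ-same j)) (*-identityʳ _)) (λ i i≢j → trans (*-congˡ (δ-other j i i≢j)) (zeroʳ _))
  coefficient-linear idle              x = trans (sum-cong {d} (λ i → zeroˡ (x i))) (sum-replicate-zero d)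

  rowSource : Row → (Fin d × Fin m) ⊎ ℝ
  rowSource (bit s)     = inj₁ s
  rowSource (barrier _) = inj₂ 0#
  rowSource idle        = inj₂ 0#

  -- Neither the matrix nor `bumpLip` depends on the bits: for fixed ω all hard inputs meet the same
  -- query tree.
  matrix : Matrix (d ℕ.* m ℕ.+ (d ℕ.* m ℕ.+ r)) d
  matrix = coefficient ∘ row

  source : Fin (d ℕ.* m ℕ.+ (d ℕ.* m ℕ.+ r)) → (Fin d × Fin m) ⊎ ℝ
  source = rowSource ∘ row

  input : Vec (Vec Bool m) d → Input (d ℕ.* m ℕ.+ (d ℕ.* m ℕ.+ r)) d
  input c = record { A = matrix ; b = encode source c ; f = bumpLip }

  fit : ∀ {k} → ℝ → Vec Bool k → ℝ
  fit y v = sum λ k → ∣ bump y - value (Vec.lookup v k) ∣ ^ᵣ p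

  penalty : ℝ → ℝ
  penalty y = ∣ bump (fromℕ 2 * y) - 0# ∣ ^ᵣ p

  block : ℝ → Vec Bool m → ℝ
  block y v = fit y v + fromℕ m * penalty y

  extent : ℝ → ℝ
  extent y = fromℕ m * (∣ y ∣ ^ᵣ p + ∣ fromℕ 2 * y ∣ ^ᵣ p)

  bump-cong : ∀ {x y} → x ≈ y → bump x ≈ bump y
  bump-cong {x} {y} x≈y = ≤-antisym
    (≤-slack (x≤y⇒0≤y-x (≤-trans (x≤∣x∣ _) ∣fx-fy∣≤0)) (solve 2 (λ u v → u :+ (:n 0 :- (u :- v)) := v) refl (bump x) (bump y)))
    (≤-slack (x≤y⇒0≤y-x (≤-trans (-x≤∣x∣ _) ∣fx-fy∣≤0)) (solve 2 (λ u v → v :+ (:n 0 :- :- (u :- v)) := u) refl (bump x) (bump y)))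
    where
    x-y≈0 : x - y ≈ 0#
    x-y≈0 = trans (+-congʳ x≈y) (-‿inverseʳ y)

    ∣fx-fy∣≤0 : ∣ bump x - bump y ∣ ≤ 0#
    ∣fx-fy∣≤0 = ≤-trans (bump-lipschitz x y)
      (≤-reflexive (trans (∣x∣≈x (≤-reflexive (sym x-y≈0))) x-y≈0))

  power-zero : ∀ {x} → x ≈ 0# → ∣ x ∣ ^ᵣ p ≈ 0#
  power-zero x≈0 = ^ᵣ-zero p (trans (∣x∣≈x (≤-reflexive (sym x≈0))) x≈0)

  loss-blocks : ∀ c x → loss p (input c) x ≈ sum (λ j → block (x j) (Vec.lookup c j))
  loss-blocks c x = begin-equality
    loss p (input c) x
      ≈⟨ sum-cong {d ℕ.* m ℕ.+ (d ℕ.* m ℕ.+ r)} (λ i → ^ᵣ-congʳ p (∣∣-cong (+-congʳ (bump-cong (coefficient-linear (row i) x))))) ⟩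
    sum (g ∘ row)
      ≈⟨ sum-rows g (power-zero (trans (+-congʳ (bump≈0 0≤1)) (-‿inverseʳ 0#))) ⟩
    sum (λ j → fit (x j) (Vec.lookup c j)) + sum (λ j → sum {m} (λ _ → penalty (x j)))
      ≈⟨ +-congˡ (sum-cong {d} (λ j → sum-const m (penalty (x j)))) ⟩
    sum (λ j → fit (x j) (Vec.lookup c j)) + sum (λ j → fromℕ m * penalty (x j))
      ≈⟨ sym (∑-distrib-+ {d} _ _) ⟩
    sum (λ j → block (x j) (Vec.lookup c j)) ∎
    where
    g : Row → ℝ
    g ρ = ∣ bump (linear ρ x) - answer c (rowSource ρ) ∣ ^ᵣ p

  size-blocks : ∀ c x → size p (input c) x ≈ sum (λ j → extent (x j))
  size-blocks c x = begin-equality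
    size p (input c) x
      ≈⟨ sum-cong {d ℕ.* m ℕ.+ (d ℕ.* m ℕ.+ r)} (λ i → ^ᵣ-congʳ p (∣∣-cong (coefficient-linear (row i) x))) ⟩
    sum (g ∘ row)
      ≈⟨ sum-rows g (power-zero refl) ⟩
    sum (λ j → sum {m} (λ _ → ∣ x j ∣ ^ᵣ p)) + sum (λ j → sum {m} (λ _ → ∣ fromℕ 2 * x j ∣ ^ᵣ p))
      ≈⟨ sym (∑-distrib-+ {d} _ _) ⟩
    sum (λ j → sum {m} (λ _ → ∣ x j ∣ ^ᵣ p) + sum {m} (λ _ → ∣ fromℕ 2 * x j ∣ ^ᵣ p))
      ≈⟨ sum-cong {d} (λ j → trans (+-cong (sum-const m _) (sum-const m _)) (sym (distribˡ (fromℕ m) _ _))) ⟩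
    sum (λ j → extent (x j)) ∎
    where
    g : Row → ℝ
    g ρ = ∣ linear ρ x ∣ ^ᵣ p

  -- The cost of a residual of absolute value 1. Keeping it as an opaque positive factor makes the
  -- analysis uniform in `p`.
  unit : ℝ
  unit = ∣ 1# ∣ ^ᵣ p

  0<unit : 0# < unit
  0<unit = ^ᵣ-pos p (λ ∣1∣≈0 → 0#≉1# (trans (sym ∣1∣≈0) (∣x∣≈x 0≤1)))

  misses : ∀ {k} → Bool → Vec Bool k → ℝ
  misses σ []      = 0#
  misses σ (b ∷ v) = value (σ xor b) + misses σ v

  misses-nonNeg : ∀ {k} σ (v : Vec Bool k) → 0# ≤ misses σ v
  misses-nonNeg σ []      = ≤-refl
  misses-nonNeg σ (b ∷ v) = +-nonNeg (value-nonNeg (σ xor b)) (misses-nonNeg σ v)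
    where
    value-nonNeg : ∀ b → 0# ≤ value b
    value-nonNeg true  = 0≤1
    value-nonNeg false = ≤-refl

  -- Per entry, 1 - σ b is 2 when the signs differ and 0 otherwise. This is the bridge from losses
  -- to sign sums.
  2misses : ∀ {k} σ (v : Vec Bool k) → fromℕ 2 * misses σ v ≈ fromℕ k - sign σ * signSum v
  2misses σ [] = solve 1 (λ s → :n 2 :* :n 0 := :n 0 :- s :* :n 0) refl (sign σ)
  2misses {suc k} σ (b ∷ v) = begin-equality
    fromℕ 2 * (value (σ xor b) + misses σ v)
      ≈⟨ distribˡ _ _ _ ⟩
    fromℕ 2 * value (σ xor b) + fromℕ 2 * misses σ v
      ≈⟨ +-cong (site σ b) (2misses σ v) ⟩
    1# - sign σ * sign b + (fromℕ k - sign σ * signSum v)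
      ≈⟨ solve 5 (λ o s t k u → o :- s :* t :+ (k :- s :* u) := o :+ k :- s :* (t :+ u)) refl 1# (sign σ) (sign b) (fromℕ k) (signSum v) ⟩
    fromℕ (suc k) - sign σ * signSum (b ∷ v) ∎
    where
    1*1 : 1# * 1# ≈ 1#
    1*1 = *-identityˡ 1#

    site : ∀ σ b → fromℕ 2 * value (σ xor b) ≈ 1# - sign σ * sign b
    site true  true  = trans (solve 1 (λ o → :n 2 :* :n 0 := o :- o) refl 1#) (+-congˡ (-‿cong (sym 1*1)))
    site false false = trans (solve 1 (λ o → :n 2 :* :n 0 := o :- o) refl 1#) (+-congˡ (-‿cong (trans (sym 1*1) (solve 1 (λ o → o :* o := :- o :* :- o) refl 1#))))
    site true  false = trans (solve 1 (λ o → :n 2 :* o := o :+ o) refl 1#) (+-congˡ (trans (sym 1*1) (solve 1 (λ o → o :* o := :- (o :* :- o)) refl 1#)))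
    site false true  = trans (solve 1 (λ o → :n 2 :* o := o :+ o) refl 1#) (+-congˡ (trans (sym 1*1) (solve 1 (λ o → o :* o := :- (:- o :* o)) refl 1#)))

  misses≤length : ∀ {k} σ (v : Vec Bool k) → misses σ v ≤ fromℕ k
  misses≤length σ []      = ≤-refl
  misses≤length σ (b ∷ v) = +-mono-≤ (value≤1 (σ xor b)) (misses≤length σ v)
    where
    value≤1 : ∀ b → value b ≤ 1#
    value≤1 true  = ≤-refl
    value≤1 false = 0≤1

  fit-plateau : ∀ {k y} σ (v : Vec Bool k) → bump y ≈ value σ → fit y v ≈ unit * misses σ v
  fit-plateau σ []      fy≈ = sym (zeroʳ unit)
  fit-plateau {y = y} σ (b ∷ v) fy≈ = begin-equality
    ∣ bump y - value b ∣ ^ᵣ p + fit y v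
      ≈⟨ +-cong (trans (^ᵣ-congʳ p (∣∣-cong (+-congʳ fy≈))) (site σ b)) (fit-plateau σ v fy≈) ⟩
    unit * value (σ xor b) + unit * misses σ v
      ≈⟨ sym (distribˡ _ _ _) ⟩
    unit * misses σ (b ∷ v) ∎
    where
    site : ∀ σ b → ∣ value σ - value b ∣ ^ᵣ p ≈ unit * value (σ xor b)
    site true  true  = trans (power-zero (-‿inverseʳ 1#)) (sym (zeroʳ unit))
    site false false = trans (power-zero (-‿inverseʳ 0#)) (sym (zeroʳ unit))
    site true  false = trans (^ᵣ-congʳ p (∣∣-cong (solve 1 (λ o → o :- :n 0 := o) refl 1#))) (sym (*-identityʳ unit))
    site false true  = trans (^ᵣ-congʳ p (trans (∣x∣≈-x 0-1≤0) (trans (solve 1 (λ o → :- (:n 0 :- o) := o) refl 1#) (sym (∣x∣≈x 0≤1)))))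
      (sym (*-identityʳ unit))
      where
      0-1≤0 : 0# - 1# ≤ 0#
      0-1≤0 = ≤-slack 0≤1 (solve 1 (λ o → :n 0 :- o :+ o := :n 0) refl 1#)

  fit-nonNeg : ∀ {k} y (v : Vec Bool k) → 0# ≤ fit y v
  fit-nonNeg {k} y v = sum-nonNeg {k} (λ _ → ^ᵣ-nonNeg _ p)

  penalty-full : ∀ {y} → bump (fromℕ 2 * y) ≈ 1# → penalty y ≈ unit
  penalty-full f≈1 = ^ᵣ-congʳ p (∣∣-cong (trans (+-congʳ f≈1) (solve 1 (λ o → o :- :n 0 := o) refl 1#)))

  -- The interval [2, 7/2], with its right end doubled to avoid a fraction. On it `bump` is 1; at
  -- the remaining points from 1 on the barrier rows see height 1.
  High : ℝ → Set
  High y = fromℕ 2 ≤ y × fromℕ 2 * y ≤ fromℕ 7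

  choose : ℝ → Bool
  choose y with em {P = High y}
  ... | yes _ = true
  ... | no  _ = false

  high⇒bump≈1 : ∀ {y} → High y → bump y ≈ 1#
  high⇒bump≈1 {y} (2≤y , 2y≤7) = bump≈1 2≤y (inj₁ (*-cancelˡ-≤ (fromℕ-pos 1)
    (≤-trans 2y≤7 (≤-slack (fromℕ-nonNeg 3) (solve 0 (:n 7 :+ :n 3 := :n 2 :* :n 5) refl)))))

  -- Up to 1 the bits are fitted by the value 0. From 1 on, a point outside `High` has 2y in [2, 5]
  -- or 2y ≥ 7, where `bump` is 1, so the barrier alone costs `unit` for each of the m bits. The
  -- transition of `bump` is covered by this second case.
  low-block : ∀ {y} → ¬ High y → ∀ v → unit * misses false v ≤ block y v
  low-block {y} ¬high v with ≤-total y 1#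
  ... | inj₁ y≤1 = ≤-trans (≤-reflexive (sym (fit-plateau false v (bump≈0 y≤1))))
                     (≤-slack (*-nonNeg (fromℕ-nonNeg m) (^ᵣ-nonNeg _ p)) refl)
  ... | inj₂ 1≤y = begin
    unit * misses false v          ≤⟨ *-monoˡ-≤ (proj₁ 0<unit) (misses≤length false v) ⟩
    unit * fromℕ m                 ≈⟨ *-comm _ _ ⟩
    fromℕ m * unit                 ≈⟨ *-congˡ (sym (penalty-full (bump≈1 2≤2y far))) ⟩
    fromℕ m * penalty y            ≤⟨ ≤-slack (fit-nonNeg y v) (+-comm _ _) ⟩
    block y v                      ∎
    where
    2≤2y : fromℕ 2 ≤ fromℕ 2 * y
    2≤2y = ≤-respˡ-≈ (*-identityʳ _) (*-monoˡ-≤ (fromℕ-nonNeg 2) 1≤y)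

    far : (fromℕ 2 * y ≤ fromℕ 5) ⊎ (fromℕ 7 ≤ fromℕ 2 * y)
    far with ≤-total (fromℕ 7) (fromℕ 2 * y)
    ... | inj₁ 7≤2y = inj₂ 7≤2y
    ... | inj₂ 2y≤7 with ≤-total (fromℕ 2) y
    ...   | inj₁ 2≤y = contradiction (2≤y , 2y≤7) ¬high
    ...   | inj₂ y≤2 = inj₁ (≤-trans (*-monoˡ-≤ (fromℕ-nonNeg 2) y≤2)
                         (≤-slack (fromℕ-nonNeg 1) (solve 0 (:n 2 :* :n 2 :+ :n 1 := :n 5) refl)))

  high-block : ∀ {y} → High y → ∀ v → block y v ≈ unit * misses true v + fromℕ m * penalty y
  high-block high v = +-congʳ (fit-plateau true v (high⇒bump≈1 high))

  block-lower : ∀ y v → unit * misses (choose y) v ≤ block y v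
  block-lower y v with em {P = High y}
  ... | yes high = ≤-trans (≤-slack (*-nonNeg (fromℕ-nonNeg m) (^ᵣ-nonNeg _ p)) refl) (≤-reflexive (sym (high-block high v)))
  ... | no ¬high = low-block ¬high v

  -- Ties go to `false`, hence to the coordinate 0: among equally good choices the reference point
  -- has to be the one of least size.
  best : Vec Bool m → Bool
  best v with em {P = 0# < signSum v}
  ... | yes _ = true
  ... | no  _ = false

  best-sign : ∀ v → sign (best v) * signSum v ≈ ∣ signSum v ∣
  best-sign v with em {P = 0# < signSum v}
  ... | yes (0≤S , _) = trans (*-identityˡ _) (sym (∣x∣≈x 0≤S))
  ... | no  ¬0<S with <⊎≥ 0# (signSum v)
  ...   | inj₁ 0<S = contradiction 0<S ¬0<S
  ...   | inj₂ S≤0 = trans (trans (solve 2 (λ o s → :- o :* s := :- (o :* s)) refl 1# (signSum v)) (-‿cong (*-identityˡ _))) (sym (∣x∣≈-x S≤0))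

  sign-≤ : ∀ σ x → sign σ * x ≤ ∣ x ∣
  sign-≤ true  x = ≤-respˡ-≈ (sym (*-identityˡ x)) (x≤∣x∣ x)
  sign-≤ false x = ≤-respˡ-≈ (sym (trans (solve 2 (λ o s → :- o :* s := :- (o :* s)) refl 1# x) (-‿cong (*-identityˡ x)))) (-x≤∣x∣ x)

  best-misses : ∀ σ v → misses (best v) v ≤ misses σ v
  best-misses σ v = *-cancelˡ-≤ (fromℕ-pos 1) (begin
    fromℕ 2 * misses (best v) v         ≈⟨ trans (2misses (best v) v) (+-congˡ (-‿cong (best-sign v))) ⟩
    fromℕ m - ∣ signSum v ∣              ≤⟨ +-monoʳ-≤ _ (neg-antimono-≤ (sign-≤ σ (signSum v))) ⟩
    fromℕ m - sign σ * signSum v        ≈⟨ sym (2misses σ v) ⟩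
    fromℕ 2 * misses σ v                ∎)

  target : Bool → ℝ
  target true  = fromℕ 3
  target false = 0#

  block-target : ∀ σ v → block (target σ) v ≈ unit * misses σ v
  block-target true v = begin-equality
    block (fromℕ 3) v
      ≈⟨ high-block (≤-slack (fromℕ-nonNeg 1) (solve 0 (:n 2 :+ :n 1 := :n 3) refl)
                  , ≤-slack (fromℕ-nonNeg 1) (solve 0 (:n 2 :* :n 3 :+ :n 1 := :n 7) refl)) v ⟩
    unit * misses true v + fromℕ m * penalty (fromℕ 3)
      ≈⟨ +-congˡ (trans (*-congˡ (power-zero (trans (+-congʳ (bump-6 (solve 0 (:n 2 :* :n 3 := :n 6) refl))) (-‿inverseʳ 0#)))) (zeroʳ _)) ⟩
    unit * misses true v + 0#
      ≈⟨ +-identityʳ _ ⟩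
    unit * misses true v ∎
  block-target false v = begin-equality
    block 0# v
      ≈⟨ +-cong (fit-plateau false v (bump≈0 0≤1))
           (trans (*-congˡ (power-zero (trans (+-congʳ (bump≈0 (≤-respˡ-≈ (sym (zeroʳ _)) 0≤1))) (-‿inverseʳ 0#)))) (zeroʳ _)) ⟩
    unit * misses false v + 0#
      ≈⟨ +-identityʳ _ ⟩
    unit * misses false v ∎

  extent-nonNeg : ∀ y → 0# ≤ extent y
  extent-nonNeg y = *-nonNeg (fromℕ-nonNeg m) (+-nonNeg (^ᵣ-nonNeg _ p) (^ᵣ-nonNeg _ p))

  extent-cong : ∀ {x y} → x ≈ y → extent x ≈ extent y
  extent-cong x≈y = *-congˡ (+-cong (^ᵣ-congʳ p (∣∣-cong x≈y)) (^ᵣ-congʳ p (∣∣-cong (*-congˡ x≈y))))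

  -- A block attaining its minimum on the side of 3 has no penalty, which pins it to 3.
  high-minimal : ∀ {y} v → 0# < signSum v → block y v ≤ unit * misses true v → y ≈ fromℕ 3
  high-minimal {y} v 0<S block≤ with em {P = High y}
  -- A strict majority of ones excludes the low side, where the loss is at least
  -- `unit * misses false v`, larger than allowed by `unit * signSum v`.
  ... | no ¬high = contradiction (≤-trans (low-block ¬high v) block≤) (<⇒≱ unit-misses)
    where
    unit-misses : unit * misses true v < unit * misses false v
    unit-misses = <-slack (*-pos 0<unit 0<S) (begin-equality
      unit * misses true v + unit * signSum v
        ≈⟨ sym (distribˡ unit _ _) ⟩
      unit * (misses true v + signSum v)
        ≈⟨ *-congˡ equal ⟩
      unit * misses false v ∎)
      where
      double : fromℕ 2 * (misses true v + signSum v) ≈ fromℕ 2 * misses false v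
      double = begin-equality
        fromℕ 2 * (misses true v + signSum v)
          ≈⟨ trans (distribˡ _ _ _) (+-congʳ (trans (2misses true v) (+-congˡ (-‿cong (*-identityˡ _))))) ⟩
        fromℕ m - signSum v + fromℕ 2 * signSum v
          ≈⟨ solve 2 (λ k s → k :- s :+ :n 2 :* s := k :+ s) refl (fromℕ m) (signSum v) ⟩
        fromℕ m + signSum v
          ≈⟨ +-congˡ (trans (sym (*-identityˡ _)) (solve 2 (λ o s → o :* s := :- (:- o :* s)) refl 1# (signSum v))) ⟩
        fromℕ m - - 1# * signSum v
          ≈⟨ sym (2misses false v) ⟩
        fromℕ 2 * misses false v ∎

      equal : misses true v + signSum v ≈ misses false v
      equal = ≤-antisym (*-cancelˡ-≤ (fromℕ-pos 1) (≤-reflexive double))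
                        (*-cancelˡ-≤ (fromℕ-pos 1) (≤-reflexive (sym double)))
  ... | yes high@(2≤y , _) = ≤-antisym
      (*-cancelˡ-≤ (fromℕ-pos 1) (≤-reflexive (trans 2y≈6 2*3)))
      (*-cancelˡ-≤ (fromℕ-pos 1) (≤-reflexive (sym (trans 2y≈6 2*3))))
    where
    2*3 : fromℕ 6 ≈ fromℕ 2 * fromℕ 3
    2*3 = solve 0 (:n 6 := :n 2 :* :n 3) refl

    m-penalty≤0 : fromℕ m * penalty y ≤ 0#
    m-penalty≤0 = ≤-slack (x≤y⇒0≤y-x (≤-respˡ-≈ (high-block high v) block≤))
      (solve 2 (λ u q → q :+ (u :- (u :+ q)) := :n 0) refl (unit * misses true v) (fromℕ m * penalty y))

    0<m : 0# < fromℕ m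
    0<m = <-≤-trans 0<S (≤-trans (x≤∣x∣ _) (0≤y-x⇒x≤y (≤-respʳ-≈
      (trans (2misses (best v) v) (+-congˡ (-‿cong (best-sign v))))
      (*-nonNeg (fromℕ-nonNeg 2) (misses-nonNeg (best v) v)))))

    bump≤0 : bump (fromℕ 2 * y) ≤ 0#
    bump≤0 with <⊎≥ 0# (bump (fromℕ 2 * y))
    ... | inj₂ ≤0 = ≤0
    ... | inj₁ 0<f = contradiction m-penalty≤0 (<⇒≱ (*-pos 0<m (^ᵣ-pos p
            λ ∣f∣≈0 → pos⇒≉0 0<f (≤-antisym
              (≤-trans (≤-respˡ-≈ (trans (+-congˡ (solve 0 (:- :n 0 := :n 0) refl)) (+-identityʳ _)) (x≤∣x∣ _)) (≤-reflexive ∣f∣≈0))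
              (proj₁ 0<f)))))

    2y≈6 : fromℕ 2 * y ≈ fromℕ 6
    2y≈6 = bump-zero (≤-trans
        (≤-slack (fromℕ-nonNeg 2) (solve 0 (:n 2 :+ :n 2 := :n 2 :* :n 2) refl)) (*-monoˡ-≤ (fromℕ-nonNeg 2) 2≤y))
      bump≤0

  -- For a strict majority of ones the optimal coordinate is forced, so the sizes agree; in the
  -- other case the reference coordinate is 0 and has size 0.
  extent-minimal : ∀ {y} v → block y v ≤ unit * misses (best v) v → extent (target (best v)) ≤ extent y
  extent-minimal {y} v block≤ with em {P = 0# < signSum v}
  ... | yes 0<S = ≤-reflexive (extent-cong (sym (high-minimal v 0<S block≤)))
  ... | no  _   = ≤-trans (≤-reflexive (trans (*-congˡ (trans (+-cong (power-zero refl) (power-zero (zeroʳ _))) (+-identityʳ 0#))) (zeroʳ _)))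
                    (extent-nonNeg y)

  reach : ℝ
  reach = ∣ fromℕ 3 ∣ ^ᵣ p + ∣ fromℕ 2 * fromℕ 3 ∣ ^ᵣ p

  0≤reach : 0# ≤ reach
  0≤reach = +-nonNeg (^ᵣ-nonNeg _ p) (^ᵣ-nonNeg _ p)

  extent-target : ∀ σ → extent (target σ) ≤ fromℕ m * reach
  extent-target true  = ≤-refl
  extent-target false = *-monoˡ-≤ (fromℕ-nonNeg m) (≤-respˡ-≈
    (sym (trans (+-cong (power-zero refl) (power-zero (zeroʳ _))) (+-identityʳ 0#))) 0≤reach)

  optimum : Vec (Vec Bool m) d → Vector ℝ d
  optimum c j = target (best (Vec.lookup c j))

  opt : Vec (Vec Bool m) d → ℝ
  opt c = sum (λ j → unit * misses (best (Vec.lookup c j)) (Vec.lookup c j))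

  loss-optimum : ∀ c → loss p (input c) (optimum c) ≈ opt c
  loss-optimum c = trans (loss-blocks c (optimum c)) (sum-cong {d} (λ j → block-target (best (Vec.lookup c j)) (Vec.lookup c j)))

  opt≤block : ∀ y v → unit * misses (best v) v ≤ block y v
  opt≤block y v = ≤-trans (*-monoˡ-≤ (proj₁ 0<unit) (best-misses (choose y) v)) (block-lower y v)

  isOPT : ∀ c → IsOPT p (input c) (opt c)
  isOPT c = (optimum c , loss-optimum c)
    , λ x → ≤-respʳ-≈ (sym (loss-blocks c x)) (sum-mono (λ j → opt≤block (x j) (Vec.lookup c j)))

  isReference : ∀ c → IsReference p (input c) (opt c) (optimum c)
  isReference c = loss-optimum c , λ x loss≈opt →
    ≤-respˡ-≈ (sym (size-blocks c (optimum c))) (≤-respʳ-≈ (sym (size-blocks c x))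
      (sum-mono (λ j → extent-minimal (Vec.lookup c j)
        (sum-squeeze {d} (λ j → opt≤block (x j) (Vec.lookup c j))
          (≤-respˡ-≈ (loss-blocks c x) (≤-reflexive loss≈opt)) j))))

  hasOPT : ∀ c → HasOPT p (input c)
  hasOPT c = opt c , optimum c , isOPT c , isReference c

  decide : Vector ℝ d → Vec Bool d
  decide x = Vec.tabulate (choose ∘ x)

  sum-absSum : ∀ {m d} (c : Vec (Vec Bool m) d) → sum (λ j → ∣ signSum (Vec.lookup c j) ∣) ≈ absSum c
  sum-absSum []      = refl
  sum-absSum (v ∷ c) = +-congˡ (sum-absSum c)

  sum-correlation : ∀ {m d} (σ : Fin d → Bool) (c : Vec (Vec Bool m) d) →
                    sum (λ j → sign (σ j) * signSum (Vec.lookup c j)) ≈ correlation (Vec.tabulate σ) c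
  sum-correlation σ []      = refl
  sum-correlation σ (v ∷ c) = +-congˡ (sum-correlation (σ ∘ suc) c)

  2-sum-misses : ∀ (σ : Fin d → Bool) (c : Vec (Vec Bool m) d) →
    fromℕ 2 * sum (λ j → unit * misses (σ j) (Vec.lookup c j)) ≈ unit * (fromℕ d * fromℕ m - sum (λ j → sign (σ j) * signSum (Vec.lookup c j)))
  2-sum-misses σ c = begin-equality
    fromℕ 2 * sum (λ j → unit * misses (σ j) (Vec.lookup c j))
      ≈⟨ *-congˡ (sym (*-distribˡ-sum {d} unit _)) ⟩
    fromℕ 2 * (unit * sum (λ j → misses (σ j) (Vec.lookup c j)))
      ≈⟨ solve 3 (λ a u s → a :* (u :* s) := u :* (a :* s)) refl (fromℕ 2) unit _ ⟩
    unit * (fromℕ 2 * sum (λ j → misses (σ j) (Vec.lookup c j)))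
      ≈⟨ *-congˡ (trans (*-distribˡ-sum {d} (fromℕ 2) _) (sum-cong {d} (λ j → 2misses (σ j) (Vec.lookup c j)))) ⟩
    unit * sum (λ j → fromℕ m - sign (σ j) * signSum (Vec.lookup c j))
      ≈⟨ *-congˡ (trans (∑-distrib-+ {d} _ _) (+-cong (sum-const d _) (sum-neg {d} _))) ⟩
    unit * (fromℕ d * fromℕ m - sum (λ j → sign (σ j) * signSum (Vec.lookup c j))) ∎
    where
    sum-neg : ∀ {n} (f : Vector ℝ n) → sum (λ j → - f j) ≈ - sum f
    sum-neg {zero}  f = solve 0 (:n 0 := :- :n 0) refl
    sum-neg {suc n} f = trans (+-congˡ (sum-neg (f ∘ suc))) (solve 2 (λ x s → :- x :+ :- s := :- (x :+ s)) refl (f zero) (sum (f ∘ suc)))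

  -- Each block costs at least the misses of its decided sign, so twice the excess loss dominates
  -- `unit` times the loss of correlation. The allowance is of order ε d m: a majority misses at
  -- most half of its block, and no reference coordinate exceeds 3.
  accurate⇒correlated : ∀ {ε} → 0# < ε → ∀ x c → IsAccurate p (input c) ε x →
    unit * (absSum c - correlation (decide x) c) ≤ ε * (fromℕ d * fromℕ m) * (unit + fromℕ 2 * reach)
  accurate⇒correlated {ε} 0<ε x c accurate = begin
    unit * (Y - Z)
      ≈⟨ solve 4 (λ u k y z → u :* (y :- z) := u :* (k :- z) :- u :* (k :- y)) refl unit K Y Z ⟩
    unit * (K - Z) - unit * (K - Y)
      ≤⟨ +-mono-≤ 2loss (-‿mono 2opt) ⟩
    fromℕ 2 * loss p (input c) x - fromℕ 2 * opt c
      ≤⟨ +-mono-≤ (*-monoˡ-≤ (fromℕ-nonNeg 2) (accurate (opt c) (optimum c) (isOPT c) (isReference c))) ≤-refl ⟩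
    fromℕ 2 * (opt c + ε * (opt c + size p (input c) (optimum c))) - fromℕ 2 * opt c
      ≈⟨ solve 3 (λ o e s → :n 2 :* (o :+ e :* (o :+ s)) :- :n 2 :* o := e :* (:n 2 :* o :+ :n 2 :* s)) refl (opt c) ε _ ⟩
    ε * (fromℕ 2 * opt c + fromℕ 2 * size p (input c) (optimum c))
      ≤⟨ *-monoˡ-≤ (proj₁ 0<ε) (+-mono-≤ 2opt≤ (*-monoˡ-≤ (fromℕ-nonNeg 2) size≤)) ⟩
    ε * (unit * K + fromℕ 2 * (K * reach))
      ≈⟨ solve 4 (λ e u k r → e :* (u :* k :+ :n 2 :* (k :* r)) := e :* k :* (u :+ :n 2 :* r)) refl ε unit K reach ⟩
    ε * K * (unit + fromℕ 2 * reach) ∎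
    where
    Y = absSum c
    Z = correlation (decide x) c
    K = fromℕ d * fromℕ m

    -‿mono : ∀ {u v} → u ≈ v → - v ≤ - u
    -‿mono u≈v = ≤-reflexive (-‿cong (sym u≈v))

    2opt : fromℕ 2 * opt c ≈ unit * (K - Y)
    2opt = trans (2-sum-misses (λ j → best (Vec.lookup c j)) c)
      (*-congˡ (+-congˡ (-‿cong (trans (sum-cong {d} (λ j → best-sign (Vec.lookup c j))) (sum-absSum c)))))

    2loss : unit * (K - Z) ≤ fromℕ 2 * loss p (input c) x
    2loss = begin
      unit * (K - Z)
        ≈⟨ *-congˡ (+-congˡ (-‿cong (sym (sum-correlation (choose ∘ x) c)))) ⟩
      _ ≈⟨ sym (2-sum-misses (choose ∘ x) c) ⟩
      _ ≤⟨ *-monoˡ-≤ (fromℕ-nonNeg 2) (sum-mono (λ j → block-lower (x j) (Vec.lookup c j))) ⟩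
      _ ≈⟨ *-congˡ (sym (loss-blocks c x)) ⟩
      fromℕ 2 * loss p (input c) x ∎

    0≤Y : 0# ≤ Y
    0≤Y = ≤-respʳ-≈ (sum-absSum c) (sum-nonNeg (λ j → ∣x∣-nonNeg (signSum (Vec.lookup c j))))

    2opt≤ : fromℕ 2 * opt c ≤ unit * K
    2opt≤ = ≤-respˡ-≈ (sym 2opt) (*-monoˡ-≤ (proj₁ 0<unit) (≤-slack 0≤Y (solve 2 (λ k y → k :- y :+ y := k) refl K Y)))

    size≤ : size p (input c) (optimum c) ≤ K * reach
    size≤ = begin
      size p (input c) (optimum c)             ≈⟨ size-blocks c (optimum c) ⟩
      sum (λ j → extent (optimum c j))         ≤⟨ sum-mono (λ j → extent-target (best (Vec.lookup c j))) ⟩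
      sum {d} (λ _ → fromℕ m * reach)          ≈⟨ trans (sum-const d _) (sym (*-assoc _ _ _)) ⟩
      K * reach                                ∎

-- Choice of constants and the lower bound

module LowerBound (em : ∀ {ℓ} → ExcludedMiddle ℓ) (F : CompleteOrderedField)
                  (p : CompleteOrderedField.Carrier F) where

  open Regression em F
  open OrderedFieldProperties em F
  open RealPower em F
  open Averaging em F
  open SignSums em F
  open PartialKnowledge
  open AdaptiveQueries em F using (adaptive-bound; energy-nothingKnown; correlation)

  -- These do not depend on the dimensions.
  open HardInstance em F p 0 0 0 using (unit; 0<unit; reach; 0≤reach)

  -- Converts relative accuracy into sign sums: an ε-accurate output loses at most κ ε d m of the
  -- correlation.
  κ : ℝ
  κ = (unit + fromℕ 2 * reach) / unit

  unit*κ : unit * κ ≈ unit + fromℕ 2 * reach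
  unit*κ = y*[x/y]≈x 0<unit

  0<κ : 0# < κ
  0<κ = /-pos (+-pos 0<unit (*-nonNeg (fromℕ-nonNeg 2) 0≤reach)) 0<unit

  -- Each of the three error terms of the adaptive bound is made at most w d s; in the end it
  -- suffices that 60 w < 1.
  w : ℝ
  w = 1# / fromℕ 64

  0<w : 0# < w
  0<w = /-pos 0<1 (fromℕ-pos 63)

  64w≈1 : fromℕ 64 * w ≈ 1#
  64w≈1 = y*[x/y]≈x (fromℕ-pos 63)

  0<2κ : 0# < fromℕ 2 * κ
  0<2κ = *-pos (fromℕ-pos 1) 0<κ

  -- With m ≤ s² and ε s = θ the tolerance κ ε d m is at most κ θ d s; this choice makes twice that
  -- equal to w d s.
  θ : ℝ
  θ = w / (fromℕ 2 * κ)

  0<θ : 0# < θ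
  0<θ = /-pos 0<w 0<2κ

  2κθ≈w : fromℕ 2 * κ * θ ≈ w
  2κθ≈w = y*[x/y]≈x 0<2κ

  -- The query budget is w² d s² with s = θ / ε. The bit and barrier rows number 2dm ≤ 2d s², and d
  -- ≤ 2 d log d for d ≥ 2, which gives the factor 4. The threshold makes s ≥ 7, so that rounding s²
  -- to an integer is harmless.
  lowerConstant sizeConstant threshold : ℝ
  lowerConstant = θ * θ * (w * w)
  sizeConstant  = fromℕ 4 * (θ * θ)
  threshold     = θ / fromℕ 7

  scale : ℝ → ℝ
  scale ε = θ / ε

  -- The block length m is s² up to rounding, so that sign sums have typical size s = θ / ε.
  module _ {ε : ℝ} (0<ε : 0# < ε) (ε≤ : ε ≤ threshold) {d : ℕ} (2≤d : 2 ℕ.≤ d) {m : ℕ}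
           (m≤s² : fromℕ m ≤ scale ε * scale ε) (s²<1+m : scale ε * scale ε < fromℕ (suc m)) where

    private
      s = scale ε
      D = fromℕ d
      M = fromℕ m

      0<D : 0# < D
      0<D = <-≤-trans (fromℕ-pos 1) (fromℕ-mono 2≤d)

      0<s : 0# < s
      0<s = /-pos 0<θ 0<ε

      εs≈θ : ε * s ≈ θ
      εs≈θ = y*[x/y]≈x 0<ε

      7≤s : fromℕ 7 ≤ s
      7≤s = x≤y/z 0<ε (≤-respˡ-≈ (*-comm _ _) (z*y≤x (fromℕ-pos 6) ε≤))

    -- Rounding loses less than 1, and 35 (s² - 1) - 32 s² = 3s² - 35 ≥ 3 · 49 - 35 = 112.
    32s²≤35m : fromℕ 32 * (s * s) ≤ fromℕ 35 * M
    32s²≤35m = ≤-slack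
      (+-nonNeg (+-nonNeg
        (*-nonNeg (fromℕ-nonNeg 35) (x≤y⇒0≤y-x (≤-respʳ-≈ (+-congʳ (sym fromℕ-1)) (proj₁ s²<1+m))))
        (*-nonNeg (fromℕ-nonNeg 3) (x≤y⇒0≤y-x (*-mono-≤ (fromℕ-nonNeg 7) (fromℕ-nonNeg 7) 7≤s 7≤s))))
        (fromℕ-nonNeg 112))
      (solve 2 (λ s m → :n 32 :* (s :* s) :+ (:n 35 :* (:n 1 :+ m :- s :* s) :+ :n 3 :* (s :* s :- :n 7 :* :n 7) :+ :n 112)
        := :n 35 :* m) refl s M)

    queryBound : ℝ
    queryBound = lowerConstant * D / (ε ^ 2)

    0<ε² : 0# < ε ^ 2
    0<ε² = *-pos 0<ε (*-pos 0<ε 0<1)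

    ε²s²≈θ² : ε ^ 2 * (s * s) ≈ θ * θ
    ε²s²≈θ² = begin-equality
      ε * (ε * 1#) * (s * s)  ≈⟨ *-congʳ (*-congˡ (*-identityʳ ε)) ⟩
      ε * ε * (s * s)         ≈⟨ solve 2 (λ e s → e :* e :* (s :* s) := e :* s :* (e :* s)) refl ε s ⟩
      ε * s * (ε * s)         ≈⟨ *-cong εs≈θ εs≈θ ⟩
      θ * θ                   ∎

    queryBound≤ : queryBound ≤ w * s * (w * (D * s))
    queryBound≤ = x/z≤y 0<ε² (≤-reflexive (begin-equality
      θ * θ * (w * w) * D               ≈⟨ *-congʳ (*-congʳ (sym ε²s²≈θ²)) ⟩
      ε ^ 2 * (s * s) * (w * w) * D     ≈⟨ solve 4 (λ e s w d → e :* (s :* s) :* (w :* w) :* d := e :* (w :* s :* (w :* (d :* s)))) refl (ε ^ 2) s w D ⟩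
      ε ^ 2 * (w * s * (w * (D * s)))   ∎))

    -- Here the lower bound on n enters: it leaves room for all bit and barrier rows, and the rest
    -- of the n rows are idle.
    rows-fit : ∀ {n} → sizeConstant * (D * log D) / (ε ^ 2) ≤ fromℕ n → d ℕ.* m ℕ.+ d ℕ.* m ℕ.≤ n
    rows-fit {n} size≤n = fromℕ-cancel-≤ (d ℕ.* m ℕ.+ d ℕ.* m) n (≤-trans
      (≤-respˡ-≈ (sym (trans (fromℕ-+ (d ℕ.* m) (d ℕ.* m)) (+-cong (fromℕ-* d m) (fromℕ-* d m))))
        (x≤y/z 0<ε² (begin
          ε ^ 2 * (D * M + D * M)
            ≤⟨ *-monoˡ-≤ (proj₁ 0<ε²) (+-mono-≤ DM≤ DM≤) ⟩
          ε ^ 2 * (D * (s * s) + D * (s * s))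
            ≈⟨ solve 3 (λ e D s → e :* (D :* s :+ D :* s) := :n 2 :* (e :* s) :* D) refl (ε ^ 2) D (s * s) ⟩
          fromℕ 2 * (ε ^ 2 * (s * s)) * D
            ≈⟨ *-congʳ (*-congˡ ε²s²≈θ²) ⟩
          fromℕ 2 * (θ * θ) * D
            ≈⟨ *-congʳ (*-congʳ (sym (trans (solve 1 (λ h → :n 4 :* h := :n 2 :* (:n 2 :* h)) refl ½) (trans (*-congˡ 2½≈1) (*-identityʳ _))))) ⟩
          fromℕ 4 * ½ * (θ * θ) * D
            ≈⟨ solve 3 (λ h t D → :n 4 :* h :* t :* D := :n 4 :* t :* (D :* h)) refl ½ (θ * θ) D ⟩
          sizeConstant * (D * ½)
            ≤⟨ *-monoˡ-≤ (*-nonNeg (fromℕ-nonNeg 4) (square-nonNeg θ)) (*-monoˡ-≤ (proj₁ 0<D) (½≤log (fromℕ-mono 2≤d))) ⟩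
          sizeConstant * (D * log D) ∎)))
      size≤n)
      where
      DM≤ : D * M ≤ D * (s * s)
      DM≤ = *-monoˡ-≤ (proj₁ 0<D) m≤s²

    private
      β = ½ * meanAbs m
      a = (fromℕ 2 * D + fromℕ 5) * β
      -- The balance in AM-GM: `D * h` equals w D s, and `g` times the query budget is at most w D s
      -- as well.
      h = w * s
      g = h ⁻¹
      t = κ * θ * (D * s)

      2β : meanAbs m ≈ fromℕ 2 * β
      2β = sym (trans (solve 2 (λ h x → :n 2 :* (h :* x) := h :* (:n 2 :* x)) refl ½ (meanAbs m)) (2*½*x≈x _))

      s≤4β : s ≤ fromℕ 4 * β
      s≤4β = ≤-trans (s≤2meanAbs {m} 0<s m≤s² 32s²≤35m) (≤-reflexive (trans (*-congˡ 2β)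
        (solve 1 (λ b → :n 2 :* (:n 2 :* b) := :n 4 :* b) refl β)))

      0<β : 0# < β
      0<β = *-cancelˡ-< (<-≤-trans 0<s s≤4β)
        where
        *-cancelˡ-< : 0# < fromℕ 4 * β → 0# < β
        *-cancelˡ-< 0<4β = ≰⇒> λ β≤0 → <⇒≱ 0<4β (≤-respʳ-≈ (zeroʳ _) (*-monoˡ-≤ (fromℕ-nonNeg 4) β≤0))

      0<a : 0# < a
      0<a = *-pos (+-pos (*-pos (fromℕ-pos 1) 0<D) (fromℕ-nonNeg 5)) 0<β

      0<h : 0# < h
      0<h = *-pos 0<w 0<s

      gh≈1 : g * h ≈ 1#
      gh≈1 = trans (*-comm g h) (*-inverse-pos 0<h)

      0≤t : 0# ≤ t
      0≤t = proj₁ (*-pos (*-pos 0<κ 0<θ) (*-pos 0<D 0<s))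

      2t≈wDs : fromℕ 2 * t ≈ w * (D * s)
      2t≈wDs = trans (solve 3 (λ k t x → :n 2 :* (k :* t :* x) := :n 2 :* k :* t :* x) refl κ θ (D * s)) (*-congʳ 2κθ≈w)

    -- Divided by `a`, the claim is 25β + 15 w D s < 3a, that is 15 w D s < (6D - 10) β. For D ≥ 2
    -- the right side is at least D β, and s ≤ 4β bounds the left side by 60 w D β. Without the
    -- terms in w the success probability is bounded by (1 + 5 / (2d + 5)) / 2, which is 6/7 for d =
    -- 1 but 7/9 for d = 2.
    margin : a * a + fromℕ 5 * (β * a) + a * (fromℕ 3 * (w * (D * s))) < fromℕ 2 * (a * a) * (fromℕ 4 / fromℕ 5)
    margin = ≰⇒> λ bound → <⇒≱ (*-pos (fromℕ-pos 3) 0<wDs) (≤-slack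
      (+-nonNeg (+-nonNeg
        (*-nonNeg (fromℕ-nonNeg 4) (x≤y⇒0≤y-x (cancelled bound)))
        (*-nonNeg (*-nonNeg (fromℕ-nonNeg 20) (proj₁ 0<β)) (x≤y⇒0≤y-x (fromℕ-mono 2≤d))))
        (x≤y⇒0≤y-x Ds≤))
      (solve 3 (λ D b x → let a = (:n 2 :* D :+ :n 5) :* b in
        :n 4 :* x :+ (:n 4 :* (:n 5 :* a :+ :n 25 :* b :+ :n 15 :* x :- :n 8 :* a)
                      :+ :n 20 :* b :* (D :- :n 2) :+ (D :* (:n 4 :* b) :- :n 64 :* x)) := :n 0)
        refl D β (w * (D * s))))
      where
      0<wDs : 0# < w * (D * s)
      0<wDs = *-pos 0<w (*-pos 0<D 0<s)

      Ds≤ : fromℕ 64 * (w * (D * s)) ≤ D * (fromℕ 4 * β)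
      Ds≤ = ≤-trans (≤-reflexive (trans (sym (*-assoc _ _ _)) (trans (*-congʳ 64w≈1) (*-identityˡ _))))
        (*-monoˡ-≤ (proj₁ 0<D) s≤4β)

      5*[4/5] : fromℕ 5 * (fromℕ 4 / fromℕ 5) ≈ fromℕ 4
      5*[4/5] = y*[x/y]≈x (fromℕ-pos 4)

      cancelled : fromℕ 2 * (a * a) * (fromℕ 4 / fromℕ 5) ≤ a * a + fromℕ 5 * (β * a) + a * (fromℕ 3 * (w * (D * s))) →
                  fromℕ 8 * a ≤ fromℕ 5 * a + fromℕ 25 * β + fromℕ 15 * (w * (D * s))
      cancelled bound = *-cancelˡ-≤ 0<a (begin
        a * (fromℕ 8 * a)
          ≈⟨ solve 1 (λ a → a :* (:n 8 :* a) := :n 2 :* (a :* a) :* :n 4) refl a ⟩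
        fromℕ 2 * (a * a) * fromℕ 4
          ≈⟨ *-congˡ (sym 5*[4/5]) ⟩
        fromℕ 2 * (a * a) * (fromℕ 5 * (fromℕ 4 / fromℕ 5))
          ≈⟨ solve 2 (λ a q → :n 2 :* (a :* a) :* (:n 5 :* q) := :n 5 :* (:n 2 :* (a :* a) :* q)) refl a (fromℕ 4 / fromℕ 5) ⟩
        fromℕ 5 * (fromℕ 2 * (a * a) * (fromℕ 4 / fromℕ 5))
          ≤⟨ *-monoˡ-≤ (fromℕ-nonNeg 5) bound ⟩
        fromℕ 5 * (a * a + fromℕ 5 * (β * a) + a * (fromℕ 3 * (w * (D * s))))
          ≈⟨ solve 3 (λ a b x → :n 5 :* (a :* a :+ :n 5 :* (b :* a) :+ a :* (:n 3 :* x)) := a :* (:n 5 :* a :+ :n 25 :* b :+ :n 15 :* x)) refl a β (w * (D * s)) ⟩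
        a * (fromℕ 5 * a + fromℕ 25 * β + fromℕ 15 * (w * (D * s))) ∎)

    module _ (r : ℕ) where

      open HardInstance em F p m d r using (input; hasOPT; source; matrix; decide; accurate⇒correlated)
      open BumpFunction em F using (bumpLip)

      correlated : ∀ x c → IsAccurate p (input c) ε x → absSum c - correlation (decide x) c ≤ t
      correlated x c accurate = *-cancelˡ-≤ 0<unit (begin
        unit * (absSum c - correlation (decide x) c)
          ≤⟨ accurate⇒correlated 0<ε x c accurate ⟩
        ε * (D * M) * (unit + fromℕ 2 * reach)
          ≈⟨ *-congˡ (sym unit*κ) ⟩
        ε * (D * M) * (unit * κ)
          ≤⟨ *-monoʳ-≤ (proj₁ (*-pos 0<unit 0<κ)) (*-monoˡ-≤ (proj₁ 0<ε) (*-monoˡ-≤ (proj₁ 0<D) m≤s²)) ⟩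
        ε * (D * (s * s)) * (unit * κ)
          ≈⟨ solve 5 (λ e D s u k → e :* (D :* (s :* s)) :* (u :* k) := u :* (k :* (e :* s) :* (D :* s))) refl ε D s unit κ ⟩
        unit * (κ * (ε * s) * (D * s))
          ≈⟨ *-congˡ (*-congʳ (*-congˡ εs≈θ)) ⟩
        unit * t ∎)

      few-queries : ∀ (tree : QueryTree _ ℝ (Vector ℝ d)) →
        (∀ c → fromℕ (queryCount tree (Input.b (input c))) ≤ queryBound) →
        fromℕ 2 * (a * a) * 𝔼 (blocks m d) (λ c → 𝟙 (IsAccurate p (input c) ε (result tree (Input.b (input c)))))
          ≤ a * a + fromℕ 5 * (β * a) + a * (fromℕ 3 * (w * (D * s)))
      few-queries tree count = begin
        fromℕ 2 * (a * a) * 𝔼 (blocks m d) win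
          ≈⟨ *-congˡ (𝔼-cong (blocks m d) λ c → reflexive (≡.cong win (≡.sym (overrideAll-nothingKnown c)))) ⟩
        fromℕ 2 * (a * a) * 𝔼 (blocks m d) (win ∘ overrideAll ρ)
          ≤⟨ adaptive-bound (⁻¹-pos 0<h) 0<h gh≈1 source (λ x c → IsAccurate p (input c) ε x) decide 0≤t 0<a correlated
               tree ρ queryBound (λ c → ≡.subst (λ c → fromℕ (queryCount tree (Input.b (input c))) ≤ queryBound)
                                          (≡.sym (overrideAll-nothingKnown c)) (count c)) ⟩
        a * a + 𝔼 (blocks m d) (deviation a ∘ overrideAll ρ) + a * (fromℕ 2 * t + (g * (energy₀ + queryBound) + D * h))
          ≤⟨ +-mono-≤ (+-monoʳ-≤ (a * a) deviation≤) (*-monoˡ-≤ (proj₁ 0<a) slack≤) ⟩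
        a * a + fromℕ 5 * (β * a) + a * (fromℕ 3 * (w * (D * s))) ∎
        where
        win = λ c → 𝟙 (IsAccurate p (input c) ε (result tree (Input.b (input c))))
        ρ   = nothingKnown m d
        energy₀ = AdaptiveQueries.energy em F ρ

        deviation≤ : 𝔼 (blocks m d) (deviation a ∘ overrideAll ρ) ≤ fromℕ 5 * (β * a)
        deviation≤ = ≤-trans
          (≤-reflexive (𝔼-cong (blocks m d) λ c → reflexive (≡.cong (deviation a) (overrideAll-nothingKnown c))))
          (deviation-bound m d β 2β (2m≤7meanAbs² {m} 0<s m≤s² 32s²≤35m))

        slack≤ : fromℕ 2 * t + (g * (energy₀ + queryBound) + D * h) ≤ fromℕ 3 * (w * (D * s))
        slack≤ = begin
          fromℕ 2 * t + (g * (energy₀ + queryBound) + D * h)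
            ≤⟨ +-mono-≤ (≤-reflexive 2t≈wDs) (+-mono-≤ (*-monoˡ-≤ (proj₁ (⁻¹-pos 0<h))
                 (+-mono-≤ (≤-reflexive (energy-nothingKnown m d)) queryBound≤)) ≤-refl) ⟩
          w * (D * s) + (g * (0# + h * (w * (D * s))) + D * h)
            ≈⟨ solve 5 (λ w D s g h → w :* (D :* s) :+ (g :* (:n 0 :+ h :* (w :* (D :* s))) :+ D :* (w :* s))
                 := w :* (D :* s) :+ (g :* h :* (w :* (D :* s)) :+ w :* (D :* s))) refl w D s g h ⟩
          w * (D * s) + (g * h * (w * (D * s)) + w * (D * s))
            ≈⟨ +-congˡ (+-congʳ (trans (*-congʳ gh≈1) (*-identityˡ _))) ⟩
          w * (D * s) + (w * (D * s) + w * (D * s))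
            ≈⟨ solve 1 (λ x → x :+ (x :+ x) := :n 3 :* x) refl (w * (D * s)) ⟩
          fromℕ 3 * (w * (D * s)) ∎

      -- If no table of bits served, reaching the query bound would be a null event for each of the
      -- finitely many tables. Outside one common null set the tree would then stay within the
      -- budget on all tables, and `few-queries` would contradict the average success 4/5.
      hard-input : (𝒜 : RandomizedAlgorithm (d ℕ.* m ℕ.+ (d ℕ.* m ℕ.+ r)) d) → RandomizedAlgorithm.Solves 𝒜 p ε →
                   ∃[ I ] HasOPT p I × RandomizedAlgorithm.MakesAtLeast 𝒜 queryBound I
      hard-input 𝒜 solves with em {P = ∃[ I ] HasOPT p I × RandomizedAlgorithm.MakesAtLeast 𝒜 queryBound I}
      ... | yes found = found
      ... | no  none  = contradiction (z*y≤x 0<2a² average) (<⇒≱ margin)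
        where
        open RandomizedAlgorithm 𝒜
        open Probability space using (averaging; Vec-Null-⋃; Bool-Null-⋃)

        0<2a² : 0# < fromℕ 2 * (a * a)
        0<2a² = *-pos (fromℕ-pos 1) (*-pos 0<a 0<a)

        null : ∀ c → Null (λ ω → queryBound ≤ fromℕ (queries (input c) ω))
        null c with em {P = Null (λ ω → queryBound ≤ fromℕ (queries (input c) ω))}
        ... | yes null = null
        ... | no ¬null = contradiction (input c , hasOPT c , ¬null) none

        average : fromℕ 4 / fromℕ 5 ≤ (a * a + fromℕ 5 * (β * a) + a * (fromℕ 3 * (w * (D * s)))) / (fromℕ 2 * (a * a))
        average = averaging (blocks m d) (Vec-Null-⋃ (Vec-Null-⋃ Bool-Null-⋃ m) d)
          (λ c → solves (input c) (hasOPT c)) null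
          λ ω few → x≤y/z 0<2a² (few-queries (tree matrix bumpLip ω)
            λ c → [ id , (λ many → ⊥-elim (few c many)) ]′ (≤-total (fromℕ (queries (input c) ω)) queryBound))

  lower-bound : ∀ {ε} → 0# < ε → ε ≤ threshold → ∀ {n d} → 2 ℕ.≤ d →
    sizeConstant * (fromℕ d * log (fromℕ d)) / (ε ^ 2) ≤ fromℕ n →
    (𝒜 : RandomizedAlgorithm n d) → RandomizedAlgorithm.Solves 𝒜 p ε →
    ∃[ I ] HasOPT p I × RandomizedAlgorithm.MakesAtLeast 𝒜 (lowerConstant * fromℕ d / (ε ^ 2)) I
  lower-bound {ε} 0<ε ε≤ {n} {d} 2≤d n-large = at-length (floor (scale ε * scale ε) (square-nonNeg (scale ε)))
    where
    Conclusion : ℕ → Set₁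
    Conclusion n = (𝒜 : RandomizedAlgorithm n d) → RandomizedAlgorithm.Solves 𝒜 p ε →
      ∃[ I ] HasOPT p I × RandomizedAlgorithm.MakesAtLeast 𝒜 (lowerConstant * fromℕ d / (ε ^ 2)) I

    at-length : ∃[ m ] fromℕ m ≤ scale ε * scale ε × scale ε * scale ε < fromℕ (suc m) → Conclusion n
    at-length (m , m≤s² , s²<1+m) = ≡.subst Conclusion
      (≡.trans (≡.sym (ℕ.+-assoc (d ℕ.* m) (d ℕ.* m) r)) (ℕ.m+[n∸m]≡n (rows-fit 0<ε ε≤ 2≤d m≤s² s²<1+m n-large)))
      (hard-input 0<ε ε≤ 2≤d m≤s² s²<1+m r)
      where r = n ℕ.∸ (d ℕ.* m ℕ.+ d ℕ.* m)

theorem2 : (em : ∀ {ℓ} → ExcludedMiddle ℓ) (F : CompleteOrderedField) →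
    let open Regression em F in
    (p : ℝ) → 1# ≤ p →
    ∃[ c ] ∃[ C ] 0# < c × 0# < C ×
    (∃[ ε₀ ] 0# < ε₀ ×
    (∀ (ε : ℝ) → 0# < ε → ε ≤ ε₀ →
    ∀ (n d : ℕ) → 2 ℕ.≤ d →
    C * (fromℕ d * log (fromℕ d)) / (ε ^ 2) ≤ fromℕ n →
    (𝒜 : RandomizedAlgorithm n d) → RandomizedAlgorithm.Solves 𝒜 p ε →
    ∃[ I ] HasOPT p I × RandomizedAlgorithm.MakesAtLeast 𝒜 (c * fromℕ d / (ε ^ 2)) I))
theorem2 em F p _ =
    lowerConstant , sizeConstant
  , *-pos (*-pos 0<θ 0<θ) (*-pos 0<w 0<w)
  , *-pos (fromℕ-pos 3) (*-pos 0<θ 0<θ)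
  , threshold , /-pos 0<θ (fromℕ-pos 6)
  , λ ε 0<ε ε≤ε₀ n d → lower-bound 0<ε ε≤ε₀
  where
  open Regression em F
  open OrderedFieldProperties em F using (*-pos; /-pos; fromℕ-pos)
  open LowerBound em F p
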